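{- Let $\Gamma_1=(G_1,\sigma_1)$ be a signed bipartite graph of order $n$ with exactly two distinct eigenvalues $\pm\theta_1$, and let $\Gamma_2=(G_2,\sigma_2)$ be a signed graph of order $m$ with exactly two distinct eigenvalues $\pm\theta_2$. If $H$ and $H'$ are arbitrary $(\frac{mn}{2}+1)$-vertex induced subgraphs of the signed Cartesian product $\Gamma_1\widetilde{\Box}\Gamma_2$ and of the signed semi-strong product $\Gamma_1\widetilde{\bowtie}\Gamma_2$, respectively, then $$\Delta(H)\geq\sqrt{\theta_1^2+\theta_2^2},\qquad \Delta(H')\geq\sqrt{(\theta_1^2+1)\theta_2^2}.$$
   Context: A signed graph $\Gamma=(G,\sigma)$ is a finite simple undirected graph $G$ together with a map $\sigma:E(G)\to\{+1,-1\}$. Its adjacency matrix $A(\Gamma)$ is the real symmetric matrix indexed by $V(G)$ whose $(u,v)$ entry is $\sigma(uv)$ if $u,v$ are adjacent and $0$ otherwise. The eigenvalues (spectrum) of $\Gamma$ are those of $A(\Gamma)$. Graph notions (order, bipartite, induced subgraph, maximum degree $\Delta$) refer to the underlying graph $G$. A signed bipartite graph $\Gamma_1$ of order $n$ is taken with a fixed bipartition $(V_1,V_2)$, $|V_1|=s$ (unique up to interchanging the classes when the graph is connected). Labeling the vertices of $V_1$ first, $A(\Gamma_1)=\begin{bmatrix}O_s&P\\P^T&O_{n-s}\end{bmatrix}$. For a signed graph $\Gamma_2$ of order $m$, the signed Cartesian product $\Gamma_1\widetilde{\Box}\Gamma_2$ and the signed semi-strong product $\Gamma_1\widetilde{\bowtie}\Gamma_2$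 are the signed graphs on $V(G_1)\times V(G_2)$ with adjacency matrices $$A(\Gamma_1\widetilde{\Box}\Gamma_2)=A(\Gamma_1)\otimes I_m+\begin{bmatrix}I_s&O\\O&-I_{n-s}\end{bmatrix}\otimes A(\Gamma_2),\qquad A(\Gamma_1\widetilde{\bowtie}\Gamma_2)=\begin{bmatrix}I_s&P\\P^T&-I_{n-s}\end{bmatrix}\otimes A(\Gamma_2),$$ where $\otimes$ is the Kronecker product. -}

module Defs where

open import Data.Bool.Base using (Bool; true; false; T; not; if_then_else_)
open import Data.Empty using (⊥-elim)
open import Data.Fin.Base using (Fin)
open import Data.Fin.Properties using () renaming (_≟_ to _≟ᶠ_)
open import Data.Fin.Subset using (∣_∣)
open import Data.Integer.Base as ℤ using (ℤ; +_; -[1+_]; 0ℤ; 1ℤ; -1ℤ; _◃_; sign)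
import Data.Integer.Properties as ℤ
open import Data.Nat.Base as ℕ using (ℕ; zero; suc; z≤n; s≤s; _⊔_)
import Data.Nat.Properties as ℕ
open import Data.Product.Base using (∃-syntax; _×_; _,_; proj₁; proj₂)
open import Data.Rational.Base as ℚ using (ℚ; 0ℚ; 1ℚ; ½)
import Data.Rational.Properties as ℚ
open import Data.Rational.Solver using (module +-*-Solver)
open import Data.Sign.Base using (Sign)
open import Data.Sum.Base using (_⊎_; inj₁; inj₂)
open import Data.Vec.Base using (tabulate)
import Data.Vec.Functional as Vector
open import Function.Bundles using (_⇔_; _↣_; Injection)
open import Relation.Binary.PropositionalEquality
open import Relation.Nullary.Decidable using (yes; no; ⌊_⌋)
open import Relation.Nullary.Negation using (¬_)

-- A real number is a Cauchy sequence of rationals; equality of reals is _≈ᴿ_, not _≡_.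
record ℝ : Set where
  constructor mkℝ
  field
    seq    : ℕ → ℚ
    cauchy : ∀ ε → 0ℚ ℚ.< ε →
             ∃[ N ] (∀ m n → N ℕ.≤ m → N ℕ.≤ n → ℚ.∣ seq m ℚ.- seq n ∣ ℚ.< ε)

open ℝ public

infix  4 _≈ᴿ_ _≤ᴿ_
infixl 6 _+ᴿ_
infixl 7 _*ᴿ_
infix  8 -ᴿ_

_≈ᴿ_ : ℝ → ℝ → Set
x ≈ᴿ y = ∀ ε → 0ℚ ℚ.< ε →
         ∃[ N ] (∀ n → N ℕ.≤ n → ℚ.∣ seq x n ℚ.- seq y n ∣ ℚ.< ε)

_≤ᴿ_ : ℝ → ℝ → Set
x ≤ᴿ y = ∀ ε → 0ℚ ℚ.< ε →
         ∃[ N ] (∀ n → N ℕ.≤ n → seq x n ℚ.< seq y n ℚ.+ ε)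

fromℚ : ℚ → ℝ
fromℚ q = mkℝ (λ _ → q) λ ε 0<ε → 0 , λ _ _ _ _ →
  subst (ℚ._< ε) (sym (cong ℚ.∣_∣ (ℚ.+-inverseʳ q))) 0<ε

fromℤ : ℤ → ℝ
fromℤ z = fromℚ (z ℚ./ 1)

fromℕ : ℕ → ℝ
fromℕ n = fromℤ (+ n)

0ᴿ : ℝ
0ᴿ = fromℚ 0ℚ

-ᴿ_ : ℝ → ℝ
-ᴿ x = mkℝ (λ n → ℚ.- seq x n) λ ε 0<ε →
  let N , close = cauchy x ε 0<ε
  in N , λ m n N≤m N≤n →
    subst (ℚ._< ε)
      (trans (sym (ℚ.∣-p∣≡∣p∣ (seq x m ℚ.- seq x n)))
             (cong ℚ.∣_∣ (ℚ.neg-distrib-+ (seq x m) (ℚ.- seq x n))))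
      (close m n N≤m N≤n)

_+ᴿ_ : ℝ → ℝ → ℝ
x +ᴿ y = mkℝ (λ n → seq x n ℚ.+ seq y n) λ ε 0<ε →
  let 0<½ε : 0ℚ ℚ.< ½ ℚ.* ε
      0<½ε = subst (ℚ._< ½ ℚ.* ε) (ℚ.*-zeroʳ ½) (ℚ.*-monoʳ-<-pos ½ 0<ε)
      M , closeˣ = cauchy x (½ ℚ.* ε) 0<½ε
      N , closeʸ = cauchy y (½ ℚ.* ε) 0<½ε
  in M ⊔ N , λ m n le₁ le₂ → begin-strict
       ℚ.∣ (seq x m ℚ.+ seq y m) ℚ.- (seq x n ℚ.+ seq y n) ∣
         ≡⟨ cong ℚ.∣_∣ (regroup (seq x m) (seq y m) (seq x n) (seq y n)) ⟩
       ℚ.∣ (seq x m ℚ.- seq x n) ℚ.+ (seq y m ℚ.- seq y n) ∣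
         ≤⟨ ℚ.∣p+q∣≤∣p∣+∣q∣ (seq x m ℚ.- seq x n) (seq y m ℚ.- seq y n) ⟩
       ℚ.∣ seq x m ℚ.- seq x n ∣ ℚ.+ ℚ.∣ seq y m ℚ.- seq y n ∣
         <⟨ ℚ.+-mono-<
              (closeˣ m n (ℕ.m⊔n≤o⇒m≤o M N le₁) (ℕ.m⊔n≤o⇒m≤o M N le₂))
              (closeʸ m n (ℕ.m⊔n≤o⇒n≤o M N le₁) (ℕ.m⊔n≤o⇒n≤o M N le₂)) ⟩
       ½ ℚ.* ε ℚ.+ ½ ℚ.* ε
         ≡⟨ ℚ.*-distribʳ-+ ε ½ ½ ⟨
       1ℚ ℚ.* ε
         ≡⟨ ℚ.*-identityˡ ε ⟩
       ε ∎
  where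
  open ℚ.≤-Reasoning
  regroup : ∀ a b c d → (a ℚ.+ b) ℚ.- (c ℚ.+ d) ≡ (a ℚ.- c) ℚ.+ (b ℚ.- d)
  regroup = solve 4 (λ a b c d → (a :+ b) :- (c :+ d) := (a :- c) :+ (b :- d)) refl
    where open +-*-Solver

eventually-bounded : (x : ℝ) →
  ∃[ B ] (0ℚ ℚ.< B × ∃[ N ] (∀ n → N ℕ.≤ n → ℚ.∣ seq x n ∣ ℚ.≤ B))
eventually-bounded x =
  let N , close = cauchy x 1ℚ (ℚ.positive⁻¹ 1ℚ)
  in 1ℚ ℚ.+ ℚ.∣ seq x N ∣
   , ℚ.+-mono-<-≤ (ℚ.positive⁻¹ 1ℚ) (ℚ.0≤∣p∣ (seq x N))
   , N , λ n N≤n → begin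
       ℚ.∣ seq x n ∣
         ≡⟨ cong ℚ.∣_∣ (split (seq x n) (seq x N)) ⟩
       ℚ.∣ (seq x n ℚ.- seq x N) ℚ.+ seq x N ∣
         ≤⟨ ℚ.∣p+q∣≤∣p∣+∣q∣ (seq x n ℚ.- seq x N) (seq x N) ⟩
       ℚ.∣ seq x n ℚ.- seq x N ∣ ℚ.+ ℚ.∣ seq x N ∣
         ≤⟨ ℚ.+-monoˡ-≤ ℚ.∣ seq x N ∣ (ℚ.<⇒≤ (close n N N≤n ℕ.≤-refl)) ⟩
       1ℚ ℚ.+ ℚ.∣ seq x N ∣ ∎
  where
  open ℚ.≤-Reasoning
  split : ∀ a b → a ≡ (a ℚ.- b) ℚ.+ b
  split = solve 2 (λ a b → a := (a :- b) :+ b) refl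
    where open +-*-Solver

product-close : ∀ a b c d {P Q δ} → 0ℚ ℚ.< P → 0ℚ ℚ.< Q →
  ℚ.∣ a ∣ ℚ.≤ P → ℚ.∣ d ∣ ℚ.≤ Q → ℚ.∣ a ℚ.- c ∣ ℚ.< δ → ℚ.∣ b ℚ.- d ∣ ℚ.< δ →
  ℚ.∣ a ℚ.* b ℚ.- c ℚ.* d ∣ ℚ.< δ ℚ.* (P ℚ.+ Q)
product-close a b c d {P} {Q} {δ} 0<P 0<Q a≤P d≤Q ac<δ bd<δ = begin-strict
  ℚ.∣ a ℚ.* b ℚ.- c ℚ.* d ∣
    ≡⟨ cong ℚ.∣_∣ (regroup a b c d) ⟩
  ℚ.∣ a ℚ.* (b ℚ.- d) ℚ.+ (a ℚ.- c) ℚ.* d ∣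
    ≤⟨ ℚ.∣p+q∣≤∣p∣+∣q∣ (a ℚ.* (b ℚ.- d)) ((a ℚ.- c) ℚ.* d) ⟩
  ℚ.∣ a ℚ.* (b ℚ.- d) ∣ ℚ.+ ℚ.∣ (a ℚ.- c) ℚ.* d ∣
    ≡⟨ cong₂ ℚ._+_ (ℚ.∣p*q∣≡∣p∣*∣q∣ a (b ℚ.- d)) (ℚ.∣p*q∣≡∣p∣*∣q∣ (a ℚ.- c) d) ⟩
  ℚ.∣ a ∣ ℚ.* ℚ.∣ b ℚ.- d ∣ ℚ.+ ℚ.∣ a ℚ.- c ∣ ℚ.* ℚ.∣ d ∣
    ≤⟨ ℚ.+-mono-≤
         (ℚ.*-monoʳ-≤-nonNeg ℚ.∣ b ℚ.- d ∣ {{ℚ.nonNegative (ℚ.0≤∣p∣ (b ℚ.- d))}} a≤P)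
         (ℚ.*-monoˡ-≤-nonNeg ℚ.∣ a ℚ.- c ∣ {{ℚ.nonNegative (ℚ.0≤∣p∣ (a ℚ.- c))}} d≤Q) ⟩
  P ℚ.* ℚ.∣ b ℚ.- d ∣ ℚ.+ ℚ.∣ a ℚ.- c ∣ ℚ.* Q
    <⟨ ℚ.+-mono-<
         (ℚ.*-monoʳ-<-pos P {{ℚ.positive 0<P}} bd<δ)
         (ℚ.*-monoˡ-<-pos Q {{ℚ.positive 0<Q}} ac<δ) ⟩
  P ℚ.* δ ℚ.+ δ ℚ.* Q
    ≡⟨ cong (ℚ._+ δ ℚ.* Q) (ℚ.*-comm P δ) ⟩
  δ ℚ.* P ℚ.+ δ ℚ.* Q
    ≡⟨ ℚ.*-distribˡ-+ δ P Q ⟨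
  δ ℚ.* (P ℚ.+ Q) ∎
  where
  open ℚ.≤-Reasoning
  regroup : ∀ a b c d →
            a ℚ.* b ℚ.- c ℚ.* d ≡ a ℚ.* (b ℚ.- d) ℚ.+ (a ℚ.- c) ℚ.* d
  regroup = solve 4 (λ a b c d → a :* b :- c :* d := a :* (b :- d) :+ (a :- c) :* d) refl
    where open +-*-Solver

divide-pos : ∀ ε B → 0ℚ ℚ.< ε → 0ℚ ℚ.< B → ∃[ δ ] (0ℚ ℚ.< δ × δ ℚ.* B ≡ ε)
divide-pos ε B 0<ε 0<B =
    ε ℚ.* B⁻¹
  , ℚ.positive⁻¹ (ε ℚ.* B⁻¹)
      {{ℚ.pos*pos⇒pos ε {{ℚ.positive 0<ε}} B⁻¹ {{ℚ.1/pos⇒pos B {{ℚ.positive 0<B}}}}}}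
  , trans (ℚ.*-assoc ε B⁻¹ B)
      (trans (cong (ε ℚ.*_) (ℚ.*-inverseˡ B {{B≢0}})) (ℚ.*-identityʳ ε))
  where
  B≢0 : ℚ.NonZero B
  B≢0 = ℚ.pos⇒nonZero B {{ℚ.positive 0<B}}
  B⁻¹ : ℚ
  B⁻¹ = ℚ.1/_ B {{B≢0}}

_*ᴿ_ : ℝ → ℝ → ℝ
x *ᴿ y = mkℝ (λ n → seq x n ℚ.* seq y n) λ ε 0<ε →
  let P , 0<P , M₁ , x≤P = eventually-bounded x
      Q , 0<Q , M₂ , y≤Q = eventually-bounded y
      δ , 0<δ , δ*[P+Q]≡ε = divide-pos ε (P ℚ.+ Q) 0<ε (ℚ.+-mono-< 0<P 0<Q)
      N₁ , closeˣ = cauchy x δ 0<δ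
      N₂ , closeʸ = cauchy y δ 0<δ
      M = M₁ ⊔ M₂
      N = N₁ ⊔ N₂
      M≤ : ∀ {k} → M ⊔ N ℕ.≤ k → M ℕ.≤ k
      M≤ = ℕ.m⊔n≤o⇒m≤o M N
      N≤ : ∀ {k} → M ⊔ N ℕ.≤ k → N ℕ.≤ k
      N≤ = ℕ.m⊔n≤o⇒n≤o M N
  in M ⊔ N , λ m n le₁ le₂ →
    subst (ℚ.∣ seq x m ℚ.* seq y m ℚ.- seq x n ℚ.* seq y n ∣ ℚ.<_) δ*[P+Q]≡ε
      (product-close (seq x m) (seq y m) (seq x n) (seq y n) 0<P 0<Q
        (x≤P m (ℕ.m⊔n≤o⇒m≤o M₁ M₂ (M≤ le₁)))
        (y≤Q n (ℕ.m⊔n≤o⇒n≤o M₁ M₂ (M≤ le₂)))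
        (closeˣ m n (ℕ.m⊔n≤o⇒m≤o N₁ N₂ (N≤ le₁)) (ℕ.m⊔n≤o⇒m≤o N₁ N₂ (N≤ le₂)))
        (closeʸ m n (ℕ.m⊔n≤o⇒n≤o N₁ N₂ (N≤ le₁)) (ℕ.m⊔n≤o⇒n≤o N₁ N₂ (N≤ le₂))))

IsSquareRoot : ℝ → ℝ → Set
IsSquareRoot r x = 0ᴿ ≤ᴿ r × r *ᴿ r ≈ᴿ x

-- All matrices here have integer entries; they act on real vectors through fromℤ.
Matrix : Set → Set
Matrix V = V → V → ℤ

_⊗_ : ∀ {V W} → Matrix V → Matrix W → Matrix (V × W)
(M ⊗ N) (i , k) (j , l) = M i j ℤ.* N k l

_⊕_ : ∀ {V} → Matrix V → Matrix V → Matrix V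
(M ⊕ N) i j = M i j ℤ.+ N i j

diagonal : ∀ {n} → (Fin n → ℤ) → Matrix (Fin n)
diagonal d i j = if ⌊ i ≟ᶠ j ⌋ then d i else 0ℤ

identity : ∀ {n} → Matrix (Fin n)
identity = diagonal (λ _ → 1ℤ)

_*ᵛ_ : ∀ {n} → Matrix (Fin n) → (Fin n → ℝ) → (Fin n → ℝ)
(M *ᵛ v) i = Vector.foldr _+ᴿ_ 0ᴿ (λ j → fromℤ (M i j) *ᴿ v j)

IsEigenvalue : ∀ {n} → Matrix (Fin n) → ℝ → Set
IsEigenvalue {n} M θ = ∃[ v ] (¬ (∀ i → v i ≈ᴿ 0ᴿ) × (∀ i → (M *ᵛ v) i ≈ᴿ θ *ᴿ v i))

HasExactlyTwoEigenvalues± : ∀ {n} → Matrix (Fin n) → ℝ → Set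
HasExactlyTwoEigenvalues± M θ =
  ¬ (θ ≈ᴿ -ᴿ θ) × (∀ t → IsEigenvalue M t ⇔ (t ≈ᴿ θ ⊎ t ≈ᴿ -ᴿ θ))

record SignedGraph (V : Set) : Set where
  field
    adj        : V → V → Bool
    adj-sym    : ∀ u v → adj u v ≡ adj v u
    adj-irrefl : ∀ v → adj v v ≡ false
    σ          : ∀ u v → T (adj u v) → Sign
    σ-sym      : ∀ u v (e : T (adj u v)) (e′ : T (adj v u)) → σ u v e ≡ σ v u e′

open SignedGraph public

signedEntry : (b : Bool) → (T b → Sign) → ℤ
signedEntry false s = 0ℤ
signedEntry true  s = s _ ◃ 1

adjacencyMatrix : ∀ {V} → SignedGraph V → Matrix V
adjacencyMatrix Γ u v = signedEntry (adj Γ u v) (σ Γ u v)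

-- The graph of order k induced by a k-element set of vertices, the set being
-- presented as the image of an injection Fin k ↣ V.
induced : ∀ {V k} → SignedGraph V → (Fin k ↣ V) → SignedGraph (Fin k)
induced Γ f = record
  { adj        = λ i j → adj Γ (to i) (to j)
  ; adj-sym    = λ i j → adj-sym Γ (to i) (to j)
  ; adj-irrefl = λ i → adj-irrefl Γ (to i)
  ; σ          = λ i j → σ Γ (to i) (to j)
  ; σ-sym      = λ i j → σ-sym Γ (to i) (to j)
  }
  where open Injection f using (to)

degree : ∀ {n} → SignedGraph (Fin n) → Fin n → ℕ
degree Γ v = ∣ tabulate (adj Γ v) ∣

Δ : ∀ {n} → SignedGraph (Fin n) → ℕ
Δ Γ = Vector.foldr _⊔_ 0 (degree Γ)

record Bipartition {V : Set} (Γ : SignedGraph V) : Set where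
  field
    inV₁    : V → Bool
    crosses : ∀ u v → T (adj Γ u v) → inV₁ u ≡ not (inV₁ v)

open Bipartition public

-- When the vertices of V₁ are listed first this is the block matrix
-- diag(I , -I); no such ordering of the vertices is assumed.
classSign : ∀ {n} {Γ : SignedGraph (Fin n)} → Bipartition Γ → Matrix (Fin n)
classSign B = diagonal (λ i → if inV₁ B i then 1ℤ else -1ℤ)

record IsSignedAdjacency {V : Set} (M : Matrix V) : Set where
  field
    symmetric : ∀ u v → M u v ≡ M v u
    zero-diag : ∀ v → M v v ≡ 0ℤ
    entries   : ∀ u v → ℤ.∣ M u v ∣ ℕ.≤ 1

fromMatrix : ∀ {V} (M : Matrix V) → IsSignedAdjacency M → SignedGraph V
fromMatrix M isAdj = record
  { adj        = λ u v → not ⌊ M u v ℤ.≟ 0ℤ ⌋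
  ; adj-sym    = λ u v → cong (λ z → not ⌊ z ℤ.≟ 0ℤ ⌋) (symmetric u v)
  ; adj-irrefl = λ v → cong (λ z → not ⌊ z ℤ.≟ 0ℤ ⌋) (zero-diag v)
  ; σ          = λ u v _ → sign (M u v)
  ; σ-sym      = λ u v _ _ → cong sign (symmetric u v)
  }
  where open IsSignedAdjacency isAdj

adjacencyMatrix-fromMatrix : ∀ {V} (M : Matrix V) (isAdj : IsSignedAdjacency M) →
  ∀ u v → adjacencyMatrix (fromMatrix M isAdj) u v ≡ M u v
adjacencyMatrix-fromMatrix M isAdj u v = lemma (M u v) (IsSignedAdjacency.entries isAdj u v)
  where
  lemma : ∀ z → ℤ.∣ z ∣ ℕ.≤ 1 → signedEntry (not ⌊ z ℤ.≟ 0ℤ ⌋) (λ _ → sign z) ≡ z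
  lemma (+ 0)            _        = refl
  lemma (+ 1)            _        = refl
  lemma (+ suc (suc _))  (s≤s ())
  lemma -[1+ 0 ]         _        = refl
  lemma -[1+ suc _ ]     (s≤s ())

adjacencyMatrix-isSignedAdjacency : ∀ {V} (Γ : SignedGraph V) →
  IsSignedAdjacency (adjacencyMatrix Γ)
adjacencyMatrix-isSignedAdjacency Γ = record
  { symmetric = λ u v → entry-cong (adj-sym Γ u v) (σ-sym Γ u v)
  ; zero-diag = λ v → entry-false (adj-irrefl Γ v)
  ; entries   = λ u v → entry-bound (adj Γ u v) (σ Γ u v)
  }
  where
  entry-cong : ∀ {b c} {s : T b → Sign} {t : T c → Sign} → b ≡ c →
               (∀ e e′ → s e ≡ t e′) → signedEntry b s ≡ signedEntry c t
  entry-cong {false} refl _  = refl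
  entry-cong {true}  refl eq = cong (_◃ 1) (eq _ _)

  entry-false : ∀ {b} {s : T b → Sign} → b ≡ false → signedEntry b s ≡ 0ℤ
  entry-false refl = refl

  entry-bound : ∀ b (s : T b → Sign) → ℤ.∣ signedEntry b s ∣ ℕ.≤ 1
  entry-bound false s = z≤n
  entry-bound true  s = ℕ.≤-reflexive (ℤ.abs-◃ (s _) 1)

module _ {n m} (Γ₁ : SignedGraph (Fin n)) (B : Bipartition Γ₁)
         (Γ₂ : SignedGraph (Fin m)) where

  private
    A₁ = adjacencyMatrix Γ₁
    A₂ = adjacencyMatrix Γ₂
    D  = classSign B
    open IsSignedAdjacency
    isA₁ = adjacencyMatrix-isSignedAdjacency Γ₁
    isA₂ = adjacencyMatrix-isSignedAdjacency Γ₂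

    diagonal-sym : ∀ {k} (d : Fin k → ℤ) i j → diagonal d i j ≡ diagonal d j i
    diagonal-sym d i j with i ≟ᶠ j | j ≟ᶠ i
    ... | yes refl | yes _   = refl
    ... | yes refl | no  j≢i = ⊥-elim (j≢i refl)
    ... | no  i≢j  | yes j≡i = ⊥-elim (i≢j (sym j≡i))
    ... | no  _    | no  _   = refl

    diagonal-bound : ∀ {k} (d : Fin k → ℤ) → (∀ i → ℤ.∣ d i ∣ ℕ.≤ 1) →
                     ∀ i j → ℤ.∣ diagonal d i j ∣ ℕ.≤ 1
    diagonal-bound d b i j with i ≟ᶠ j
    ... | yes _ = b i
    ... | no  _ = z≤n

    class-bound : ∀ i → ℤ.∣ (if inV₁ B i then 1ℤ else -1ℤ) ∣ ℕ.≤ 1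
    class-bound i with inV₁ B i
    ... | true  = ℕ.≤-refl
    ... | false = ℕ.≤-refl

    D-bound : ∀ i j → ℤ.∣ D i j ∣ ℕ.≤ 1
    D-bound = diagonal-bound (λ i → if inV₁ B i then 1ℤ else -1ℤ) class-bound

    *-bound : ∀ x y → ℤ.∣ x ∣ ℕ.≤ 1 → ℤ.∣ y ∣ ℕ.≤ 1 → ℤ.∣ x ℤ.* y ∣ ℕ.≤ 1
    *-bound x y p q = subst (ℕ._≤ 1) (sym (ℤ.abs-* x y)) (ℕ.*-mono-≤ p q)

    off-diagonal : ∀ i j → A₁ i j ≡ 0ℤ ⊎ D i j ≡ 0ℤ
    off-diagonal i j with i ≟ᶠ j
    ... | yes refl = inj₁ (zero-diag isA₁ i)
    ... | no  _    = inj₂ refl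

  cartesianMatrix : Matrix (Fin n × Fin m)
  cartesianMatrix = (A₁ ⊗ identity) ⊕ (D ⊗ A₂)

  -- D ⊕ A₁ is [[I , P] , [Pᵀ , -I]] because A₁ = [[O , P] , [Pᵀ , O]].
  semiStrongMatrix : Matrix (Fin n × Fin m)
  semiStrongMatrix = (D ⊕ A₁) ⊗ A₂

  cartesian-isSignedAdjacency : IsSignedAdjacency cartesianMatrix
  cartesian-isSignedAdjacency = record
    { symmetric = λ (i , k) (j , l) → cong₂ ℤ._+_
        (cong₂ ℤ._*_ (symmetric isA₁ i j) (diagonal-sym (λ _ → 1ℤ) k l))
        (cong₂ ℤ._*_ (diagonal-sym _ i j) (symmetric isA₂ k l))
    ; zero-diag = λ (i , k) → cong₂ ℤ._+_
        (cong (ℤ._* identity k k) (zero-diag isA₁ i))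
        (trans (cong (D i i ℤ.*_) (zero-diag isA₂ k)) (ℤ.*-zeroʳ (D i i)))
    ; entries = λ (i , k) (j , l) → bound i j k l (off-diagonal i j)
    }
    where
    bound : ∀ i j k l → A₁ i j ≡ 0ℤ ⊎ D i j ≡ 0ℤ →
            ℤ.∣ A₁ i j ℤ.* identity k l ℤ.+ D i j ℤ.* A₂ k l ∣ ℕ.≤ 1
    bound i j k l (inj₁ A≡0) rewrite A≡0 | ℤ.+-identityˡ (D i j ℤ.* A₂ k l) =
      *-bound (D i j) (A₂ k l) (D-bound i j) (entries isA₂ k l)
    bound i j k l (inj₂ D≡0) rewrite D≡0 | ℤ.+-identityʳ (A₁ i j ℤ.* identity k l) =
      *-bound (A₁ i j) (identity k l) (entries isA₁ i j)
        (diagonal-bound (λ _ → 1ℤ) (λ _ → ℕ.≤-refl) k l)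

  semiStrong-isSignedAdjacency : IsSignedAdjacency semiStrongMatrix
  semiStrong-isSignedAdjacency = record
    { symmetric = λ (i , k) (j , l) → cong₂ ℤ._*_
        (cong₂ ℤ._+_ (diagonal-sym _ i j) (symmetric isA₁ i j)) (symmetric isA₂ k l)
    ; zero-diag = λ (i , k) →
        trans (cong ((D i i ℤ.+ A₁ i i) ℤ.*_) (zero-diag isA₂ k)) (ℤ.*-zeroʳ (D i i ℤ.+ A₁ i i))
    ; entries = λ (i , k) (j , l) →
        *-bound (D i j ℤ.+ A₁ i j) (A₂ k l) (bound i j (off-diagonal i j)) (entries isA₂ k l)
    }
    where
    bound : ∀ i j → A₁ i j ≡ 0ℤ ⊎ D i j ≡ 0ℤ → ℤ.∣ D i j ℤ.+ A₁ i j ∣ ℕ.≤ 1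
    bound i j (inj₁ A≡0) rewrite A≡0 | ℤ.+-identityʳ (D i j) =
      D-bound i j
    bound i j (inj₂ D≡0) rewrite D≡0 | ℤ.+-identityˡ (A₁ i j) = entries isA₁ i j

  signedCartesianProduct : SignedGraph (Fin n × Fin m)
  signedCartesianProduct = fromMatrix cartesianMatrix cartesian-isSignedAdjacency

  signedSemiStrongProduct : SignedGraph (Fin n × Fin m)
  signedSemiStrongProduct = fromMatrix semiStrongMatrix semiStrong-isSignedAdjacency

-- Each Aᵢ satisfies Aᵢ² = θᵢ² I: if the pivots of t² I - A² are positive for some t
-- and cease to be so as t decreases, then at the critical t that matrix is
-- positive semidefinite and singular, so t or - t is an eigenvalue of A and t² = θ²;
-- hence θ² I - A² is positive semidefinite. The same argument for A² - t² I shows that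
-- A² - θ² I is too, so A² = θ² I, and θ² is an integer. Bisecting over rational t, where
-- positivity of pivots is decidable, makes the critical t a Cauchy sequence.
--
-- As the class signs anticommute with A₁, both products satisfy M² = d I with
-- d = θ₁² + θ₂² or d = (θ₁² + 1) θ₂². A set of more than half of the vertices carries an
-- integer vector x ≠ 0 whose image M x vanishes off the set, since this imposes fewer
-- equations than unknowns. The principal submatrix X on the set satisfies X² x = d x,
-- and comparing entries of largest absolute value yields d ≤ Δ².

module Submission where

open import Defs
open import Algebra.Bundles using (CommutativeMonoid; CommutativeRing)
import Algebra.Properties.CommutativeMonoid.Sum as MonoidSum
import Algebra.Properties.Semiring.Sum
open import Algebra.Structures using (IsCommutativeRing)
open import Algebra.Solver.Ring.AlmostCommutativeRing
  using (_-Raw-AlmostCommutative⟶_; -raw-almostCommutative⟶; fromCommutativeRing)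
open import Data.Empty using (⊥-elim)
open import Data.Bool.Base using (Bool; true; false; if_then_else_; not; T)
open import Data.Fin.Base using (Fin; zero; suc; punchIn; punchOut; combine; remQuot; _↑ˡ_; _↑ʳ_)
import Data.Fin.Properties as Fin
open import Data.Fin.Subset using (∣_∣)
open import Data.Integer.Base as ℤ using (ℤ; +_; 0ℤ; 1ℤ; -1ℤ)
import Data.Integer.Properties as ℤ
import Data.Integer.Solver as ℤ-Solver
import Data.Maybe.Base as Maybe
open import Data.Nat.Base as ℕ using (ℕ; zero; suc)
import Data.Nat.Properties as ℕ
open import Data.Product.Base using (∃; ∃-syntax; _×_; _,_; proj₁; proj₂; uncurry)
open import Data.Rational.Base as ℚ using (ℚ; 0ℚ; 1ℚ; ½)
import Data.Rational.Properties as ℚ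
import Data.Rational.Unnormalised.Base as ℚᵘ
import Data.Rational.Unnormalised.Properties as ℚᵘ
import Data.Rational.Solver as ℚ-Solver
open import Data.Sum.Base as Sum using (_⊎_; inj₁; inj₂)
open import Data.Unit.Base using (⊤; tt)
import Data.Vec.Functional as Vector
import Data.Vec.Functional.Properties as Vector
open import Data.Vec.Base using (tabulate)
open import Function.Bundles using (_↣_; Injection; Equivalence)
open import Level using (0ℓ)
open import Relation.Binary.Definitions using (Tri; tri<; tri≈; tri>)
open import Relation.Binary.PropositionalEquality as ≡ using (_≡_; _≢_)
open import Relation.Nullary.Decidable
  using (Dec; yes; no; ⌊_⌋; dec⇒maybe; decidable-stable; _×-dec_; ¬?)
open import Relation.Nullary.Negation using (¬_)

-- Over Cauchy reals neither the sign of a pivot nor the vanishing of a vector can be decided, so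
-- such case distinctions are available only under double negation. That suffices wherever the goal
-- is an absurdity or an equation, since equality of reals is stable. It does not produce a real
-- number: the critical `t` has to be given as a sequence, which is why definiteness is tested over
-- the rationals and carried to the limit. The bridge is exact, because ring operations on reals act
-- term by term: the `n`-th term of a form or of a Schur complement is the one computed from the
-- `n`-th terms. Hence one development of forms, over an abstract ordered algebra, serves both ℚ and
-- ℝ. Passing from `A` to `A²` merges `±θ` into the single number `θ²`, so the two extreme
-- eigenvalues of `A²` coincide and a pair of semidefiniteness statements determines the matrix
-- without any eigenbasis. In the combinatorial half, a dimension count takes the place of
-- eigenvalue interlacing for the principal submatrix, which keeps all of it in the integers.

-- Ordered algebras over the rationals, with undecidable signs

record OrderedℚAlgebra : Set₁ where
  field
    commutativeRing : CommutativeRing 0ℓ 0ℓ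
    morphism        : CommutativeRing.rawRing ℚ.+-*-commutativeRing
                      -Raw-AlmostCommutative⟶ fromCommutativeRing commutativeRing
  open CommutativeRing commutativeRing public hiding (zero)
  open _-Raw-AlmostCommutative⟶_ morphism public renaming (⟦_⟧ to ι)
  field
    Pos        : Carrier → Set
    pos-resp   : ∀ {x y} → x ≈ y → Pos x → Pos y
    pos-+      : ∀ {x y} → Pos x → Pos y → Pos (x + y)
    pos-*      : ∀ {x y} → Pos x → Pos y → Pos (x * y)
    pos-1      : Pos 1#
    pos⇒≉0     : ∀ {x} → Pos x → ¬ x ≈ 0#
    trichotomy : ∀ x → ¬ ¬ (x ≈ 0# ⊎ Pos x ⊎ Pos (- x))
    ≈0-stable  : ∀ {x} → ¬ ¬ (x ≈ 0#) → x ≈ 0#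

module Order (R : OrderedℚAlgebra) where
  open OrderedℚAlgebra R
  open import Algebra.Solver.Ring
    (CommutativeRing.rawRing ℚ.+-*-commutativeRing) (fromCommutativeRing commutativeRing) morphism
    (λ p q → Maybe.map (λ p≡q → reflexive (≡.cong ι p≡q)) (dec⇒maybe (p ℚ.≟ q)))
    public using (solve; _:=_; _:+_; _:*_; :-_)
  open import Algebra.Properties.Ring ring public using (-‿involutive; -0#≈0#)
  open import Algebra.Properties.Semiring.Sum semiring public
  open import Relation.Binary.Reasoning.Setoid setoid

  -- Being a negation, it turns every proof of nonnegativity into a refutation, where the doubly
  -- negated `trichotomy` may be applied.
  NonNeg : Carrier → Set
  NonNeg x = ¬ Pos (- x)

  nonNeg-resp : ∀ {x y} → x ≈ y → NonNeg x → NonNeg y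
  nonNeg-resp x≈y 0≤x y<0 = 0≤x (pos-resp (-‿cong (sym x≈y)) y<0)

  pos-asym : ∀ {x} → Pos x → NonNeg x
  pos-asym {x} 0<x x<0 = pos⇒≉0 (pos-+ 0<x x<0) (-‿inverseʳ x)

  ≈0⇒nonNeg : ∀ {x} → x ≈ 0# → NonNeg x
  ≈0⇒nonNeg x≈0 x<0 = pos⇒≉0 x<0 (trans (-‿cong x≈0) -0#≈0#)

  nonNeg-+ : ∀ {x y} → NonNeg x → NonNeg y → NonNeg (x + y)
  nonNeg-+ {x} {y} 0≤x 0≤y x+y<0 = trichotomy x λ where
    (inj₁ x≈0)        → 0≤y (pos-resp (-‿cong (trans (+-congʳ x≈0) (+-identityˡ y))) x+y<0)
    (inj₂ (inj₁ 0<x)) → 0≤y (pos-resp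
      (solve 2 (λ x y → x :+ (:- (x :+ y)) := :- y) refl x y) (pos-+ 0<x x+y<0))
    (inj₂ (inj₂ x<0)) → 0≤x x<0

  nonNeg-* : ∀ {x y} → NonNeg x → NonNeg y → NonNeg (x * y)
  nonNeg-* {x} {y} 0≤x 0≤y xy<0 = trichotomy x λ where
    (inj₁ x≈0)        → pos⇒≉0 xy<0 (trans (-‿cong (trans (*-congʳ x≈0) (zeroˡ y))) -0#≈0#)
    (inj₂ (inj₂ x<0)) → 0≤x x<0
    (inj₂ (inj₁ 0<x)) → trichotomy y λ where
      (inj₁ y≈0)        → pos⇒≉0 xy<0 (trans (-‿cong (trans (*-congˡ y≈0) (zeroʳ x))) -0#≈0#)
      (inj₂ (inj₁ 0<y)) → pos-asym (pos-* 0<x 0<y) xy<0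
      (inj₂ (inj₂ y<0)) → 0≤y y<0

  nonNeg-square : ∀ x → NonNeg (x * x)
  nonNeg-square x xx<0 = trichotomy x λ where
    (inj₁ x≈0)        → ≈0⇒nonNeg (trans (*-congʳ x≈0) (zeroˡ x)) xx<0
    (inj₂ (inj₁ 0<x)) → pos-asym (pos-* 0<x 0<x) xx<0
    (inj₂ (inj₂ x<0)) → pos-asym (pos-* x<0 x<0) (pos-resp
      (solve 1 (λ x → :- (x :* x) := :- ((:- x) :* (:- x))) refl x) xx<0)

  nonNeg-sum : ∀ {n} {f : Fin n → Carrier} → (∀ i → NonNeg (f i)) → NonNeg (sum f)
  nonNeg-sum {zero}  _   = ≈0⇒nonNeg refl
  nonNeg-sum {suc n} 0≤f = nonNeg-+ (0≤f zero) (nonNeg-sum (λ i → 0≤f (suc i)))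

  nonNeg-cancel : ∀ {a x} → Pos a → NonNeg (a * x) → NonNeg x
  nonNeg-cancel {a} {x} 0<a 0≤ax x<0 = 0≤ax (pos-resp
    (solve 2 (λ a x → a :* (:- x) := :- (a :* x)) refl a x) (pos-* 0<a x<0))

  nonNeg-antisym : ∀ {x} → NonNeg x → NonNeg (- x) → x ≈ 0#
  nonNeg-antisym {x} 0≤x x≤0 = ≈0-stable λ x≉0 → trichotomy x λ where
    (inj₁ x≈0)        → x≉0 x≈0
    (inj₂ (inj₁ 0<x)) → x≤0 (pos-resp (sym (-‿involutive x)) 0<x)
    (inj₂ (inj₂ x<0)) → 0≤x x<0

  -≈0⇒≈ : ∀ {x y} → x + - y ≈ 0# → x ≈ y
  -≈0⇒≈ {x} {y} x-y≈0 = begin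
    x            ≈⟨ solve 2 (λ x y → x := (x :+ :- y) :+ y) refl x y ⟩
    x + - y + y  ≈⟨ +-congʳ x-y≈0 ⟩
    0# + y       ≈⟨ +-identityˡ y ⟩
    y            ∎

  ≈-stable : ∀ {x y} → ¬ ¬ (x ≈ y) → x ≈ y
  ≈-stable {x} {y} x≈y-¬¬ = -≈0⇒≈ (≈0-stable λ x-y≉0 → x≈y-¬¬ λ x≈y →
    x-y≉0 (trans (+-congʳ x≈y) (-‿inverseʳ y)))

  -- The algebra has no inverses. Signs replace division: if `a * x` vanishes, then `x` and `- x`
  -- are both nonnegative.
  *-cancel-≈0 : ∀ {a x} → Pos a → a * x ≈ 0# → x ≈ 0#
  *-cancel-≈0 {a} {x} 0<a ax≈0 = nonNeg-antisym
    (nonNeg-cancel 0<a (≈0⇒nonNeg ax≈0))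
    (nonNeg-cancel 0<a (≈0⇒nonNeg (trans
      (solve 2 (λ a x → a :* (:- x) := :- (a :* x)) refl a x) (trans (-‿cong ax≈0) -0#≈0#))))

  square≈0⇒≈0 : ∀ {x} → NonNeg (- (x * x)) → x ≈ 0#
  square≈0⇒≈0 {x} xx≤0 = ≈0-stable λ x≉0 → trichotomy x λ where
    (inj₁ x≈0)        → x≉0 x≈0
    (inj₂ (inj₁ 0<x)) → xx≤0 (pos-resp (sym (-‿involutive _)) (pos-* 0<x 0<x))
    (inj₂ (inj₂ x<0)) → xx≤0 (pos-resp
      (solve 1 (λ x → (:- x) :* (:- x) := :- (:- (x :* x))) refl x) (pos-* x<0 x<0))

  sum-squares≈0⇒≈0 : ∀ {n} {x : Fin n → Carrier} →
    NonNeg (- sum (λ i → x i * x i)) → ∀ i → x i ≈ 0#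
  sum-squares≈0⇒≈0 {x = x} ss≤0 zero = square≈0⇒≈0 (nonNeg-resp
    (solve 2 (λ a s → (:- (a :+ s)) :+ s := :- a) refl _ _)
    (nonNeg-+ ss≤0 (nonNeg-sum (λ i → nonNeg-square (x (suc i))))))
  sum-squares≈0⇒≈0 {x = x} ss≤0 (suc i) = sum-squares≈0⇒≈0 (nonNeg-resp
    (solve 2 (λ a s → (:- (a :+ s)) :+ a := :- s) refl _ _)
    (nonNeg-+ ss≤0 (nonNeg-square (x zero)))) i

sum-single : (M : CommutativeMonoid 0ℓ 0ℓ) → let open CommutativeMonoid M; open MonoidSum M in
             ∀ {n} (f : Fin n → Carrier) i → (∀ j → j ≢ i → f j ≈ ε) → sum f ≈ f i
sum-single M {suc n} f i f≈0 = begin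
  sum f                               ≈⟨ sum-remove {i = i} f ⟩
  f i ∙ sum (λ j → f (punchIn i j))   ≈⟨ ∙-congˡ (sum-cong-≋ λ j → f≈0 _ (Fin.punchInᵢ≢i i j)) ⟩
  f i ∙ sum {n} (λ _ → ε)             ≈⟨ ∙-congˡ (sum-replicate-zero n) ⟩
  f i ∙ ε                             ≈⟨ identityʳ (f i) ⟩
  f i                                 ∎
  where
  open CommutativeMonoid M
  open MonoidSum M
  open import Relation.Binary.Reasoning.Setoid setoid

-- Quadratic forms, pivots and kernels

module Forms (R : OrderedℚAlgebra) where
  open OrderedℚAlgebra R
  open Order R
  open import Relation.Binary.Reasoning.Setoid setoid

  Vec : ℕ → Set
  Vec n = Fin n → Carrier

  Mat : ℕ → Set
  Mat n = Fin n → Fin n → Carrier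

  infixr 7 _·_

  _·_ : ∀ {n} → Mat n → Vec n → Vec n
  (C · x) i = sum λ j → C i j * x j

  ⟪_,_⟫ : ∀ {n} → Vec n → Vec n → Carrier
  ⟪ x , y ⟫ = sum λ i → x i * y i

  form : ∀ {n} → Mat n → Vec n → Carrier
  form C x = ⟪ x , C · x ⟫

  Symmetric : ∀ {n} → Mat n → Set
  Symmetric C = ∀ i j → C i j ≈ C j i

  PSD : ∀ {n} → Mat n → Set
  PSD C = ∀ x → NonNeg (form C x)

  Kernel : ∀ {n} → Mat n → Set
  Kernel {n} C = ∃[ v ] (¬ (∀ i → v i ≈ 0#) × (∀ i → (C · v) i ≈ 0#))

  -- The Schur complement of the corner entry, multiplied by that entry so that
  -- elimination needs no division.
  schur : ∀ {n} → Mat (suc n) → Mat n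
  schur C i j = C zero zero * C (suc i) (suc j) + - (C zero (suc i) * C zero (suc j))

  -- Positive definiteness by pivots rather than by values of the form: finitely many strict
  -- inequalities, hence decidable over ℚ and inherited by the late approximants of a real matrix.
  PD : ∀ {n} → Mat n → Set
  PD {zero}  C = ⊤
  PD {suc n} C = Pos (C zero zero) × PD (schur C)

  pd-resp : ∀ {n} {C D : Mat n} → (∀ i j → C i j ≈ D i j) → PD C → PD D
  pd-resp {zero}  C≈D pd         = tt
  pd-resp {suc n} C≈D (0<c , pd) = pos-resp (C≈D zero zero) 0<c , pd-resp (λ i j → +-cong
    (*-cong (C≈D zero zero) (C≈D (suc i) (suc j)))
    (-‿cong (*-cong (C≈D zero (suc i)) (C≈D zero (suc j))))) pd

  ·-cong : ∀ {n} {C D : Mat n} → (∀ i j → C i j ≈ D i j) → ∀ x i → (C · x) i ≈ (D · x) i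
  ·-cong C≈D x i = sum-cong-≋ λ j → *-congʳ (C≈D i j)

  form-cong : ∀ {n} {C D : Mat n} → (∀ i j → C i j ≈ D i j) → ∀ x → form C x ≈ form D x
  form-cong C≈D x = sum-cong-≋ λ i → *-congˡ (·-cong C≈D x i)

  psd-resp : ∀ {n} {C D : Mat n} → (∀ i j → C i j ≈ D i j) → PSD C → PSD D
  psd-resp C≈D psd x = nonNeg-resp (form-cong C≈D x) (psd x)

  ⟪⟫-linearˡ : ∀ {n} a b (x y z : Vec n) →
               ⟪ (λ i → a * x i + b * y i) , z ⟫ ≈ a * ⟪ x , z ⟫ + b * ⟪ y , z ⟫
  ⟪⟫-linearˡ a b x y z = begin
    sum (λ i → (a * x i + b * y i) * z i)
      ≈⟨ sum-cong-≋ (λ i → solve 5 (λ a b x y z →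
           (a :* x :+ b :* y) :* z := a :* (x :* z) :+ b :* (y :* z)) refl a b (x i) (y i) (z i)) ⟩
    sum (λ i → a * (x i * z i) + b * (y i * z i))
      ≈⟨ ∑-distrib-+ (λ i → a * (x i * z i)) (λ i → b * (y i * z i)) ⟩
    sum (λ i → a * (x i * z i)) + sum (λ i → b * (y i * z i))
      ≈⟨ +-cong (sym (*-distribˡ-sum a (λ i → x i * z i))) (sym (*-distribˡ-sum b (λ i → y i * z i))) ⟩
    a * ⟪ x , z ⟫ + b * ⟪ y , z ⟫ ∎

  ⟪⟫-comm : ∀ {n} (x y : Vec n) → ⟪ x , y ⟫ ≈ ⟪ y , x ⟫
  ⟪⟫-comm x y = sum-cong-≋ λ i → *-comm (x i) (y i)

  ⟪⟫-linearʳ : ∀ {n} a b (x y z : Vec n) →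
               ⟪ z , (λ i → a * x i + b * y i) ⟫ ≈ a * ⟪ z , x ⟫ + b * ⟪ z , y ⟫
  ⟪⟫-linearʳ a b x y z = begin
    ⟪ z , (λ i → a * x i + b * y i) ⟫  ≈⟨ ⟪⟫-comm z (λ i → a * x i + b * y i) ⟩
    ⟪ (λ i → a * x i + b * y i) , z ⟫  ≈⟨ ⟪⟫-linearˡ a b x y z ⟩
    a * ⟪ x , z ⟫ + b * ⟪ y , z ⟫      ≈⟨ +-cong (*-congˡ (⟪⟫-comm x z)) (*-congˡ (⟪⟫-comm y z)) ⟩
    a * ⟪ z , x ⟫ + b * ⟪ z , y ⟫      ∎

  ⟪⟫-scale : ∀ {n} a (x y : Vec n) → ⟪ x , (λ i → a * y i) ⟫ ≈ a * ⟪ x , y ⟫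
  ⟪⟫-scale a x y = begin
    sum (λ i → x i * (a * y i))
      ≈⟨ sum-cong-≋ (λ i → solve 3 (λ a x y → x :* (a :* y) := a :* (x :* y)) refl a (x i) (y i)) ⟩
    sum (λ i → a * (x i * y i))  ≈⟨ *-distribˡ-sum a (λ i → x i * y i) ⟨
    a * ⟪ x , y ⟫                ∎

  self-adjoint : ∀ {n} (C : Mat n) → Symmetric C → ∀ x y → ⟪ x , C · y ⟫ ≈ ⟪ C · x , y ⟫
  self-adjoint C C-sym x y = begin
    sum (λ i → x i * sum (λ j → C i j * y j))
      ≈⟨ sum-cong-≋ (λ i → *-distribˡ-sum (x i) (λ j → C i j * y j)) ⟩
    sum (λ i → sum (λ j → x i * (C i j * y j)))
      ≈⟨ ∑-comm (λ i j → x i * (C i j * y j)) ⟩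
    sum (λ j → sum (λ i → x i * (C i j * y j)))
      ≈⟨ sum-cong-≋ (λ j → sum-cong-≋ (λ i → begin
           x i * (C i j * y j)  ≈⟨ *-congˡ (*-congʳ (C-sym i j)) ⟩
           x i * (C j i * y j)  ≈⟨ solve 3 (λ x c y → x :* (c :* y) := (c :* x) :* y) refl
                                     (x i) (C j i) (y j) ⟩
           C j i * x i * y j    ∎)) ⟩
    sum (λ j → sum (λ i → C j i * x i * y j))
      ≈⟨ sum-cong-≋ (λ j → *-distribʳ-sum (y j) (λ i → C j i * x i)) ⟨
    sum (λ j → sum (λ i → C j i * x i) * y j)  ∎

  module _ {n : ℕ} (C : Mat (suc n)) (C-sym : Symmetric C) where
    private
      a  = C zero zero
      b  : Vec n
      b i = C zero (suc i)
      C′ : Mat n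
      C′ i j = C (suc i) (suc j)

    schur-sym : Symmetric (schur C)
    schur-sym i j = +-cong (*-congˡ (C-sym (suc i) (suc j))) (-‿cong (*-comm (b i) (b j)))

    schur-· : ∀ x i → (schur C · x) i ≈ a * (C′ · x) i + - ⟪ b , x ⟫ * b i
    schur-· x i = begin
      sum (λ j → (a * C′ i j + - (b i * b j)) * x j)
        ≈⟨ sum-cong-≋ (λ j → solve 5 (λ a c bi bj x →
             (a :* c :+ :- (bi :* bj)) :* x := (a :* c :+ (:- bi) :* bj) :* x) refl
             a (C′ i j) (b i) (b j) (x j)) ⟩
      ⟪ (λ j → a * C′ i j + - b i * b j) , x ⟫
        ≈⟨ ⟪⟫-linearˡ a (- b i) (C′ i) b x ⟩
      a * (C′ · x) i + - b i * ⟪ b , x ⟫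
        ≈⟨ +-congˡ (solve 2 (λ b s → (:- b) :* s := (:- s) :* b) refl (b i) ⟪ b , x ⟫) ⟩
      a * (C′ · x) i + - ⟪ b , x ⟫ * b i ∎

    -- Completing the square in `x zero`, multiplied through by the corner: `(C · x) zero` is
    -- `a * x₀ + β`, and what remains is the form of `schur C` by `schur-·`.
    form-schur : ∀ x → a * form C x ≈ (C · x) zero * (C · x) zero + form (schur C) (λ i → x (suc i))
    form-schur x = begin
      a * (x₀ * (a * x₀ + β) + sum (λ i → x′ i * (C (suc i) zero * x₀ + (C′ · x′) i)))
        ≈⟨ *-congˡ (+-congˡ (sum-cong-≋ λ i → *-congˡ (begin
             C (suc i) zero * x₀ + (C′ · x′) i
               ≈⟨ +-cong (trans (*-congʳ (C-sym (suc i) zero)) (*-comm _ _)) (sym (*-identityˡ _)) ⟩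
             x₀ * b i + 1# * (C′ · x′) i ∎))) ⟩
      a * (x₀ * (a * x₀ + β) + ⟪ x′ , (λ i → x₀ * b i + 1# * (C′ · x′) i) ⟫)
        ≈⟨ *-congˡ (+-congˡ (begin
             ⟪ x′ , (λ i → x₀ * b i + 1# * (C′ · x′) i) ⟫  ≈⟨ ⟪⟫-linearʳ x₀ 1# b (C′ · x′) x′ ⟩
             x₀ * ⟪ x′ , b ⟫ + 1# * F                      ≈⟨ +-cong (*-congˡ (⟪⟫-comm x′ b)) (*-identityˡ F) ⟩
             x₀ * β + F                                    ∎)) ⟩
      a * (x₀ * (a * x₀ + β) + (x₀ * β + F))
        ≈⟨ solve 4 (λ a x₀ β F →
             a :* (x₀ :* (a :* x₀ :+ β) :+ (x₀ :* β :+ F)) :=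
             (a :* x₀ :+ β) :* (a :* x₀ :+ β) :+ (a :* F :+ (:- β) :* β)) refl a x₀ β F ⟩
      (a * x₀ + β) * (a * x₀ + β) + (a * F + - β * β)
        ≈⟨ +-congˡ (begin
             a * F + - β * β
               ≈⟨ +-congˡ (*-congˡ (⟪⟫-comm b x′)) ⟩
             a * F + - β * ⟪ x′ , b ⟫
               ≈⟨ ⟪⟫-linearʳ a (- β) (C′ · x′) b x′ ⟨
             ⟪ x′ , (λ i → a * (C′ · x′) i + - β * b i) ⟫
               ≈⟨ sum-cong-≋ (λ i → *-congˡ (schur-· x′ i)) ⟨
             form (schur C) x′ ∎) ⟩
      (a * x₀ + β) * (a * x₀ + β) + form (schur C) x′ ∎
      where
      x₀ = x zero
      x′ : Vec n
      x′ i = x (suc i)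
      β = ⟪ b , x′ ⟫
      F = form C′ x′

    -- Solves the first row for the first coordinate, the others being scaled by `a` to avoid
    -- division. Then `C` maps `lift v` to zero followed by `schur C · v`, so that values of the
    -- form and kernel vectors pass between the two matrices.
    lift : Vec n → Vec (suc n)
    lift v zero    = - ⟪ b , v ⟫
    lift v (suc i) = a * v i

    lift-zero : ∀ v → (C · lift v) zero ≈ 0#
    lift-zero v = begin
      a * - ⟪ b , v ⟫ + ⟪ b , (λ i → a * v i) ⟫  ≈⟨ +-congˡ (⟪⟫-scale a b v) ⟩
      a * - ⟪ b , v ⟫ + a * ⟪ b , v ⟫            ≈⟨ distribˡ a _ _ ⟨
      a * (- ⟪ b , v ⟫ + ⟪ b , v ⟫)              ≈⟨ *-congˡ (-‿inverseˡ _) ⟩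
      a * 0#                                     ≈⟨ zeroʳ a ⟩
      0#                                         ∎

    lift-suc : ∀ v i → (C · lift v) (suc i) ≈ (schur C · v) i
    lift-suc v i = begin
      C (suc i) zero * - ⟪ b , v ⟫ + ⟪ C′ i , (λ j → a * v j) ⟫
        ≈⟨ +-cong (trans (*-congʳ (C-sym (suc i) zero)) (*-comm _ _)) (⟪⟫-scale a (C′ i) v) ⟩
      - ⟪ b , v ⟫ * b i + a * (C′ · v) i  ≈⟨ +-comm _ _ ⟩
      a * (C′ · v) i + - ⟪ b , v ⟫ * b i  ≈⟨ schur-· v i ⟨
      (schur C · v) i                     ∎

    psd-schur : Pos a → PSD C → PSD (schur C)
    psd-schur 0<a psd v = nonNeg-cancel 0<a (nonNeg-resp eq (psd (lift v)))
      where
      eq : form C (lift v) ≈ a * form (schur C) v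
      eq = begin
        - ⟪ b , v ⟫ * (C · lift v) zero + sum (λ i → a * v i * (C · lift v) (suc i))
          ≈⟨ +-cong (trans (*-congˡ (lift-zero v)) (zeroʳ _))
                    (sum-cong-≋ λ i → trans (*-congˡ (lift-suc v i)) (*-assoc a _ _)) ⟩
        0# + sum (λ i → a * (v i * (schur C · v) i))  ≈⟨ +-identityˡ _ ⟩
        sum (λ i → a * (v i * (schur C · v) i))       ≈⟨ *-distribˡ-sum a (λ i → v i * (schur C · v) i) ⟨
        a * form (schur C) v                          ∎

    kernel-schur : Pos a → Kernel (schur C) → Kernel C
    kernel-schur 0<a (v , v≉0 , eq) = lift v , (λ l≈0 → v≉0 λ i → *-cancel-≈0 0<a (l≈0 (suc i))) , λ where
      zero    → lift-zero v
      (suc i) → trans (lift-suc v i) (eq i)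

  pd⇒pos-diagonal : ∀ {n} (C : Mat n) → Fin n → PD C → ∃[ i ] Pos (C i i)
  pd⇒pos-diagonal {suc n} C _ (0<c , _) = zero , 0<c

  pd⇒psd : ∀ {n} (C : Mat n) → Symmetric C → PD C → PSD C
  pd⇒psd {zero}  C C-sym pd         x = ≈0⇒nonNeg refl
  pd⇒psd {suc n} C C-sym (0<a , pd) x = nonNeg-cancel 0<a (nonNeg-resp (sym (form-schur C C-sym x))
    (nonNeg-+ (nonNeg-square _) (pd⇒psd (schur C) (schur-sym C C-sym) pd (λ i → x (suc i)))))

  unit : ∀ {n} → Fin n → Vec n
  unit i j = if ⌊ j Fin.≟ i ⌋ then 1# else 0#

  unit-refl : ∀ {n} (i : Fin n) → unit i i ≈ 1#
  unit-refl i with i Fin.≟ i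
  ... | yes _  = refl
  ... | no i≢i = ⊥-elim (i≢i ≡.refl)

  unit-≢ : ∀ {n} (i : Fin n) {j} → j ≢ i → unit i j ≈ 0#
  unit-≢ i {j} j≢i with j Fin.≟ i
  ... | yes j≡i = ⊥-elim (j≢i j≡i)
  ... | no _    = refl

  ⟪⟫-unit : ∀ {n} (x : Vec n) i → ⟪ x , unit i ⟫ ≈ x i
  ⟪⟫-unit x i = begin
    ⟪ x , unit i ⟫    ≈⟨ sum-single +-commutativeMonoid _ i
                           (λ j j≢i → trans (*-congˡ (unit-≢ i j≢i)) (zeroʳ (x j))) ⟩
    x i * unit i i    ≈⟨ *-congˡ (unit-refl i) ⟩
    x i * 1#          ≈⟨ *-identityʳ (x i) ⟩
    x i               ∎

  psd-diagonal : ∀ {n} (C : Mat n) → PSD C → ∀ i → NonNeg (C i i)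
  psd-diagonal C psd i = nonNeg-resp eq (psd (unit i))
    where
    eq : form C (unit i) ≈ C i i
    eq = trans (⟪⟫-comm (unit i) (C · unit i)) (trans (⟪⟫-unit (C · unit i) i) (⟪⟫-unit (C i) i))

  -- The form takes the value - (C j j + 2) (C i j)² at (C j j + 1) eᵢ - C i j eⱼ.
  psd-isotropic : ∀ {n} (C : Mat n) → Symmetric C → PSD C → ∀ i j → C i i ≈ 0# → C i j ≈ 0#
  psd-isotropic C C-sym psd i j cᵢᵢ≈0 = square≈0⇒≈0 (nonNeg-resp
    (solve 3 (λ c d e → (:- ((d :+ (e :+ e)) :* (c :* c))) :+ (d :* (c :* c) :+
       ((e :+ e) :* (c :* c) :+ (:- (c :* c)))) := :- (c :* c)) refl c d 1#)
    (nonNeg-+ (nonNeg-resp eq (psd x)) (nonNeg-+ (nonNeg-* (psd-diagonal C psd j) (nonNeg-square c))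
      (nonNeg-resp (begin
        c * c                                 ≈⟨ solve 1 (λ q → q := (q :+ q) :+ (:- q)) refl (c * c) ⟩
        (c * c + c * c) + - (c * c)           ≈⟨ +-congʳ (+-cong (*-identityˡ _) (*-identityˡ _)) ⟨
        (1# * (c * c) + 1# * (c * c)) + - (c * c)  ≈⟨ +-congʳ (distribʳ _ _ _) ⟨
        (1# + 1#) * (c * c) + - (c * c)       ∎) (nonNeg-square c)))))
    where
    c = C i j
    d = C j j
    s = d + 1#
    u = - c
    x : Vec _
    x k = s * unit i k + u * unit j k
    row : ∀ k → (C · x) k ≈ s * C k i + u * C k j
    row k = trans (⟪⟫-linearʳ s u (unit i) (unit j) (C k))
                  (+-cong (*-congˡ (⟪⟫-unit (C k) i)) (*-congˡ (⟪⟫-unit (C k) j)))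
    eq : form C x ≈ - ((d + (1# + 1#)) * (c * c))
    eq = begin
      ⟪ x , C · x ⟫
        ≈⟨ ⟪⟫-linearˡ s u (unit i) (unit j) (C · x) ⟩
      s * ⟪ unit i , C · x ⟫ + u * ⟪ unit j , C · x ⟫
        ≈⟨ +-cong (*-congˡ (trans (⟪⟫-comm (unit i) (C · x)) (trans (⟪⟫-unit (C · x) i) (row i))))
                  (*-congˡ (trans (⟪⟫-comm (unit j) (C · x)) (trans (⟪⟫-unit (C · x) j) (row j)))) ⟩
      s * (s * C i i + u * c) + u * (s * C j i + u * d)
        ≈⟨ +-cong (*-congˡ (+-congʳ (trans (*-congˡ cᵢᵢ≈0) (zeroʳ s))))
                  (*-congˡ (+-congʳ (*-congˡ (C-sym j i)))) ⟩
      s * (0# + u * c) + u * (s * c + u * d)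
        ≈⟨ +-congʳ (*-congˡ (+-identityˡ _)) ⟩
      s * (u * c) + u * (s * c + u * d)
        ≈⟨ solve 3 (λ c d e →
             (d :+ e) :* ((:- c) :* c) :+ (:- c) :* ((d :+ e) :* c :+ (:- c) :* d) :=
             :- ((d :+ (e :+ e)) :* (c :* c))) refl c d 1# ⟩
      - ((d + (1# + 1#)) * (c * c)) ∎

  -- Elimination goes on while the corner is positive. A zero corner makes its whole row vanish by
  -- `psd-isotropic`, so the first unit vector is in the kernel, and the lifts carry it back; a
  -- negative corner contradicts semidefiniteness.
  psd⇒pd∨kernel : ∀ {n} (C : Mat n) → Symmetric C → PSD C → ¬ ¬ (PD C ⊎ Kernel C)
  psd⇒pd∨kernel {zero}  C C-sym psd k = k (inj₁ tt)
  psd⇒pd∨kernel {suc n} C C-sym psd k = trichotomy (C zero zero) λ where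
    (inj₁ c≈0) → k (inj₂ (unit zero , (λ u≈0 → pos⇒≉0 pos-1 (u≈0 zero)) , λ i →
      trans (⟪⟫-unit (C i) zero) (trans (C-sym i zero) (psd-isotropic C C-sym psd zero i c≈0))))
    (inj₂ (inj₁ 0<c)) → psd⇒pd∨kernel (schur C) (schur-sym C C-sym) (psd-schur C C-sym 0<c psd) λ where
      (inj₁ pd)  → k (inj₁ (0<c , pd))
      (inj₂ ker) → k (inj₂ (kernel-schur C C-sym 0<c ker))
    (inj₂ (inj₂ c<0)) → psd-diagonal C psd zero c<0

  -- A crude Cauchy-Schwarz inequality: `(u + v)² ≤ 2 u² + 2 v²` splits off one coordinate at a
  -- time, which is where the doubled constants come from.
  inner-bound : ∀ {n} (a : Vec n) →
    ∃[ K ] (NonNeg K × ∀ x → NonNeg (K * ⟪ x , x ⟫ + - (⟪ a , x ⟫ * ⟪ a , x ⟫)))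
  inner-bound {zero} a = 0# , ≈0⇒nonNeg refl , λ x →
    ≈0⇒nonNeg (trans (+-cong (zeroˡ _) (-‿cong (zeroˡ _))) (-‿inverseʳ 0#))
  inner-bound {suc n} a =
    let K , 0≤K , bound = inner-bound (λ i → a (suc i)) in
    (K + K) + (a zero * a zero + a zero * a zero) ,
    nonNeg-+ (nonNeg-+ 0≤K 0≤K) (nonNeg-+ (nonNeg-square _) (nonNeg-square _)) , λ x →
    let x₀ = x zero
        a₀ = a zero
        x′ = λ i → x (suc i)
        ξ  = ⟪ x′ , x′ ⟫
        β  = ⟪ (λ i → a (suc i)) , x′ ⟫
        K[xx] = nonNeg-* 0≤K (nonNeg-square x₀)
        aaξ = nonNeg-* (nonNeg-square a₀) (nonNeg-sum (λ i → nonNeg-square (x′ i)))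
    in nonNeg-resp
      (solve 5 (λ K a x ξ β →
        ((K :* (x :* x) :+ K :* (x :* x)) :+ ((a :* a) :* ξ :+ (a :* a) :* ξ)) :+
        (((K :* ξ :+ :- (β :* β)) :+ (K :* ξ :+ :- (β :* β))) :+
         (a :* x :+ :- β) :* (a :* x :+ :- β)) :=
        ((K :+ K) :+ (a :* a :+ a :* a)) :* (x :* x :+ ξ) :+
        :- ((a :* x :+ β) :* (a :* x :+ β))) refl K a₀ x₀ ξ β)
      (nonNeg-+ (nonNeg-+ (nonNeg-+ K[xx] K[xx]) (nonNeg-+ aaξ aaξ))
        (nonNeg-+ (nonNeg-+ (bound x′) (bound x′)) (nonNeg-square _)))

  norm-bound : ∀ {m n} (a : Fin m → Vec n) →
    ∃[ K ] (NonNeg K × ∀ x → NonNeg (K * ⟪ x , x ⟫ + - sum (λ i → ⟪ a i , x ⟫ * ⟪ a i , x ⟫)))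
  norm-bound {zero}  a = 0# , ≈0⇒nonNeg refl , λ x →
    ≈0⇒nonNeg (trans (+-cong (zeroˡ _) -0#≈0#) (+-identityˡ 0#))
  norm-bound {suc m} a =
    let K , 0≤K , bound  = inner-bound (a zero)
        L , 0≤L , bound′ = norm-bound (λ i → a (suc i))
    in K + L , nonNeg-+ 0≤K 0≤L , λ x → nonNeg-resp
      (solve 5 (λ K L q s t →
        (K :* q :+ :- s) :+ (L :* q :+ :- t) := (K :+ L) :* q :+ :- (s :+ t)) refl K L _ _ _)
      (nonNeg-+ (bound x) (bound′ x))

-- Integers inside the rationals, and integer matrices

toℚ : ℤ → ℚ
toℚ z = z ℚ./ 1

-- Normalisation of a fraction does not compute for a variable numerator, so the arithmetic of `toℚ`
-- is read off in the unnormalised rationals. The `0` there is the denominator less one.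
toℚᵘ-toℚ : ∀ z → ℚ.toℚᵘ (toℚ z) ℚᵘ.≃ ℚᵘ.mkℚᵘ z 0
toℚᵘ-toℚ z = ℚ.toℚᵘ-fromℚᵘ (ℚᵘ.mkℚᵘ z 0)

toℚ-homo-+ : ∀ a b → toℚ (a ℤ.+ b) ≡ toℚ a ℚ.+ toℚ b
toℚ-homo-+ a b = ℚ.toℚᵘ-injective (begin
  ℚ.toℚᵘ (toℚ (a ℤ.+ b))                  ≈⟨ toℚᵘ-toℚ (a ℤ.+ b) ⟩
  ℚᵘ.mkℚᵘ (a ℤ.+ b) 0                     ≈⟨ ℚᵘ.*≡* (≡.cong (ℤ._* 1ℤ)
                                               (≡.cong₂ ℤ._+_ (ℤ.*-identityʳ a) (ℤ.*-identityʳ b))) ⟨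
  ℚᵘ.mkℚᵘ a 0 ℚᵘ.+ ℚᵘ.mkℚᵘ b 0            ≈⟨ ℚᵘ.+-cong (toℚᵘ-toℚ a) (toℚᵘ-toℚ b) ⟨
  ℚ.toℚᵘ (toℚ a) ℚᵘ.+ ℚ.toℚᵘ (toℚ b)      ≈⟨ ℚ.toℚᵘ-homo-+ (toℚ a) (toℚ b) ⟨
  ℚ.toℚᵘ (toℚ a ℚ.+ toℚ b)                ∎)
  where open import Relation.Binary.Reasoning.Setoid ℚᵘ.≃-setoid

toℚ-homo-* : ∀ a b → toℚ (a ℤ.* b) ≡ toℚ a ℚ.* toℚ b
toℚ-homo-* a b = ℚ.toℚᵘ-injective (begin
  ℚ.toℚᵘ (toℚ (a ℤ.* b))                  ≈⟨ toℚᵘ-toℚ (a ℤ.* b) ⟩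
  ℚᵘ.mkℚᵘ a 0 ℚᵘ.* ℚᵘ.mkℚᵘ b 0            ≈⟨ ℚᵘ.*-cong (toℚᵘ-toℚ a) (toℚᵘ-toℚ b) ⟨
  ℚ.toℚᵘ (toℚ a) ℚᵘ.* ℚ.toℚᵘ (toℚ b)      ≈⟨ ℚ.toℚᵘ-homo-* (toℚ a) (toℚ b) ⟨
  ℚ.toℚᵘ (toℚ a ℚ.* toℚ b)                ∎)
  where open import Relation.Binary.Reasoning.Setoid ℚᵘ.≃-setoid

toℚ-injective : ∀ {a b} → toℚ a ≡ toℚ b → a ≡ b
toℚ-injective {a} {b} eq = begin
  a          ≡⟨ ℤ.*-identityʳ a ⟨
  a ℤ.* 1ℤ   ≡⟨ ℚᵘ.drop-*≡* (ℚᵘ.≃-trans (ℚᵘ.≃-sym (toℚᵘ-toℚ a))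
                  (ℚᵘ.≃-trans (ℚ.toℚᵘ-cong eq) (toℚᵘ-toℚ b))) ⟩
  b ℤ.* 1ℤ   ≡⟨ ℤ.*-identityʳ b ⟩
  b          ∎
  where open ≡.≡-Reasoning

toℚ-mono-≤ : ∀ {a b} → a ℤ.≤ b → toℚ a ℚ.≤ toℚ b
toℚ-mono-≤ {a} {b} a≤b = ℚ.toℚᵘ-cancel-≤ (ℚᵘ.≤-respˡ-≃ (ℚᵘ.≃-sym (toℚᵘ-toℚ a))
  (ℚᵘ.≤-respʳ-≃ (ℚᵘ.≃-sym (toℚᵘ-toℚ b)) (ℚᵘ.*≤* (ℤ.*-monoʳ-≤-nonNeg 1ℤ a≤b))))

module ℤ-Sum = Algebra.Properties.Semiring.Sum ℤ.+-*-semiring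

infixl 7 _⊙_

_⊙_ : ∀ {n} → Matrix (Fin n) → Matrix (Fin n) → Matrix (Fin n)
(M ⊙ N) i j = ℤ-Sum.sum λ k → M i k ℤ.* N k j

diagonal-refl : ∀ {n} (d : Fin n → ℤ) i → diagonal d i i ≡ d i
diagonal-refl d i with i Fin.≟ i
... | yes _  = ≡.refl
... | no i≢i = ⊥-elim (i≢i ≡.refl)

diagonal-≢ : ∀ {n} (d : Fin n → ℤ) {i j} → i ≢ j → diagonal d i j ≡ 0ℤ
diagonal-≢ d {i} {j} i≢j with i Fin.≟ j
... | yes i≡j = ⊥-elim (i≢j i≡j)
... | no _    = ≡.refl

identity-sym : ∀ {n} (i j : Fin n) → identity i j ≡ identity j i
identity-sym i j with i Fin.≟ j
... | yes ≡.refl = ≡.sym (diagonal-refl (λ _ → 1ℤ) i)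
... | no i≢j     = ≡.sym (diagonal-≢ (λ _ → 1ℤ) (λ j≡i → i≢j (≡.sym j≡i)))

⊙-sym : ∀ {n} (A : Matrix (Fin n)) → (∀ i j → A i j ≡ A j i) → ∀ i j → (A ⊙ A) i j ≡ (A ⊙ A) j i
⊙-sym A A-sym i j = ℤ-Sum.sum-cong-≗ λ k → ≡.trans (ℤ.*-comm (A i k) (A k j))
  (≡.cong₂ ℤ._*_ (A-sym k j) (A-sym i k))

-- The pencils `α I + β A²` of a symmetric integer matrix

module Pencils (R : OrderedℚAlgebra) {n : ℕ} (A : Matrix (Fin n)) (A-sym : ∀ i j → A i j ≡ A j i) where
  open OrderedℚAlgebra R
  open Order R
  open Forms R
  open import Relation.Binary.Reasoning.Setoid setoid

  embed : ℤ → Carrier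
  embed z = ι (toℚ z)

  embed-+ : ∀ a b → embed (a ℤ.+ b) ≈ embed a + embed b
  embed-+ a b = trans (reflexive (≡.cong ι (toℚ-homo-+ a b))) (+-homo (toℚ a) (toℚ b))

  embed-* : ∀ a b → embed (a ℤ.* b) ≈ embed a * embed b
  embed-* a b = trans (reflexive (≡.cong ι (toℚ-homo-* a b))) (*-homo (toℚ a) (toℚ b))

  embed-sum : ∀ {k} (f : Fin k → ℤ) → embed (ℤ-Sum.sum f) ≈ sum (λ i → embed (f i))
  embed-sum {zero}  f = 0-homo
  embed-sum {suc k} f = trans (embed-+ (f zero) (ℤ-Sum.sum (λ i → f (suc i)))) (+-congˡ (embed-sum (λ i → f (suc i))))

  Aᴿ : Mat n
  Aᴿ i j = embed (A i j)

  -- Two coefficients, so that `t² I - A²` (called top) and `A² - t² I` (called bottom) share their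
  -- lemmas.
  pencil : Carrier → Carrier → Mat n
  pencil α β i j = α * embed (identity i j) + β * embed ((A ⊙ A) i j)

  pencil-cong : ∀ {α α′ β β′} → α ≈ α′ → β ≈ β′ → ∀ i j → pencil α β i j ≈ pencil α′ β′ i j
  pencil-cong α≈α′ β≈β′ i j = +-cong (*-congʳ α≈α′) (*-congʳ β≈β′)

  pencil-sym : ∀ α β → Symmetric (pencil α β)
  pencil-sym α β i j = +-cong
    (*-congˡ (reflexive (≡.cong embed (identity-sym i j))))
    (*-congˡ (reflexive (≡.cong embed (⊙-sym A A-sym i j))))

  identity-· : ∀ (x : Vec n) i → ((λ i j → embed (identity i j)) · x) i ≈ x i
  identity-· x i = begin
    sum (λ j → embed (identity i j) * x j)
      ≈⟨ sum-single +-commutativeMonoid {n} (λ j → embed (identity i j) * x j) i (λ j j≢i → trans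
           (*-congʳ (trans (reflexive (≡.cong embed (diagonal-≢ (λ _ → 1ℤ) (λ i≡j → j≢i (≡.sym i≡j))))) 0-homo))
           (zeroˡ (x j))) ⟩
    embed (identity i i) * x i
      ≈⟨ *-congʳ (trans (reflexive (≡.cong embed (diagonal-refl (λ _ → 1ℤ) i))) 1-homo) ⟩
    1# * x i  ≈⟨ *-identityˡ (x i) ⟩
    x i       ∎

  square-· : ∀ x i → ((λ i j → embed ((A ⊙ A) i j)) · x) i ≈ (Aᴿ · Aᴿ · x) i
  square-· x i = begin
    sum (λ j → embed ((A ⊙ A) i j) * x j)
      ≈⟨ sum-cong-≋ (λ j → begin
           embed ((A ⊙ A) i j) * x j
             ≈⟨ *-congʳ (trans (embed-sum (λ k → A i k ℤ.* A k j)) (sum-cong-≋ λ k → embed-* (A i k) (A k j))) ⟩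
           sum (λ k → Aᴿ i k * Aᴿ k j) * x j
             ≈⟨ *-distribʳ-sum (x j) (λ k → Aᴿ i k * Aᴿ k j) ⟩
           sum (λ k → Aᴿ i k * Aᴿ k j * x j)
             ≈⟨ sum-cong-≋ (λ k → *-assoc (Aᴿ i k) (Aᴿ k j) (x j)) ⟩
           sum (λ k → Aᴿ i k * (Aᴿ k j * x j)) ∎) ⟩
    sum (λ j → sum (λ k → Aᴿ i k * (Aᴿ k j * x j)))
      ≈⟨ ∑-comm (λ j k → Aᴿ i k * (Aᴿ k j * x j)) ⟩
    sum (λ k → sum (λ j → Aᴿ i k * (Aᴿ k j * x j)))
      ≈⟨ sum-cong-≋ (λ k → *-distribˡ-sum (Aᴿ i k) (λ j → Aᴿ k j * x j)) ⟨
    sum (λ k → Aᴿ i k * sum (λ j → Aᴿ k j * x j)) ∎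

  pencil-· : ∀ α β x i → (pencil α β · x) i ≈ α * x i + β * (Aᴿ · Aᴿ · x) i
  pencil-· α β x i = trans
    (⟪⟫-linearˡ α β (λ j → embed (identity i j)) (λ j → embed ((A ⊙ A) i j)) x)
    (+-cong (*-congˡ (identity-· x i)) (*-congˡ (square-· x i)))

  form-pencil : ∀ α β x → form (pencil α β) x ≈ α * ⟪ x , x ⟫ + β * ⟪ Aᴿ · x , Aᴿ · x ⟫
  form-pencil α β x = begin
    ⟪ x , pencil α β · x ⟫
      ≈⟨ sum-cong-≋ (λ i → *-congˡ (pencil-· α β x i)) ⟩
    ⟪ x , (λ i → α * x i + β * (Aᴿ · Aᴿ · x) i) ⟫
      ≈⟨ ⟪⟫-linearʳ α β x (Aᴿ · Aᴿ · x) x ⟩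
    α * ⟪ x , x ⟫ + β * ⟪ x , Aᴿ · Aᴿ · x ⟫
      ≈⟨ +-congˡ (*-congˡ (self-adjoint Aᴿ (λ i j → reflexive (≡.cong embed (A-sym i j))) x (Aᴿ · x))) ⟩
    α * ⟪ x , x ⟫ + β * ⟪ Aᴿ · x , Aᴿ · x ⟫ ∎

  pencil-psd : ∀ {α β} → NonNeg α → NonNeg β → PSD (pencil α β)
  pencil-psd 0≤α 0≤β x = nonNeg-resp (sym (form-pencil _ _ x))
    (nonNeg-+ (nonNeg-* 0≤α (nonNeg-sum λ i → nonNeg-square (x i)))
              (nonNeg-* 0≤β (nonNeg-sum λ i → nonNeg-square ((Aᴿ · x) i))))

  pencil-neg : ∀ α β i j → pencil (- α) (- β) i j ≈ - pencil α β i j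
  pencil-neg α β i j = solve 4 (λ α β e s →
    (:- α) :* e :+ (:- β) :* s := :- (α :* e :+ β :* s)) refl α β _ _

  -- Unfolding norm during conversion checking would run the recursion of norm-bound.
  abstract
    norm : Carrier
    norm = proj₁ (norm-bound Aᴿ)

    0≤norm : NonNeg norm
    0≤norm = proj₁ (proj₂ (norm-bound Aᴿ))

    norm-bounded : ∀ x → NonNeg (norm * ⟪ x , x ⟫ + - ⟪ Aᴿ · x , Aᴿ · x ⟫)
    norm-bounded = proj₂ (proj₂ (norm-bound Aᴿ))

  private
    -- Since `|A x|² ≤ norm |x|²` and `h * h` is `norm² + 2 norm + 1`, the form of `h² I - A²` is at
    -- least `|x|²`. This makes `h` a safe right end for the bisections.
    h : Carrier
    h = norm + 1#

    0≤norm²+norm : NonNeg (norm * norm + norm)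
    0≤norm²+norm = nonNeg-+ (nonNeg-square norm) 0≤norm

    form-h : ∀ x → NonNeg (form (pencil (h * h) (- 1#)) x + - ⟪ x , x ⟫)
    form-h x = nonNeg-resp (begin
      (norm * norm + norm) * ⟪ x , x ⟫ + (norm * ⟪ x , x ⟫ + - ⟪ Aᴿ · x , Aᴿ · x ⟫)
        ≈⟨ +-congˡ (+-congˡ (-‿cong (*-identityˡ _))) ⟨
      (norm * norm + norm) * q + (norm * q + - (1# * s))
        ≈⟨ solve 3 (λ k q s → (k :* k :+ k) :* q :+ (k :* q :+ :- s) :=
             (k :* k :+ k :+ k) :* q :+ (:- s)) refl norm q (1# * s) ⟩
      (norm * norm + norm + norm) * q + - (1# * s)
        ≈⟨ +-congʳ (begin
             (norm * norm + norm + norm) * q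
               ≈⟨ *-congʳ (begin
                    norm * norm + norm + norm
                      ≈⟨ +-cong (+-congˡ (*-identityʳ norm)) (*-identityˡ norm) ⟨
                    norm * norm + norm * 1# + 1# * norm
                      ≈⟨ solve 2 (λ k e → k :* k :+ k :* e :+ e :* k :=
                           (k :+ e) :* (k :+ e) :+ (:- (e :* e))) refl norm 1# ⟩
                    h * h + - (1# * 1#) ∎) ⟩
             (h * h + - (1# * 1#)) * q
               ≈⟨ *-congʳ (+-congˡ (-‿cong (*-identityˡ 1#))) ⟩
             (h * h + - 1#) * q
               ≈⟨ solve 3 (λ H e q → (H :+ :- e) :* q := H :* q :+ (:- (e :* q))) refl (h * h) 1# q ⟩
             h * h * q + - (1# * q)
               ≈⟨ +-congˡ (-‿cong (*-identityˡ q)) ⟩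
             h * h * q + - q ∎) ⟩
      h * h * q + - q + - (1# * s)
        ≈⟨ solve 4 (λ H q e s → H :* q :+ (:- q) :+ (:- (e :* s)) :=
             H :* q :+ (:- e) :* s :+ (:- q)) refl (h * h) q 1# s ⟩
      h * h * q + - 1# * s + - q
        ≈⟨ +-congʳ (form-pencil (h * h) (- 1#) x) ⟨
      form (pencil (h * h) (- 1#)) x + - q ∎)
      (nonNeg-+ (nonNeg-* 0≤norm²+norm (nonNeg-sum λ i → nonNeg-square (x i)))
                (norm-bounded x))
      where
      q = ⟪ x , x ⟫
      s = ⟪ Aᴿ · x , Aᴿ · x ⟫

  top-psd : PSD (pencil (h * h) (- 1#))
  top-psd x = nonNeg-resp (solve 2 (λ f q → f :+ (:- q) :+ q := f) refl _ _)
    (nonNeg-+ (form-h x) (nonNeg-sum λ i → nonNeg-square (x i)))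

  -- For a kernel vector `v`, `form-h` would say that `- |v|²` is nonnegative.
  top-pd : ¬ ¬ PD (pencil (h * h) (- 1#))
  top-pd ¬pd = psd⇒pd∨kernel _ (pencil-sym (h * h) (- 1#)) top-psd λ where
    (inj₁ pd) → ¬pd pd
    (inj₂ (v , v≉0 , eq)) → v≉0 (sum-squares≈0⇒≈0 (nonNeg-resp (begin
      form (pencil (h * h) (- 1#)) v + - ⟪ v , v ⟫
        ≈⟨ +-congʳ (trans (sum-cong-≋ λ i → trans (*-congˡ (eq i)) (zeroʳ (v i))) (sum-replicate-zero n)) ⟩
      0# + - ⟪ v , v ⟫  ≈⟨ +-identityˡ _ ⟩
      - ⟪ v , v ⟫       ∎) (form-h v)))

  -- If A² v = t² v, then v is an eigenvector for t or A v - t v is one for - t.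
  module _ {θ : Carrier} (eigenvalues : ∀ t v → ¬ (∀ i → v i ≈ 0#) → (∀ i → (Aᴿ · v) i ≈ t * v i) →
                              t ≈ θ ⊎ t ≈ - θ) where

    eigenvalue-square : ∀ t v → ¬ (∀ i → v i ≈ 0#) → (∀ i → (Aᴿ · v) i ≈ t * v i) → t * t ≈ θ * θ
    eigenvalue-square t v v≉0 Av≈tv with eigenvalues t v v≉0 Av≈tv
    ... | inj₁ t≈θ  = *-cong t≈θ t≈θ
    ... | inj₂ t≈-θ = trans (*-cong t≈-θ t≈-θ) (solve 1 (λ θ → (:- θ) :* (:- θ) := θ :* θ) refl θ)

    square-eigenvalue : ∀ t v → ¬ (∀ i → v i ≈ 0#) → (∀ i → (Aᴿ · Aᴿ · v) i ≈ t * t * v i) →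
                        t * t ≈ θ * θ
    -- Whether `w` vanishes is undecidable. The equation sought is stable, so its failure may be
    -- assumed; then `w` cannot vanish, because otherwise `v` would be an eigenvector for `t` and
    -- the equation would hold.
    square-eigenvalue t v v≉0 AAv≈ttv = ≈-stable λ tt≉θθ → tt≉θθ (trans
      (solve 1 (λ t → t :* t := (:- t) :* (:- t)) refl t)
      (eigenvalue-square (- t) w
        (λ w≈0 → tt≉θθ (eigenvalue-square t v v≉0 λ i → begin
          (Aᴿ · v) i
            ≈⟨ solve 3 (λ a t v → a := (a :+ (:- t) :* v) :+ t :* v) refl ((Aᴿ · v) i) t (v i) ⟩
          ((Aᴿ · v) i + - t * v i) + t * v i  ≈⟨ +-congʳ (+-congʳ (*-identityˡ _)) ⟨
          w i + t * v i                       ≈⟨ +-congʳ (w≈0 i) ⟩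
          0# + t * v i                        ≈⟨ +-identityˡ _ ⟩
          t * v i                             ∎))
        λ i → begin
          (Aᴿ · w) i                                  ≈⟨ ⟪⟫-linearʳ 1# (- t) (Aᴿ · v) v (Aᴿ i) ⟩
          1# * (Aᴿ · Aᴿ · v) i + - t * (Aᴿ · v) i     ≈⟨ +-congʳ (trans (*-identityˡ _) (AAv≈ttv i)) ⟩
          t * t * v i + - t * (Aᴿ · v) i
            ≈⟨ solve 3 (λ t v a → t :* t :* v :+ (:- t) :* a := (:- t) :* (a :+ (:- t) :* v)) refl
                 t (v i) ((Aᴿ · v) i) ⟩
          - t * ((Aᴿ · v) i + - t * v i)              ≈⟨ *-congˡ (+-congʳ (*-identityˡ _)) ⟨
          - t * w i                                   ∎))
      where
      -- The factor `1#` gives `w` the shape of the combinations in `⟪⟫-linearʳ`.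
      w : Vec n
      w i = 1# * (Aᴿ · v) i + - t * v i

    top-kernel : ∀ t → Kernel (pencil (t * t) (- 1#)) → t * t ≈ θ * θ
    top-kernel t (v , v≉0 , eq) = square-eigenvalue t v v≉0 λ i → sym (-≈0⇒≈ (begin
      t * t * v i + - (Aᴿ · Aᴿ · v) i         ≈⟨ +-congˡ (-‿cong (*-identityˡ _)) ⟨
      t * t * v i + - (1# * (Aᴿ · Aᴿ · v) i)  ≈⟨ solve 3 (λ p e a → p :+ (:- (e :* a)) := p :+ (:- e) :* a) refl
                                                   (t * t * v i) 1# ((Aᴿ · Aᴿ · v) i) ⟩
      t * t * v i + - 1# * (Aᴿ · Aᴿ · v) i    ≈⟨ pencil-· (t * t) (- 1#) v i ⟨
      (pencil (t * t) (- 1#) · v) i           ≈⟨ eq i ⟩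
      0#                                      ∎))

    bottom-kernel : ∀ t → Kernel (pencil (- (t * t)) 1#) → t * t ≈ θ * θ
    bottom-kernel t (v , v≉0 , eq) = square-eigenvalue t v v≉0 λ i → -≈0⇒≈ (begin
      (Aᴿ · Aᴿ · v) i + - (t * t * v i)       ≈⟨ +-congʳ (*-identityˡ _) ⟨
      1# * (Aᴿ · Aᴿ · v) i + - (t * t * v i)  ≈⟨ solve 3 (λ a p v → a :+ (:- (p :* v)) := (:- p) :* v :+ a) refl
                                                   (1# * (Aᴿ · Aᴿ · v) i) (t * t) (v i) ⟩
      - (t * t) * v i + 1# * (Aᴿ · Aᴿ · v) i  ≈⟨ pencil-· (- (t * t)) 1# v i ⟨
      (pencil (- (t * t)) 1# · v) i           ≈⟨ eq i ⟩
      0#                                      ∎)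

  -- The two pencils are negatives of each other, so the diagonal of each is both nonnegative and
  -- nonpositive. A semidefinite matrix with zero diagonal is zero by `psd-isotropic`.
  squeeze : ∀ α → PSD (pencil α (- 1#)) → PSD (pencil (- α) 1#) →
            ∀ i j → embed ((A ⊙ A) i j) ≈ α * embed (identity i j)
  squeeze α top bottom i j = sym (-≈0⇒≈ (begin
    α * embed (identity i j) + - embed ((A ⊙ A) i j)
      ≈⟨ +-congˡ (-‿cong (*-identityˡ _)) ⟨
    α * embed (identity i j) + - (1# * embed ((A ⊙ A) i j))
      ≈⟨ solve 3 (λ p e a → p :+ (:- (e :* a)) := p :+ (:- e) :* a) refl
           (α * embed (identity i j)) 1# (embed ((A ⊙ A) i j)) ⟩
    pencil α (- 1#) i j
      ≈⟨ psd-isotropic _ (pencil-sym α (- 1#)) top i j (nonNeg-antisym (psd-diagonal _ top i)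
           (nonNeg-resp (trans (pencil-cong refl (sym (-‿involutive 1#)) i i) (pencil-neg α (- 1#) i i))
             (psd-diagonal _ bottom i))) ⟩
    0# ∎))

open ≡ using (refl; sym; trans; cong; cong₂; subst; subst₂)

-- Integer linear equations and principal submatrices

module ℕ-Sum = Algebra.Properties.Semiring.Sum ℕ.+-*-semiring

-- One elimination step uses the pivot p of the first row and multiplies through by it.
nontrivial-solution : ∀ {l k} (r : Fin l → Fin k → ℤ) → l ℕ.< k →
  ∃ λ (x : Fin k → ℤ) → ∃ λ (p : Fin k) →
    x p ≢ 0ℤ × (∀ a → ℤ-Sum.sum (λ i → r a i ℤ.* x i) ≡ 0ℤ)
nontrivial-solution {zero}  {suc k} r _ = (λ _ → 1ℤ) , zero , (λ ()) , λ ()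
nontrivial-solution {suc l} {suc k} r (ℕ.s≤s l<k) with Fin.any? (λ i → ¬? (r zero i ℤ.≟ 0ℤ))
... | no r₀≡0 =
  let x , p , xₚ≢0 , eqs = nontrivial-solution (λ a → r (suc a)) (ℕ.m<n⇒m<1+n l<k)
  in x , p , xₚ≢0 , λ where
    zero → trans (ℤ-Sum.sum-cong-≗ λ i → cong (ℤ._* x i)
             (decidable-stable (r zero i ℤ.≟ 0ℤ) λ r≢0 → r₀≡0 (i , r≢0)))
             (ℤ-Sum.sum-replicate-zero (suc k))
    (suc a) → eqs a
... | yes (p , c≢0) =
  let x′ , q , x′≢0 , eqs = nontrivial-solution r′ l<k
      -- With the other unknowns scaled by the pivot `c`, this value of the pivot unknown solves the
      -- first row without division.
      s = ℤ.- β zero x′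
      x = Vector.insertAt (λ i → c ℤ.* x′ i) p s
      xᵢ : ∀ i → x (punchIn p i) ≡ c ℤ.* x′ i
      xᵢ = Vector.insertAt-punchIn (λ i → c ℤ.* x′ i) p s
  in x , punchIn p q
   , (λ x≡0 → Sum.[ c≢0 , x′≢0 ]′ (ℤ.i*j≡0⇒i≡0∨j≡0 c (trans (sym (xᵢ q)) x≡0)))
   , λ a → begin
       ℤ-Sum.sum (λ i → r a i ℤ.* x i)
         ≡⟨ ℤ-Sum.sum-remove {i = p} (λ i → r a i ℤ.* x i) ⟩
       r a p ℤ.* x p ℤ.+ ℤ-Sum.sum (λ i → r a (punchIn p i) ℤ.* x (punchIn p i))
         ≡⟨ cong₂ ℤ._+_ (cong (λ z → r a p ℤ.* z) (Vector.insertAt-lookup (λ i → c ℤ.* x′ i) p s))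
              (ℤ-Sum.sum-cong-≗ λ i → trans (cong (λ z → r a (punchIn p i) ℤ.* z) (xᵢ i))
                (swap (r a (punchIn p i)) c (x′ i))) ⟩
       r a p ℤ.* s ℤ.+ ℤ-Sum.sum (λ i → c ℤ.* (r a (punchIn p i) ℤ.* x′ i))
         ≡⟨ cong (λ z → r a p ℤ.* s ℤ.+ z) (ℤ-Sum.*-distribˡ-sum c (λ i → r a (punchIn p i) ℤ.* x′ i)) ⟨
       r a p ℤ.* s ℤ.+ c ℤ.* β a x′
         ≡⟨ reduced a x′ eqs ⟩
       0ℤ ∎
  where
  open ≡.≡-Reasoning
  open ℤ-Solver.+-*-Solver
  c = r zero p
  β : Fin (suc l) → (Fin k → ℤ) → ℤ
  β a x = ℤ-Sum.sum λ i → r a (punchIn p i) ℤ.* x i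
  r′ : Fin l → Fin k → ℤ
  r′ a i = c ℤ.* r (suc a) (punchIn p i) ℤ.+ ℤ.- r (suc a) p ℤ.* r zero (punchIn p i)
  swap : ∀ a b c → a ℤ.* (b ℤ.* c) ≡ b ℤ.* (a ℤ.* c)
  swap = solve 3 (λ a b c → a :* (b :* c) := b :* (a :* c)) refl
  reduced : ∀ a x → (∀ a → ℤ-Sum.sum (λ i → r′ a i ℤ.* x i) ≡ 0ℤ) →
            r a p ℤ.* (ℤ.- β zero x) ℤ.+ c ℤ.* β a x ≡ 0ℤ
  reduced zero    x _   = solve 2 (λ c b → c :* (:- b) :+ c :* b := con 0ℤ) refl c (β zero x)
  reduced (suc a) x eqs = begin
    d ℤ.* (ℤ.- β zero x) ℤ.+ c ℤ.* β (suc a) x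
      ≡⟨ solve 4 (λ d b c e → d :* (:- b) :+ c :* e := c :* e :+ (:- d) :* b) refl
           d (β zero x) c (β (suc a) x) ⟩
    c ℤ.* β (suc a) x ℤ.+ ℤ.- d ℤ.* β zero x
      ≡⟨ cong₂ ℤ._+_ (ℤ-Sum.*-distribˡ-sum c (λ i → r (suc a) (punchIn p i) ℤ.* x i))
                     (ℤ-Sum.*-distribˡ-sum (ℤ.- d) (λ i → r zero (punchIn p i) ℤ.* x i)) ⟩
    ℤ-Sum.sum (λ i → c ℤ.* (r (suc a) (punchIn p i) ℤ.* x i)) ℤ.+
    ℤ-Sum.sum (λ i → ℤ.- d ℤ.* (r zero (punchIn p i) ℤ.* x i))
      ≡⟨ ℤ-Sum.∑-distrib-+ (λ i → c ℤ.* (r (suc a) (punchIn p i) ℤ.* x i))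
                           (λ i → ℤ.- d ℤ.* (r zero (punchIn p i) ℤ.* x i)) ⟨
    ℤ-Sum.sum (λ i → c ℤ.* (r (suc a) (punchIn p i) ℤ.* x i) ℤ.+ ℤ.- d ℤ.* (r zero (punchIn p i) ℤ.* x i))
      ≡⟨ ℤ-Sum.sum-cong-≗ (λ i → solve 5 (λ c e x d b →
           c :* (e :* x) :+ (:- d) :* (b :* x) := (c :* e :+ (:- d) :* b) :* x) refl
           c (r (suc a) (punchIn p i)) (x i) d (r zero (punchIn p i))) ⟩
    ℤ-Sum.sum (λ i → r′ a i ℤ.* x i)
      ≡⟨ eqs a ⟩
    0ℤ ∎
    where d = r (suc a) p

-- The remaining points are characterised by how sums split, which is the form in which they enter.
-- The induction deletes the point `f zero` from the ambient set and renumbers the rest.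
complement : ∀ {k N} (f : Fin k → Fin N) → (∀ {i j} → f i ≡ f j → i ≡ j) →
  ∃ λ l → ∃ λ (g : Fin l → Fin N) → k ℕ.+ l ≡ N ×
    (∀ (h : Fin N → ℤ) → ℤ-Sum.sum h ≡ ℤ-Sum.sum (λ i → h (f i)) ℤ.+ ℤ-Sum.sum (λ j → h (g j)))
complement {zero}  {N}     f f-inj = N , (λ j → j) , refl , λ h → sym (ℤ.+-identityˡ (ℤ-Sum.sum h))
complement {suc k} {zero}  f f-inj with () ← f zero
complement {suc k} {suc N} f f-inj =
  let p   = f zero
      p≢ : ∀ i → p ≢ f (suc i)
      p≢ i p≡ = Fin.0≢1+n (f-inj p≡)
      f′ = λ i → punchOut (p≢ i)
      l , g , k+l≡N , split = complement f′
        (λ {i} {j} eq → Fin.suc-injective (f-inj (Fin.punchOut-injective (p≢ i) (p≢ j) eq)))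
  in l , (λ j → punchIn p (g j)) , cong suc k+l≡N , λ h → begin
    ℤ-Sum.sum h
      ≡⟨ ℤ-Sum.sum-remove {i = p} h ⟩
    h p ℤ.+ ℤ-Sum.sum (λ i → h (punchIn p i))
      ≡⟨ cong (λ z → h p ℤ.+ z) (split (λ i → h (punchIn p i))) ⟩
    h p ℤ.+ (ℤ-Sum.sum (λ i → h (punchIn p (f′ i))) ℤ.+ ℤ-Sum.sum (λ j → h (punchIn p (g j))))
      ≡⟨ ℤ.+-assoc (h p) _ _ ⟨
    h p ℤ.+ ℤ-Sum.sum (λ i → h (punchIn p (f′ i))) ℤ.+ ℤ-Sum.sum (λ j → h (punchIn p (g j)))
      ≡⟨ cong (λ s → h p ℤ.+ s ℤ.+ ℤ-Sum.sum (λ j → h (punchIn p (g j))))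
           (ℤ-Sum.sum-cong-≗ λ i → cong h (Fin.punchIn-punchOut (p≢ i))) ⟩
    h p ℤ.+ ℤ-Sum.sum (λ i → h (f (suc i))) ℤ.+ ℤ-Sum.sum (λ j → h (punchIn p (g j))) ∎
  where open ≡.≡-Reasoning

argmax : ∀ {k} (x : Fin k → ℕ) → Fin k → ∃[ p ] (∀ i → x i ℕ.≤ x p)
argmax {suc zero}    x _ = zero , λ { zero → ℕ.≤-refl }
argmax {suc (suc k)} x _ with argmax (λ i → x (suc i)) zero
... | p , max with ℕ.≤-total (x zero) (x (suc p))
...   | inj₁ x₀≤xₚ = suc p , λ { zero → x₀≤xₚ ; (suc i) → max i }
...   | inj₂ xₚ≤x₀ = zero , λ { zero → ℕ.≤-refl ; (suc i) → ℕ.≤-trans (max i) xₚ≤x₀ }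

∣sum∣≤ : ∀ {k} (a b : Fin k → ℤ) B → (∀ i → ℤ.∣ b i ∣ ℕ.≤ B) →
         ℤ.∣ ℤ-Sum.sum (λ i → a i ℤ.* b i) ∣ ℕ.≤ ℕ-Sum.sum (λ i → ℤ.∣ a i ∣) ℕ.* B
∣sum∣≤ {zero}  a b B b≤B = ℕ.z≤n
∣sum∣≤ {suc k} a b B b≤B = begin
  ℤ.∣ a zero ℤ.* b zero ℤ.+ t ∣                     ≤⟨ ℤ.∣i+j∣≤∣i∣+∣j∣ (a zero ℤ.* b zero) t ⟩
  ℤ.∣ a zero ℤ.* b zero ∣ ℕ.+ ℤ.∣ t ∣               ≡⟨ cong (ℕ._+ ℤ.∣ t ∣) (ℤ.abs-* (a zero) (b zero)) ⟩
  ℤ.∣ a zero ∣ ℕ.* ℤ.∣ b zero ∣ ℕ.+ ℤ.∣ t ∣         ≤⟨ ℕ.+-mono-≤ (ℕ.*-monoʳ-≤ ℤ.∣ a zero ∣ (b≤B zero))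
                                                        (∣sum∣≤ (λ i → a (suc i)) (λ i → b (suc i)) B (λ i → b≤B (suc i))) ⟩
  ℤ.∣ a zero ∣ ℕ.* B ℕ.+ s ℕ.* B                    ≡⟨ ℕ.*-distribʳ-+ B ℤ.∣ a zero ∣ s ⟨
  (ℤ.∣ a zero ∣ ℕ.+ s) ℕ.* B                        ∎
  where
  open ℕ.≤-Reasoning
  t = ℤ-Sum.sum λ i → a (suc i) ℤ.* b (suc i)
  s = ℕ-Sum.sum λ i → ℤ.∣ a (suc i) ∣

square-sum : ∀ {n} (M : Matrix (Fin n)) {k} (y : Fin k → Fin n) (x : Fin k → ℤ) u →
  ℤ-Sum.sum (λ w → M u w ℤ.* ℤ-Sum.sum (λ i → M w (y i) ℤ.* x i)) ≡
  ℤ-Sum.sum (λ i → (M ⊙ M) u (y i) ℤ.* x i)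
square-sum M y x u = begin
  ℤ-Sum.sum (λ w → M u w ℤ.* ℤ-Sum.sum (λ i → M w (y i) ℤ.* x i))
    ≡⟨ ℤ-Sum.sum-cong-≗ (λ w → trans (ℤ-Sum.*-distribˡ-sum (M u w) (λ i → M w (y i) ℤ.* x i))
         (ℤ-Sum.sum-cong-≗ λ i → sym (ℤ.*-assoc (M u w) (M w (y i)) (x i)))) ⟩
  ℤ-Sum.sum (λ w → ℤ-Sum.sum (λ i → M u w ℤ.* M w (y i) ℤ.* x i))
    ≡⟨ ℤ-Sum.∑-comm (λ w i → M u w ℤ.* M w (y i) ℤ.* x i) ⟩
  ℤ-Sum.sum (λ i → ℤ-Sum.sum (λ w → M u w ℤ.* M w (y i) ℤ.* x i))
    ≡⟨ ℤ-Sum.sum-cong-≗ (λ i → ℤ-Sum.*-distribʳ-sum (x i) (λ w → M u w ℤ.* M w (y i))) ⟨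
  ℤ-Sum.sum (λ i → (M ⊙ M) u (y i) ℤ.* x i) ∎
  where open ≡.≡-Reasoning

-- The row bound `D` is spent twice at the entry `x p` of largest absolute value: once to bound
-- every entry of `X x` by `D |x p|`, once more for `X (X x)`, whose entry at `p` is `d x p`.
principal-submatrix-bound : ∀ {N k} (M : Matrix (Fin N)) d D → (∀ u v → (M ⊙ M) u v ≡ + d ℤ.* identity u v) →
  (f : Fin k → Fin N) → (∀ {i j} → f i ≡ f j → i ≡ j) → N ℕ.< k ℕ.+ k →
  (∀ i → ℕ-Sum.sum (λ j → ℤ.∣ M (f i) (f j) ∣) ℕ.≤ D) → d ℕ.≤ D ℕ.* D
principal-submatrix-bound {N} {k} M d D M²≡d f f-inj N<2k rows≤D =
  -- `|x p|` dominates `|x q|`, and `x q` is nonzero, so this factor can be cancelled.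
  ℕ.*-cancelʳ-≤ d (D ℕ.* D) ℤ.∣ x p ∣ {{ℕ.≢-nonZero λ xₚ≡0 → xq≢0 (ℤ.∣i∣≡0⇒i≡0 (ℕ.n≤0⇒n≡0
    (subst (ℤ.∣ x q ∣ ℕ.≤_) xₚ≡0 (x≤xₚ q))))}} (begin
    d ℕ.* ℤ.∣ x p ∣                       ≡⟨ ℤ.abs-* (+ d) (x p) ⟨
    ℤ.∣ + d ℤ.* x p ∣                     ≡⟨ cong ℤ.∣_∣ (sym Xy≡dx) ⟩
    ℤ.∣ ℤ-Sum.sum (λ j → M (f p) (f j) ℤ.* y (f j)) ∣
      ≤⟨ ∣sum∣≤ (λ j → M (f p) (f j)) (λ j → y (f j)) (D ℕ.* ℤ.∣ x p ∣) y≤ ⟩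
    ℕ-Sum.sum (λ j → ℤ.∣ M (f p) (f j) ∣) ℕ.* (D ℕ.* ℤ.∣ x p ∣)
      ≤⟨ ℕ.*-monoˡ-≤ (D ℕ.* ℤ.∣ x p ∣) (rows≤D p) ⟩
    D ℕ.* (D ℕ.* ℤ.∣ x p ∣)               ≡⟨ ℕ.*-assoc D D ℤ.∣ x p ∣ ⟨
    D ℕ.* D ℕ.* ℤ.∣ x p ∣                 ∎)
  where
  open ℕ.≤-Reasoning
  module R = ≡.≡-Reasoning
  comp = complement f f-inj
  l = proj₁ comp
  g = proj₁ (proj₂ comp)
  l<k : l ℕ.< k
  l<k = ℕ.+-cancelˡ-< k l k (subst (ℕ._< k ℕ.+ k) (sym (proj₁ (proj₂ (proj₂ comp)))) N<2k)
  solution = nontrivial-solution (λ a i → M (g a) (f i)) l<k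
  x = proj₁ solution
  q = proj₁ (proj₂ solution)
  xq≢0 = proj₁ (proj₂ (proj₂ solution))
  y : Fin N → ℤ
  y w = ℤ-Sum.sum λ i → M w (f i) ℤ.* x i
  p = proj₁ (argmax (λ i → ℤ.∣ x i ∣) q)
  x≤xₚ = proj₂ (argmax (λ i → ℤ.∣ x i ∣) q)
  y≤ : ∀ j → ℤ.∣ y (f j) ∣ ℕ.≤ D ℕ.* ℤ.∣ x p ∣
  y≤ j = ℕ.≤-trans (∣sum∣≤ (λ i → M (f j) (f i)) x ℤ.∣ x p ∣ x≤xₚ) (ℕ.*-monoˡ-≤ ℤ.∣ x p ∣ (rows≤D j))
  Xy≡dx : ℤ-Sum.sum (λ j → M (f p) (f j) ℤ.* y (f j)) ≡ + d ℤ.* x p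
  Xy≡dx = R.begin
    ℤ-Sum.sum (λ j → M (f p) (f j) ℤ.* y (f j))
      -- The terms off the set are zero by the choice of `x`; adding them completes the sum to a
      -- full row of `M`, to which the hypothesis on `M ⊙ M` applies.
      R.≡⟨ ℤ.+-identityʳ _ ⟨
    ℤ-Sum.sum (λ j → M (f p) (f j) ℤ.* y (f j)) ℤ.+ 0ℤ
      R.≡⟨ cong (λ z → ℤ-Sum.sum (λ j → M (f p) (f j) ℤ.* y (f j)) ℤ.+ z) (trans (ℤ-Sum.sum-cong-≗ λ a →
           trans (cong (λ z → M (f p) (g a) ℤ.* z) (proj₂ (proj₂ (proj₂ solution)) a)) (ℤ.*-zeroʳ (M (f p) (g a))))
           (ℤ-Sum.sum-replicate-zero l)) ⟨
    ℤ-Sum.sum (λ j → M (f p) (f j) ℤ.* y (f j)) ℤ.+ ℤ-Sum.sum (λ a → M (f p) (g a) ℤ.* y (g a))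
      R.≡⟨ proj₂ (proj₂ (proj₂ comp)) (λ w → M (f p) w ℤ.* y w) ⟨
    ℤ-Sum.sum (λ w → M (f p) w ℤ.* y w)
      R.≡⟨ square-sum M f x (f p) ⟩
    ℤ-Sum.sum (λ i → (M ⊙ M) (f p) (f i) ℤ.* x i)
      R.≡⟨ ℤ-Sum.sum-cong-≗ (λ i → cong (ℤ._* x i) (M²≡d (f p) (f i))) ⟩
    ℤ-Sum.sum (λ i → + d ℤ.* identity (f p) (f i) ℤ.* x i)
      R.≡⟨ sum-single ℤ.+-0-commutativeMonoid (λ i → + d ℤ.* identity (f p) (f i) ℤ.* x i) p (λ i i≢p →
           cong (ℤ._* x i) (trans (cong (λ z → + d ℤ.* z) (diagonal-≢ (λ _ → 1ℤ) λ fp≡fi → i≢p (f-inj (sym fp≡fi))))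
             (ℤ.*-zeroʳ (+ d)))) ⟩
    + d ℤ.* identity (f p) (f p) ℤ.* x p
      R.≡⟨ cong (ℤ._* x p) (trans (cong (λ z → + d ℤ.* z) (diagonal-refl (λ _ → 1ℤ) (f p))) (ℤ.*-identityʳ (+ d))) ⟩
    + d ℤ.* x p R.∎

-- Squares of the two product matrices

diagonal-⊙ˡ : ∀ {n} d (N : Matrix (Fin n)) i j → (diagonal d ⊙ N) i j ≡ d i ℤ.* N i j
diagonal-⊙ˡ d N i j = trans
  (sum-single ℤ.+-0-commutativeMonoid (λ k → diagonal d i k ℤ.* N k j) i λ k k≢i →
    cong (ℤ._* N k j) (diagonal-≢ d λ i≡k → k≢i (sym i≡k)))
  (cong (ℤ._* N i j) (diagonal-refl d i))

diagonal-⊙ʳ : ∀ {n} (M : Matrix (Fin n)) d i j → (M ⊙ diagonal d) i j ≡ M i j ℤ.* d j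
diagonal-⊙ʳ M d i j = trans
  (sum-single ℤ.+-0-commutativeMonoid (λ k → M i k ℤ.* diagonal d k j) j λ k k≢j →
    trans (cong (M i k ℤ.*_) (diagonal-≢ d k≢j)) (ℤ.*-zeroʳ (M i k)))
  (cong (M i j ℤ.*_) (diagonal-refl d j))

infixl 7 _⊡_

-- Matrix product over pairs. The iterated sum lets Kronecker products factor; `Δ-bound` later moves
-- it to a single index.
_⊡_ : ∀ {n m} → Matrix (Fin n × Fin m) → Matrix (Fin n × Fin m) → Matrix (Fin n × Fin m)
(M ⊡ N) u v = ℤ-Sum.sum λ j → ℤ-Sum.sum λ l → M u (j , l) ℤ.* N (j , l) v

⊡-cong : ∀ {n m} {M M′ N N′ : Matrix (Fin n × Fin m)} → (∀ u v → M u v ≡ M′ u v) → (∀ u v → N u v ≡ N′ u v) →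
         ∀ u v → (M ⊡ N) u v ≡ (M′ ⊡ N′) u v
⊡-cong M≡M′ N≡N′ u v = ℤ-Sum.sum-cong-≗ λ j → ℤ-Sum.sum-cong-≗ λ l →
  cong₂ ℤ._*_ (M≡M′ u (j , l)) (N≡N′ (j , l) v)

module _ {n m : ℕ} where
  open ≡.≡-Reasoning
  open ℤ-Solver.+-*-Solver

  mixed-product : ∀ (M N : Matrix (Fin n)) (P Q : Matrix (Fin m)) i k j l →
    ((M ⊗ P) ⊡ (N ⊗ Q)) (i , k) (j , l) ≡ (M ⊙ N) i j ℤ.* (P ⊙ Q) k l
  mixed-product M N P Q i k j l = begin
    ℤ-Sum.sum (λ a → ℤ-Sum.sum λ b → (M i a ℤ.* P k b) ℤ.* (N a j ℤ.* Q b l))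
      ≡⟨ ℤ-Sum.sum-cong-≗ (λ a → trans
           (ℤ-Sum.sum-cong-≗ λ b → solve 4 (λ x y z w → (x :* y) :* (z :* w) := (x :* z) :* (y :* w)) refl
             (M i a) (P k b) (N a j) (Q b l))
           (sym (ℤ-Sum.*-distribˡ-sum (M i a ℤ.* N a j) (λ b → P k b ℤ.* Q b l)))) ⟩
    ℤ-Sum.sum (λ a → M i a ℤ.* N a j ℤ.* (P ⊙ Q) k l)
      ≡⟨ ℤ-Sum.*-distribʳ-sum ((P ⊙ Q) k l) (λ a → M i a ℤ.* N a j) ⟨
    (M ⊙ N) i j ℤ.* (P ⊙ Q) k l ∎

  ⊕-⊡-⊕ : ∀ (A B C D : Matrix (Fin n × Fin m)) u v →
    ((A ⊕ B) ⊡ (C ⊕ D)) u v ≡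
    ((A ⊡ C) u v ℤ.+ (A ⊡ D) u v) ℤ.+ ((B ⊡ C) u v ℤ.+ (B ⊡ D) u v)
  ⊕-⊡-⊕ A B C D u v = begin
    ΣΣ (λ w → (A u w ℤ.+ B u w) ℤ.* (C w v ℤ.+ D w v))
      ≡⟨ ℤ-Sum.sum-cong-≗ (λ j → ℤ-Sum.sum-cong-≗ λ l → let w = j , l in
           solve 4 (λ a b c d → (a :+ b) :* (c :+ d) := (a :* c :+ a :* d) :+ (b :* c :+ b :* d)) refl
             (A u w) (B u w) (C w v) (D w v)) ⟩
    ΣΣ (λ w → (A u w ℤ.* C w v ℤ.+ A u w ℤ.* D w v) ℤ.+ (B u w ℤ.* C w v ℤ.+ B u w ℤ.* D w v))
      ≡⟨ ΣΣ-+ (λ w → A u w ℤ.* C w v ℤ.+ A u w ℤ.* D w v) (λ w → B u w ℤ.* C w v ℤ.+ B u w ℤ.* D w v) ⟩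
    ΣΣ (λ w → A u w ℤ.* C w v ℤ.+ A u w ℤ.* D w v) ℤ.+ ΣΣ (λ w → B u w ℤ.* C w v ℤ.+ B u w ℤ.* D w v)
      ≡⟨ cong₂ ℤ._+_ (ΣΣ-+ (λ w → A u w ℤ.* C w v) (λ w → A u w ℤ.* D w v))
                     (ΣΣ-+ (λ w → B u w ℤ.* C w v) (λ w → B u w ℤ.* D w v)) ⟩
    ((A ⊡ C) u v ℤ.+ (A ⊡ D) u v) ℤ.+ ((B ⊡ C) u v ℤ.+ (B ⊡ D) u v) ∎
    where
    ΣΣ : (Fin n × Fin m → ℤ) → ℤ
    ΣΣ h = ℤ-Sum.sum λ j → ℤ-Sum.sum λ l → h (j , l)
    ΣΣ-+ : ∀ g h → ΣΣ (λ w → g w ℤ.+ h w) ≡ ΣΣ g ℤ.+ ΣΣ h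
    ΣΣ-+ g h = trans
      (ℤ-Sum.sum-cong-≗ λ j → ℤ-Sum.∑-distrib-+ (λ l → g (j , l)) (λ l → h (j , l)))
      (ℤ-Sum.∑-distrib-+ (λ j → ℤ-Sum.sum λ l → g (j , l)) (λ j → ℤ-Sum.sum λ l → h (j , l)))

  module _ (Γ₁ : SignedGraph (Fin n)) (B : Bipartition Γ₁) (Γ₂ : SignedGraph (Fin m))
           {d₁ d₂ : ℕ} (A₁² : ∀ i j → (adjacencyMatrix Γ₁ ⊙ adjacencyMatrix Γ₁) i j ≡ + d₁ ℤ.* identity i j)
           (A₂² : ∀ i j → (adjacencyMatrix Γ₂ ⊙ adjacencyMatrix Γ₂) i j ≡ + d₂ ℤ.* identity i j) where
    private
      A₁ = adjacencyMatrix Γ₁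
      A₂ = adjacencyMatrix Γ₂
      D  = classSign B

      ε : Fin n → ℤ
      ε i = if inV₁ B i then 1ℤ else -1ℤ

      -- Where `A₁ i j` is nonzero, `i` and `j` lie in opposite classes by `crosses`, so `ε i` is
      -- `- ε j`.
      anticommute : ∀ i j → (D ⊙ A₁) i j ≡ ℤ.- (A₁ ⊙ D) i j
      anticommute i j = begin
        (D ⊙ A₁) i j        ≡⟨ diagonal-⊙ˡ ε A₁ i j ⟩
        ε i ℤ.* A₁ i j      ≡⟨ cases (adj Γ₁ i j) (σ Γ₁ i j) (crosses B i j) ⟩
        ℤ.- (A₁ i j ℤ.* ε j) ≡⟨ cong ℤ.-_ (diagonal-⊙ʳ A₁ ε i j) ⟨
        ℤ.- (A₁ ⊙ D) i j    ∎
        where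
        -- The Boolean is generalised together with the sign function whose type depends on it, so
        -- that matching lets `signedEntry` reduce.
        cases : ∀ b (s : T b → _) → (T b → inV₁ B i ≡ not (inV₁ B j)) →
                ε i ℤ.* signedEntry b s ≡ ℤ.- (signedEntry b s ℤ.* ε j)
        cases false s _ = ℤ.*-zeroʳ (ε i)
        cases true  s cross with inV₁ B i | inV₁ B j | cross tt
        ... | true  | false | _ = solve 1 (λ a → con 1ℤ :* a := :- (a :* con -1ℤ)) refl (signedEntry true s)
        ... | false | true  | _ = solve 1 (λ a → con -1ℤ :* a := :- (a :* con 1ℤ)) refl (signedEntry true s)

      D² : ∀ i j → (D ⊙ D) i j ≡ identity i j
      D² i j = trans (diagonal-⊙ˡ ε D i j) (entry (i Fin.≟ j))
        where
        entry : Dec (i ≡ j) → ε i ℤ.* D i j ≡ identity i j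
        entry (yes refl) = trans (cong (ε i ℤ.*_) (diagonal-refl ε i))
          (trans (square (inV₁ B i)) (sym (diagonal-refl (λ _ → 1ℤ) i)))
          where
          square : ∀ b → (if b then 1ℤ else -1ℤ) ℤ.* (if b then 1ℤ else -1ℤ) ≡ 1ℤ
          square true  = refl
          square false = refl
        entry (no i≢j) = trans (trans (cong (ε i ℤ.*_) (diagonal-≢ ε i≢j)) (ℤ.*-zeroʳ (ε i)))
          (sym (diagonal-≢ (λ _ → 1ℤ) i≢j))

    -- The mixed terms are `A₁ D ⊗ A₂` and `D A₁ ⊗ A₂`, which cancel by `anticommute`; the pure
    -- terms contribute `d₁` and `d₂`.
    cartesian-square : ∀ u v → (cartesianMatrix Γ₁ B Γ₂ ⊡ cartesianMatrix Γ₁ B Γ₂) u v ≡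
                               + (d₁ ℕ.+ d₂) ℤ.* (identity ⊗ identity) u v
    cartesian-square u@(i , k) v@(j , l) = begin
      (((A₁ ⊗ identity) ⊕ (D ⊗ A₂)) ⊡ ((A₁ ⊗ identity) ⊕ (D ⊗ A₂))) u v
        ≡⟨ ⊕-⊡-⊕ (A₁ ⊗ identity) (D ⊗ A₂) (A₁ ⊗ identity) (D ⊗ A₂) u v ⟩
      (((A₁ ⊗ identity) ⊡ (A₁ ⊗ identity)) u v ℤ.+ ((A₁ ⊗ identity) ⊡ (D ⊗ A₂)) u v) ℤ.+
      (((D ⊗ A₂) ⊡ (A₁ ⊗ identity)) u v ℤ.+ ((D ⊗ A₂) ⊡ (D ⊗ A₂)) u v)
        ≡⟨ cong₂ ℤ._+_
             (cong₂ ℤ._+_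
               (trans (mixed-product A₁ A₁ identity identity i k j l)
                 (cong₂ ℤ._*_ (A₁² i j) (trans (diagonal-⊙ˡ (λ _ → 1ℤ) identity k l) (ℤ.*-identityˡ _))))
               (trans (mixed-product A₁ D identity A₂ i k j l)
                 (cong ((A₁ ⊙ D) i j ℤ.*_) (trans (diagonal-⊙ˡ (λ _ → 1ℤ) A₂ k l) (ℤ.*-identityˡ _)))))
             (cong₂ ℤ._+_
               (trans (mixed-product D A₁ A₂ identity i k j l)
                 (cong₂ ℤ._*_ (anticommute i j) (trans (diagonal-⊙ʳ A₂ (λ _ → 1ℤ) k l) (ℤ.*-identityʳ _))))
               (trans (mixed-product D D A₂ A₂ i k j l) (cong₂ ℤ._*_ (D² i j) (A₂² k l)))) ⟩
      (+ d₁ ℤ.* p ℤ.* q ℤ.+ (A₁ ⊙ D) i j ℤ.* A₂ k l) ℤ.+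
      (ℤ.- (A₁ ⊙ D) i j ℤ.* A₂ k l ℤ.+ p ℤ.* (+ d₂ ℤ.* q))
        ≡⟨ solve 6 (λ a b p q s t → (a :* p :* q :+ s :* t) :+ ((:- s) :* t :+ p :* (b :* q)) :=
             (a :+ b) :* (p :* q)) refl (+ d₁) (+ d₂) p q ((A₁ ⊙ D) i j) (A₂ k l) ⟩
      (+ d₁ ℤ.+ + d₂) ℤ.* (p ℤ.* q)
        ≡⟨ cong (ℤ._* (p ℤ.* q)) (ℤ.pos-+ d₁ d₂) ⟨
      + (d₁ ℕ.+ d₂) ℤ.* (p ℤ.* q) ∎
      where
      p = identity i j
      q = identity k l

    -- By `anticommute`, `(D + A₁)²` is `D² + A₁² = (1 + d₁) I`, and the second factor contributes
    -- `d₂`.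
    semiStrong-square : ∀ u v → (semiStrongMatrix Γ₁ B Γ₂ ⊡ semiStrongMatrix Γ₁ B Γ₂) u v ≡
                                + ((d₁ ℕ.+ 1) ℕ.* d₂) ℤ.* (identity ⊗ identity) u v
    semiStrong-square u@(i , k) v@(j , l) = begin
      (((D ⊕ A₁) ⊗ A₂) ⊡ ((D ⊕ A₁) ⊗ A₂)) u v
        ≡⟨ ⊡-cong expand expand u v ⟩
      (((D ⊗ A₂) ⊕ (A₁ ⊗ A₂)) ⊡ ((D ⊗ A₂) ⊕ (A₁ ⊗ A₂))) u v
        ≡⟨ ⊕-⊡-⊕ (D ⊗ A₂) (A₁ ⊗ A₂) (D ⊗ A₂) (A₁ ⊗ A₂) u v ⟩
      (((D ⊗ A₂) ⊡ (D ⊗ A₂)) u v ℤ.+ ((D ⊗ A₂) ⊡ (A₁ ⊗ A₂)) u v) ℤ.+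
      (((A₁ ⊗ A₂) ⊡ (D ⊗ A₂)) u v ℤ.+ ((A₁ ⊗ A₂) ⊡ (A₁ ⊗ A₂)) u v)
        ≡⟨ cong₂ ℤ._+_
             (cong₂ ℤ._+_
               (trans (mixed-product D D A₂ A₂ i k j l) (cong₂ ℤ._*_ (D² i j) (A₂² k l)))
               (trans (mixed-product D A₁ A₂ A₂ i k j l) (cong₂ ℤ._*_ (anticommute i j) (A₂² k l))))
             (cong₂ ℤ._+_
               (trans (mixed-product A₁ D A₂ A₂ i k j l) (cong ((A₁ ⊙ D) i j ℤ.*_) (A₂² k l)))
               (trans (mixed-product A₁ A₁ A₂ A₂ i k j l) (cong₂ ℤ._*_ (A₁² i j) (A₂² k l)))) ⟩
      (p ℤ.* (+ d₂ ℤ.* q) ℤ.+ ℤ.- (A₁ ⊙ D) i j ℤ.* (+ d₂ ℤ.* q)) ℤ.+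
      ((A₁ ⊙ D) i j ℤ.* (+ d₂ ℤ.* q) ℤ.+ + d₁ ℤ.* p ℤ.* (+ d₂ ℤ.* q))
        ≡⟨ solve 5 (λ a b p q s →
             (p :* (b :* q) :+ (:- s) :* (b :* q)) :+ (s :* (b :* q) :+ a :* p :* (b :* q)) :=
             (a :+ con 1ℤ) :* b :* (p :* q)) refl (+ d₁) (+ d₂) p q ((A₁ ⊙ D) i j) ⟩
      (+ d₁ ℤ.+ 1ℤ) ℤ.* + d₂ ℤ.* (p ℤ.* q)
        ≡⟨ cong (ℤ._* (p ℤ.* q)) (trans (ℤ.pos-* (d₁ ℕ.+ 1) d₂) (cong (ℤ._* + d₂) (ℤ.pos-+ d₁ 1))) ⟨
      + ((d₁ ℕ.+ 1) ℕ.* d₂) ℤ.* (p ℤ.* q) ∎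
      where
      p = identity i j
      q = identity k l
      expand : ∀ u v → ((D ⊕ A₁) ⊗ A₂) u v ≡ ((D ⊗ A₂) ⊕ (A₁ ⊗ A₂)) u v
      expand (i , k) (j , l) = ℤ.*-distribʳ-+ (A₂ k l) (D i j) (A₁ i j)

-- From pairs to one index, and from row sums to degrees

sum-++ : ∀ a {b} (h : Fin (a ℕ.+ b) → ℤ) →
         ℤ-Sum.sum h ≡ ℤ-Sum.sum (λ i → h (i ↑ˡ b)) ℤ.+ ℤ-Sum.sum (λ j → h (a ↑ʳ j))
sum-++ zero    h = sym (ℤ.+-identityˡ _)
sum-++ (suc a) h = trans (cong (λ z → h zero ℤ.+ z) (sum-++ a (λ i → h (suc i)))) (sym (ℤ.+-assoc (h zero) _ _))

sum-combine : ∀ n {m} (h : Fin (n ℕ.* m) → ℤ) →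
              ℤ-Sum.sum h ≡ ℤ-Sum.sum {n} (λ i → ℤ-Sum.sum {m} λ j → h (combine i j))
sum-combine zero        h = refl
sum-combine (suc n) {m} h = trans (sum-++ m h)
  (cong (λ z → ℤ-Sum.sum (λ j → h (j ↑ˡ n ℕ.* m)) ℤ.+ z) (sum-combine n (λ w → h (m ↑ʳ w))))

-- Entries at edges are `±1` and all others vanish, so absolute values forget the signing and count
-- neighbours.
degree-rows : ∀ {k} {V : Set} (Γ : SignedGraph V) (f : Fin k ↣ V) i →
  let open Injection f using (to) in
  ℕ-Sum.sum (λ j → ℤ.∣ adjacencyMatrix Γ (to i) (to j) ∣) ≡ degree (induced Γ f) i
degree-rows Γ f i = go (λ j → adj Γ (to i) (to j)) (λ j → σ Γ (to i) (to j))
  where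
  open Injection f using (to)
  go : ∀ {k} (a : Fin k → Bool) (s : ∀ j → T (a j) → _) →
       ℕ-Sum.sum (λ j → ℤ.∣ signedEntry (a j) (s j) ∣) ≡ ∣ tabulate a ∣
  go {zero}  a s = refl
  go {suc k} a s with a zero | s zero | go (λ j → a (suc j)) (λ j → s (suc j))
  ... | false | _  | eq = eq
  ... | true  | s₀ | eq = cong₂ ℕ._+_ (ℤ.abs-◃ (s₀ tt) 1) eq

degree≤Δ : ∀ {n} (Γ : SignedGraph (Fin n)) i → degree Γ i ℕ.≤ Δ Γ
degree≤Δ Γ = go (degree Γ)
  where
  go : ∀ {n} (h : Fin n → ℕ) i → h i ℕ.≤ Vector.foldr ℕ._⊔_ 0 h
  go h zero    = ℕ.m≤m⊔n (h zero) _
  go h (suc i) = ℕ.≤-trans (go (λ j → h (suc j)) i) (ℕ.m≤n⊔m (h zero) _)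

-- Carries `principal-submatrix-bound` along the bijection of `Fin (n * m)` with the pairs, under
-- which the product, the identity and the injection correspond.
Δ-bound : ∀ {n m k d} (Γ : SignedGraph (Fin n × Fin m)) (f : Fin k ↣ (Fin n × Fin m)) → n ℕ.* m ℕ.< k ℕ.+ k →
  (∀ u v → (adjacencyMatrix Γ ⊡ adjacencyMatrix Γ) u v ≡ + d ℤ.* (identity ⊗ identity) u v) →
  d ℕ.≤ Δ (induced Γ f) ℕ.* Δ (induced Γ f)
Δ-bound {n} {m} {k} {d} Γ f nm<2k A² = principal-submatrix-bound M d (Δ (induced Γ f)) M² f̂ f̂-inj nm<2k rows
  where
  open Injection f using (to; injective)
  open ≡.≡-Reasoning
  A = adjacencyMatrix Γ
  pair : Fin (n ℕ.* m) → Fin n × Fin m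
  pair = remQuot m
  M : Matrix (Fin (n ℕ.* m))
  M u v = A (pair u) (pair v)
  f̂ : Fin k → Fin (n ℕ.* m)
  f̂ i = uncurry combine (to i)
  pair-f̂ : ∀ i → pair (f̂ i) ≡ to i
  pair-f̂ i = Fin.remQuot-combine (proj₁ (to i)) (proj₂ (to i))
  f̂-inj : ∀ {i j} → f̂ i ≡ f̂ j → i ≡ j
  f̂-inj {i} {j} eq = injective (trans (sym (pair-f̂ i)) (trans (cong pair eq) (pair-f̂ j)))
  identity-pair : ∀ u v → (identity ⊗ identity) (pair u) (pair v) ≡ identity u v
  identity-pair u v = go (u Fin.≟ v)
    where
    p = pair u
    q = pair v
    zeroed : Dec (proj₁ p ≡ proj₁ q) → u ≢ v → identity (proj₁ p) (proj₁ q) ℤ.* identity (proj₂ p) (proj₂ q) ≡ 0ℤ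
    zeroed (no ≢₁)  u≢v = cong (ℤ._* identity (proj₂ p) (proj₂ q)) (diagonal-≢ (λ _ → 1ℤ) ≢₁)
    zeroed (yes ≡₁) u≢v = trans (cong (identity (proj₁ p) (proj₁ q) ℤ.*_) (diagonal-≢ (λ _ → 1ℤ) λ ≡₂ →
        u≢v (trans (sym (Fin.combine-remQuot {n} m u))
          (trans (cong₂ combine ≡₁ ≡₂) (Fin.combine-remQuot {n} m v)))))
      (ℤ.*-zeroʳ (identity (proj₁ p) (proj₁ q)))
    go : Dec (u ≡ v) → (identity ⊗ identity) p q ≡ identity u v
    go (yes refl) = trans (cong₂ ℤ._*_ (diagonal-refl (λ _ → 1ℤ) (proj₁ p)) (diagonal-refl (λ _ → 1ℤ) (proj₂ p)))
                          (sym (diagonal-refl (λ _ → 1ℤ) u))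
    go (no u≢v)   = trans (zeroed (proj₁ p Fin.≟ proj₁ q) u≢v) (sym (diagonal-≢ (λ _ → 1ℤ) u≢v))
  M² : ∀ u v → (M ⊙ M) u v ≡ + d ℤ.* identity u v
  M² u v = begin
    ℤ-Sum.sum (λ w → M u w ℤ.* M w v)
      ≡⟨ sum-combine n (λ w → M u w ℤ.* M w v) ⟩
    ℤ-Sum.sum {n} (λ i → ℤ-Sum.sum {m} λ j → A (pair u) (pair (combine i j)) ℤ.* A (pair (combine i j)) (pair v))
      ≡⟨ ℤ-Sum.sum-cong-≗ (λ i → ℤ-Sum.sum-cong-≗ λ j →
           cong (λ w → A (pair u) w ℤ.* A w (pair v)) (Fin.remQuot-combine i j)) ⟩
    (A ⊡ A) (pair u) (pair v)
      ≡⟨ A² (pair u) (pair v) ⟩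
    + d ℤ.* (identity ⊗ identity) (pair u) (pair v)
      ≡⟨ cong (λ z → + d ℤ.* z) (identity-pair u v) ⟩
    + d ℤ.* identity u v ∎
  rows : ∀ i → ℕ-Sum.sum (λ j → ℤ.∣ M (f̂ i) (f̂ j) ∣) ℕ.≤ Δ (induced Γ f)
  rows i = ℕ.≤-trans (ℕ.≤-reflexive (trans
    (ℕ-Sum.sum-cong-≗ λ j → cong₂ (λ u v → ℤ.∣ A u v ∣) (pair-f̂ i) (pair-f̂ j)) (degree-rows Γ f i)))
    (degree≤Δ (induced Γ f) i)

-- Rational estimates

open ℚ-Solver.+-*-Solver

p≤∣p∣ : ∀ p → p ℚ.≤ ℚ.∣ p ∣
p≤∣p∣ p with ℚ.≤-total 0ℚ p
... | inj₁ 0≤p = ℚ.≤-reflexive (sym (ℚ.0≤p⇒∣p∣≡p 0≤p))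
... | inj₂ p≤0 = ℚ.≤-trans p≤0 (ℚ.0≤∣p∣ p)

+-cancelʳ-< : ∀ r {p q} → p ℚ.+ r ℚ.< q ℚ.+ r → p ℚ.< q
+-cancelʳ-< r {p} {q} lt = subst₂ ℚ._<_ (eq p r) (eq q r) (ℚ.+-monoˡ-< (ℚ.- r) lt)
  where
  eq : ∀ p r → p ℚ.+ r ℚ.+ ℚ.- r ≡ p
  eq = solve 2 (λ p r → p :+ r :+ :- r := p) refl

dist-sym : ∀ p q → ℚ.∣ p ℚ.- q ∣ ≡ ℚ.∣ q ℚ.- p ∣
dist-sym p q = trans (sym (ℚ.∣-p∣≡∣p∣ (p ℚ.- q)))
  (cong ℚ.∣_∣ (solve 2 (λ p q → :- (p :- q) := q :- p) refl p q))

dist-triangle : ∀ p q r → ℚ.∣ p ℚ.- r ∣ ℚ.≤ ℚ.∣ p ℚ.- q ∣ ℚ.+ ℚ.∣ q ℚ.- r ∣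
dist-triangle p q r = ℚ.≤-trans
  (ℚ.≤-reflexive (cong ℚ.∣_∣ (solve 3 (λ p q r → p :- r := (p :- q) :+ (q :- r)) refl p q r)))
  (ℚ.∣p+q∣≤∣p∣+∣q∣ (p ℚ.- q) (q ℚ.- r))

dist<⇒< : ∀ p q {ε} → ℚ.∣ p ℚ.- q ∣ ℚ.< ε → p ℚ.< q ℚ.+ ε
dist<⇒< p q lt = subst (ℚ._< _) (solve 2 (λ p q → q :+ (p :- q) := p) refl p q)
  (ℚ.+-monoʳ-< q (ℚ.≤-<-trans (p≤∣p∣ (p ℚ.- q)) lt))

∣p∣< : ∀ p {ε} → p ℚ.< ε → ℚ.- p ℚ.< ε → ℚ.∣ p ∣ ℚ.< ε
∣p∣< p p<ε -p<ε with ℚ.∣p∣≡p∨∣p∣≡-p p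
... | inj₁ eq = subst (ℚ._< _) (sym eq) p<ε
... | inj₂ eq = subst (ℚ._< _) (sym eq) -p<ε

½-pos : ∀ {ε} → 0ℚ ℚ.< ε → 0ℚ ℚ.< ½ ℚ.* ε
½-pos {ε} 0<ε = subst (ℚ._< ½ ℚ.* ε) (ℚ.*-zeroʳ ½) (ℚ.*-monoʳ-<-pos ½ 0<ε)

½+½ : ∀ ε → ½ ℚ.* ε ℚ.+ ½ ℚ.* ε ≡ ε
½+½ ε = trans (sym (ℚ.*-distribʳ-+ ε ½ ½)) (ℚ.*-identityˡ ε)

½< : ∀ {ε} → 0ℚ ℚ.< ε → ½ ℚ.* ε ℚ.< ε
½< {ε} 0<ε = subst₂ ℚ._<_ (ℚ.+-identityʳ _) (½+½ ε) (ℚ.+-monoʳ-< (½ ℚ.* ε) (½-pos 0<ε))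

0<p*q : ∀ {p q} → 0ℚ ℚ.< p → 0ℚ ℚ.< q → 0ℚ ℚ.< p ℚ.* q
0<p*q {p} {q} 0<p 0<q = ℚ.positive⁻¹ _ {{ℚ.pos*pos⇒pos p {{ℚ.positive 0<p}} q {{ℚ.positive 0<q}}}}

-- The Cauchy reals as an ordered algebra

pointwise : ∀ {x y} → (∀ n → seq x n ≡ seq y n) → x ≈ᴿ y
pointwise {x} {y} eq ε 0<ε = 0 , λ n _ →
  subst (ℚ._< ε) (sym (cong ℚ.∣_∣ (trans (cong (ℚ._- seq y n) (eq n)) (ℚ.+-inverseʳ (seq y n))))) 0<ε

≈ᴿ-sym : ∀ {x y} → x ≈ᴿ y → y ≈ᴿ x
≈ᴿ-sym {x} {y} x≈y ε 0<ε =
  let N , close = x≈y ε 0<ε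
  in N , λ n N≤n → subst (ℚ._< ε) (dist-sym (seq x n) (seq y n)) (close n N≤n)

≈ᴿ-trans : ∀ {x y z} → x ≈ᴿ y → y ≈ᴿ z → x ≈ᴿ z
≈ᴿ-trans {x} {y} {z} x≈y y≈z ε 0<ε =
  let M , closeˣ = x≈y (½ ℚ.* ε) (½-pos 0<ε)
      N , closeʸ = y≈z (½ ℚ.* ε) (½-pos 0<ε)
  in M ℕ.⊔ N , λ n le → ℚ.≤-<-trans (dist-triangle (seq x n) (seq y n) (seq z n))
       (subst (_ ℚ.<_) (½+½ ε) (ℚ.+-mono-< (closeˣ n (ℕ.m⊔n≤o⇒m≤o M N le)) (closeʸ n (ℕ.m⊔n≤o⇒n≤o M N le))))

+ᴿ-cong : ∀ {x x′ y y′} → x ≈ᴿ x′ → y ≈ᴿ y′ → x +ᴿ y ≈ᴿ x′ +ᴿ y′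
+ᴿ-cong {x} {x′} {y} {y′} x≈x′ y≈y′ ε 0<ε =
  let M , closeˣ = x≈x′ (½ ℚ.* ε) (½-pos 0<ε)
      N , closeʸ = y≈y′ (½ ℚ.* ε) (½-pos 0<ε)
  in M ℕ.⊔ N , λ n le → ℚ.≤-<-trans
       (ℚ.≤-trans
         (ℚ.≤-reflexive (cong ℚ.∣_∣ (solve 4 (λ a b c d →
           (a :+ b) :- (c :+ d) := (a :- c) :+ (b :- d)) refl
           (seq x n) (seq y n) (seq x′ n) (seq y′ n))))
         (ℚ.∣p+q∣≤∣p∣+∣q∣ (seq x n ℚ.- seq x′ n) (seq y n ℚ.- seq y′ n)))
       (subst (_ ℚ.<_) (½+½ ε) (ℚ.+-mono-< (closeˣ n (ℕ.m⊔n≤o⇒m≤o M N le)) (closeʸ n (ℕ.m⊔n≤o⇒n≤o M N le))))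

*ᴿ-cong : ∀ {x x′ y y′} → x ≈ᴿ x′ → y ≈ᴿ y′ → x *ᴿ y ≈ᴿ x′ *ᴿ y′
*ᴿ-cong {x} {x′} {y} {y′} x≈x′ y≈y′ ε 0<ε =
  let P , 0<P , M₁ , x≤P  = eventually-bounded x
      Q , 0<Q , M₂ , y′≤Q = eventually-bounded y′
      δ , 0<δ , eq = divide-pos ε (P ℚ.+ Q) 0<ε (ℚ.+-mono-< 0<P 0<Q)
      N₁ , closeˣ = x≈x′ δ 0<δ
      N₂ , closeʸ = y≈y′ δ 0<δ
      M = M₁ ℕ.⊔ M₂
      N = N₁ ℕ.⊔ N₂
  in M ℕ.⊔ N , λ n le →
    let M≤n = ℕ.m⊔n≤o⇒m≤o M N le
        N≤n = ℕ.m⊔n≤o⇒n≤o M N le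
    in subst (_ ℚ.<_) eq (product-close (seq x n) (seq y n) (seq x′ n) (seq y′ n) 0<P 0<Q
         (x≤P n (ℕ.m⊔n≤o⇒m≤o M₁ M₂ M≤n)) (y′≤Q n (ℕ.m⊔n≤o⇒n≤o M₁ M₂ M≤n))
         (closeˣ n (ℕ.m⊔n≤o⇒m≤o N₁ N₂ N≤n)) (closeʸ n (ℕ.m⊔n≤o⇒n≤o N₁ N₂ N≤n)))

-ᴿ-cong : ∀ {x y} → x ≈ᴿ y → -ᴿ x ≈ᴿ -ᴿ y
-ᴿ-cong {x} {y} x≈y ε 0<ε =
  let N , close = x≈y ε 0<ε
  in N , λ n N≤n → subst (ℚ._< ε)
       (trans (dist-sym (seq x n) (seq y n)) (cong ℚ.∣_∣
         (solve 2 (λ a b → b :- a := (:- a) :- (:- b)) refl (seq x n) (seq y n))))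
       (close n N≤n)

-- One rational bound serves the whole tail: termwise positivity alone would admit sequences tending
-- to zero.
0<ᴿ_ : ℝ → Set
0<ᴿ x = ∃[ ε ] (0ℚ ℚ.< ε × ∃[ N ] (∀ n → N ℕ.≤ n → ε ℚ.≤ seq x n))

0<ᴿ-resp : ∀ {x y} → x ≈ᴿ y → 0<ᴿ x → 0<ᴿ y
0<ᴿ-resp {x} {y} x≈y (ε , 0<ε , M , ε≤x) =
  let N , close = x≈y (½ ℚ.* ε) (½-pos 0<ε)
  in ½ ℚ.* ε , ½-pos 0<ε , M ℕ.⊔ N , λ n le → ℚ.<⇒≤ (+-cancelʳ-< (½ ℚ.* ε)
       (ℚ.≤-<-trans (subst (ℚ._≤ _) (sym (½+½ ε)) (ε≤x n (ℕ.m⊔n≤o⇒m≤o M N le)))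
         (dist<⇒< (seq x n) (seq y n) (close n (ℕ.m⊔n≤o⇒n≤o M N le)))))

0<ᴿ-+ : ∀ {x y} → 0<ᴿ x → 0<ᴿ y → 0<ᴿ (x +ᴿ y)
0<ᴿ-+ (δ , 0<δ , M , δ≤x) (ε , 0<ε , N , ε≤y) =
  δ ℚ.+ ε , ℚ.+-mono-< 0<δ 0<ε , M ℕ.⊔ N , λ n le →
  ℚ.+-mono-≤ (δ≤x n (ℕ.m⊔n≤o⇒m≤o M N le)) (ε≤y n (ℕ.m⊔n≤o⇒n≤o M N le))

0<ᴿ-* : ∀ {x y} → 0<ᴿ x → 0<ᴿ y → 0<ᴿ (x *ᴿ y)
0<ᴿ-* {x} {y} (δ , 0<δ , M , δ≤x) (ε , 0<ε , N , ε≤y) =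
  δ ℚ.* ε , 0<p*q 0<δ 0<ε , M ℕ.⊔ N , λ n le →
  let δ≤xₙ = δ≤x n (ℕ.m⊔n≤o⇒m≤o M N le)
  in ℚ.≤-trans
    (ℚ.*-monoˡ-≤-nonNeg δ {{ℚ.nonNegative (ℚ.<⇒≤ 0<δ)}} (ε≤y n (ℕ.m⊔n≤o⇒n≤o M N le)))
    (ℚ.*-monoʳ-≤-nonNeg (seq y n) {{ℚ.nonNegative (ℚ.≤-trans (ℚ.<⇒≤ 0<ε) (ε≤y n (ℕ.m⊔n≤o⇒n≤o M N le)))}} δ≤xₙ)

0<ᴿ⇒≉0 : ∀ {x} → 0<ᴿ x → ¬ x ≈ᴿ 0ᴿ
0<ᴿ⇒≉0 {x} (ε , 0<ε , M , ε≤x) x≈0 =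
  let N , close = x≈0 ε 0<ε
      n = M ℕ.⊔ N
  in ℚ.<-irrefl refl (ℚ.<-≤-trans
       (subst (seq x n ℚ.<_) (ℚ.+-identityˡ ε) (dist<⇒< (seq x n) 0ℚ (close n (ℕ.m≤n⊔m M N))))
       (ε≤x n (ℕ.m≤m⊔n M N)))

0<ᴿ-from : ∀ x N {δ} → 0ℚ ℚ.< δ → (∀ n → N ℕ.≤ n → ℚ.∣ seq x N ℚ.- seq x n ∣ ℚ.< δ) →
           δ ℚ.+ δ ℚ.≤ seq x N → 0<ᴿ x
0<ᴿ-from x N {δ} 0<δ close 2δ≤x = δ , 0<δ , N , λ n N≤n →
  ℚ.<⇒≤ (+-cancelʳ-< δ (ℚ.≤-<-trans 2δ≤x (dist<⇒< (seq x N) (seq x n) (close n N≤n))))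

-- A single rational is inspected, the term at the modulus for `ε/4`, and compared with `ε/2`. If it
-- is at least that large in absolute value, the tail keeps its sign with margin `ε/4`; otherwise
-- the tail stays within `3ε/4` of zero.
classify : ∀ x ε → 0ℚ ℚ.< ε →
  ∃[ N ] (∀ n → N ℕ.≤ n → ℚ.∣ seq x n ℚ.- 0ℚ ∣ ℚ.< ε) ⊎ 0<ᴿ x ⊎ 0<ᴿ (-ᴿ x)
classify x ε 0<ε with ½ ℚ.* ε ℚ.≤? seq x N | ½ ℚ.* ε ℚ.≤? ℚ.- seq x N
  where
  δ = ½ ℚ.* (½ ℚ.* ε)
  N = proj₁ (cauchy x δ (½-pos (½-pos 0<ε)))
... | yes le | _ = inj₂ (inj₁ (0<ᴿ-from x _ (½-pos (½-pos 0<ε))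
        (λ n N≤n → proj₂ (cauchy x _ (½-pos (½-pos 0<ε))) _ n ℕ.≤-refl N≤n)
        (ℚ.≤-trans (ℚ.≤-reflexive (½+½ (½ ℚ.* ε))) le)))
... | no _ | yes le = inj₂ (inj₂ (0<ᴿ-from (-ᴿ x) _ (½-pos (½-pos 0<ε))
        (λ n N≤n → proj₂ (cauchy (-ᴿ x) _ (½-pos (½-pos 0<ε))) _ n ℕ.≤-refl N≤n)
        (ℚ.≤-trans (ℚ.≤-reflexive (½+½ (½ ℚ.* ε))) le)))
... | no x≱ | no -x≱ = inj₁ (_ , λ n N≤n → begin-strict
        ℚ.∣ seq x n ℚ.- 0ℚ ∣
          ≤⟨ dist-triangle (seq x n) (seq x N) 0ℚ ⟩
        ℚ.∣ seq x n ℚ.- seq x N ∣ ℚ.+ ℚ.∣ seq x N ℚ.- 0ℚ ∣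
          <⟨ ℚ.+-mono-< (close n N N≤n ℕ.≤-refl)
               (subst (λ z → ℚ.∣ z ∣ ℚ.< _) (sym (ℚ.+-identityʳ (seq x N)))
                 (∣p∣< (seq x N) (ℚ.≰⇒> x≱) (ℚ.≰⇒> -x≱))) ⟩
        ½ ℚ.* (½ ℚ.* ε) ℚ.+ ½ ℚ.* ε
          <⟨ ℚ.+-monoˡ-< (½ ℚ.* ε) (½< (½-pos 0<ε)) ⟩
        ½ ℚ.* ε ℚ.+ ½ ℚ.* ε
          ≡⟨ ½+½ ε ⟩
        ε ∎)
  where
  open ℚ.≤-Reasoning
  N = proj₁ (cauchy x (½ ℚ.* (½ ℚ.* ε)) (½-pos (½-pos 0<ε)))
  close = proj₂ (cauchy x (½ ℚ.* (½ ℚ.* ε)) (½-pos (½-pos 0<ε)))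

-- With both signs excluded, `classify` can only return a modulus, for every `ε`. This is the source
-- of `≋0-stable` and of trichotomy up to double negation.
unsigned⇒≈0 : ∀ x → ¬ (0<ᴿ x ⊎ 0<ᴿ (-ᴿ x)) → x ≈ᴿ 0ᴿ
unsigned⇒≈0 x ¬sign ε 0<ε with classify x ε 0<ε
... | inj₁ small = small
... | inj₂ sign  = ⊥-elim (¬sign sign)

infix  4 _≋_
infixl 6 _⊞_
infixl 7 _⊠_
infix  8 ⊟_

-- Sealed copies of the operations on ℝ: conversion checking must not compare
-- the Cauchy moduli carried by sums and products.
abstract
  _≋_ : ℝ → ℝ → Set
  _≋_ = _≈ᴿ_

  _⊞_ _⊠_ : ℝ → ℝ → ℝ
  _⊞_ = _+ᴿ_
  _⊠_ = _*ᴿ_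

  ⊟_ : ℝ → ℝ
  ⊟_ = -ᴿ_

  seq-⊞ : ∀ x y n → seq (x ⊞ y) n ≡ seq x n ℚ.+ seq y n
  seq-⊞ x y n = refl

  seq-⊠ : ∀ x y n → seq (x ⊠ y) n ≡ seq x n ℚ.* seq y n
  seq-⊠ x y n = refl

  seq-⊟ : ∀ x n → seq (⊟ x) n ≡ ℚ.- seq x n
  seq-⊟ x n = refl

  ≋⇒≈ᴿ : ∀ {x y} → x ≋ y → x ≈ᴿ y
  ≋⇒≈ᴿ x≋y = x≋y

  ≈ᴿ⇒≋ : ∀ {x y} → x ≈ᴿ y → x ≋ y
  ≈ᴿ⇒≋ x≈y = x≈y

  ⊞-⊠-isCommutativeRing : IsCommutativeRing _≋_ _⊞_ _⊠_ ⊟_ 0ᴿ (fromℚ 1ℚ)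
  ⊞-⊠-isCommutativeRing = record
      { isRing = record
        { +-isAbelianGroup = record
          { isGroup = record
            { isMonoid = record
              { isSemigroup = record
                { isMagma = record
                  { isEquivalence = record
                    { refl  = λ {x} → pointwise {x} {x} λ _ → refl
                    ; sym   = λ {x} {y} → ≈ᴿ-sym {x} {y}
                    ; trans = λ {x} {y} {z} → ≈ᴿ-trans {x} {y} {z}
                    }
                  ; ∙-cong = λ {x} {x′} {y} {y′} → +ᴿ-cong {x} {x′} {y} {y′}
                  }
                ; assoc = λ x y z → pointwise {x +ᴿ y +ᴿ z} {x +ᴿ (y +ᴿ z)}
                    λ n → ℚ.+-assoc (seq x n) (seq y n) (seq z n)
                }
              ; identity = (λ x → pointwise {0ᴿ +ᴿ x} {x} λ n → ℚ.+-identityˡ (seq x n))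
                         , (λ x → pointwise {x +ᴿ 0ᴿ} {x} λ n → ℚ.+-identityʳ (seq x n))
              }
            ; inverse = (λ x → pointwise { -ᴿ x +ᴿ x} {0ᴿ} λ n → ℚ.+-inverseˡ (seq x n))
                      , (λ x → pointwise {x +ᴿ -ᴿ x} {0ᴿ} λ n → ℚ.+-inverseʳ (seq x n))
            ; ⁻¹-cong = λ {x} {y} → -ᴿ-cong {x} {y}
            }
          ; comm = λ x y → pointwise {x +ᴿ y} {y +ᴿ x} λ n → ℚ.+-comm (seq x n) (seq y n)
          }
        ; *-cong = λ {x} {x′} {y} {y′} → *ᴿ-cong {x} {x′} {y} {y′}
        ; *-assoc = λ x y z → pointwise {x *ᴿ y *ᴿ z} {x *ᴿ (y *ᴿ z)}
            λ n → ℚ.*-assoc (seq x n) (seq y n) (seq z n)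
        ; *-identity = (λ x → pointwise {fromℚ 1ℚ *ᴿ x} {x} λ n → ℚ.*-identityˡ (seq x n))
                     , (λ x → pointwise {x *ᴿ fromℚ 1ℚ} {x} λ n → ℚ.*-identityʳ (seq x n))
        ; distrib = (λ x y z → pointwise {x *ᴿ (y +ᴿ z)} {x *ᴿ y +ᴿ x *ᴿ z}
                      λ n → ℚ.*-distribˡ-+ (seq x n) (seq y n) (seq z n))
                  , (λ x y z → pointwise {(y +ᴿ z) *ᴿ x} {y *ᴿ x +ᴿ z *ᴿ x}
                      λ n → ℚ.*-distribʳ-+ (seq x n) (seq y n) (seq z n))
        }
      ; *-comm = λ x y → pointwise {x *ᴿ y} {y *ᴿ x} λ n → ℚ.*-comm (seq x n) (seq y n)
      }

  0<ᴿ-resp-≋ : ∀ {x y} → x ≋ y → 0<ᴿ x → 0<ᴿ y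
  0<ᴿ-resp-≋ {x} {y} = 0<ᴿ-resp {x} {y}

  0<ᴿ-⊞ : ∀ {x y} → 0<ᴿ x → 0<ᴿ y → 0<ᴿ (x ⊞ y)
  0<ᴿ-⊞ {x} {y} = 0<ᴿ-+ {x} {y}

  0<ᴿ-⊠ : ∀ {x y} → 0<ᴿ x → 0<ᴿ y → 0<ᴿ (x ⊠ y)
  0<ᴿ-⊠ {x} {y} = 0<ᴿ-* {x} {y}

  0<ᴿ⇒≋̸0 : ∀ {x} → 0<ᴿ x → ¬ x ≋ 0ᴿ
  0<ᴿ⇒≋̸0 {x} = 0<ᴿ⇒≉0 {x}

  trichotomyᴿ : ∀ x → ¬ ¬ (x ≋ 0ᴿ ⊎ 0<ᴿ x ⊎ 0<ᴿ (⊟ x))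
  trichotomyᴿ x k = k (inj₁ (unsigned⇒≈0 x λ sign → k (inj₂ sign)))

  ≋0-stable : ∀ {x} → ¬ ¬ (x ≋ 0ᴿ) → x ≋ 0ᴿ
  ≋0-stable {x} ¬x≉0 = unsigned⇒≈0 x λ where
    (inj₁ 0<x) → ¬x≉0 (0<ᴿ⇒≉0 {x} 0<x)
    (inj₂ x<0) → ¬x≉0 λ x≈0 → 0<ᴿ⇒≉0 { -ᴿ x} x<0 (-ᴿ-cong {x} {0ᴿ} x≈0)

seq⇒≋ : ∀ {x y} → (∀ n → seq x n ≡ seq y n) → x ≋ y
seq⇒≋ {x} {y} eq = ≈ᴿ⇒≋ (pointwise {x} {y} eq)

⊞≋+ᴿ : ∀ x y → x ⊞ y ≋ x +ᴿ y
⊞≋+ᴿ x y = seq⇒≋ (seq-⊞ x y)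

⊠≋*ᴿ : ∀ x y → x ⊠ y ≋ x *ᴿ y
⊠≋*ᴿ x y = seq⇒≋ (seq-⊠ x y)

⊟≋-ᴿ : ∀ x → ⊟ x ≋ -ᴿ x
⊟≋-ᴿ x = seq⇒≋ (seq-⊟ x)

ℝ-algebra : OrderedℚAlgebra
ℝ-algebra = record
  { commutativeRing = record { isCommutativeRing = ⊞-⊠-isCommutativeRing }
  ; morphism = record
    { ⟦_⟧    = fromℚ
    ; +-homo = λ p q → seq⇒≋ λ n → sym (seq-⊞ (fromℚ p) (fromℚ q) n)
    ; *-homo = λ p q → seq⇒≋ λ n → sym (seq-⊠ (fromℚ p) (fromℚ q) n)
    ; -‿homo = λ p → seq⇒≋ λ n → sym (seq-⊟ (fromℚ p) n)
    ; 0-homo = seq⇒≋ λ _ → refl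
    ; 1-homo = seq⇒≋ λ _ → refl
    }
  ; Pos        = 0<ᴿ_
  ; pos-resp   = 0<ᴿ-resp-≋
  ; pos-+      = 0<ᴿ-⊞
  ; pos-*      = 0<ᴿ-⊠
  ; pos-1      = 1ℚ , ℚ.positive⁻¹ 1ℚ , 0 , λ _ _ → ℚ.≤-refl
  ; pos⇒≉0     = 0<ᴿ⇒≋̸0
  ; trichotomy = trichotomyᴿ
  ; ≈0-stable  = ≋0-stable
  }
ℚ-algebra : OrderedℚAlgebra
ℚ-algebra = record
  { commutativeRing = ℚ.+-*-commutativeRing
  ; morphism   = -raw-almostCommutative⟶ (fromCommutativeRing ℚ.+-*-commutativeRing)
  ; Pos        = 0ℚ ℚ.<_
  ; pos-resp   = λ { refl 0<x → 0<x }
  ; pos-+      = ℚ.+-mono-<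
  ; pos-*      = 0<p*q
  ; pos-1      = ℚ.positive⁻¹ 1ℚ
  ; pos⇒≉0     = λ { 0<x refl → ℚ.<-irrefl refl 0<x }
  ; trichotomy = λ x k → k (sign x)
  ; ≈0-stable  = decidable-stable (_ ℚ.≟ 0ℚ)
  }
  where
  sign : ∀ x → x ≡ 0ℚ ⊎ 0ℚ ℚ.< x ⊎ 0ℚ ℚ.< ℚ.- x
  sign x with ℚ.<-cmp x 0ℚ
  ... | tri< x<0 _ _ = inj₂ (inj₂ (ℚ.neg-antimono-< x<0))
  ... | tri≈ _ x≡0 _ = inj₁ x≡0
  ... | tri> _ _ 0<x = inj₂ (inj₁ 0<x)

module Ringᴿ = OrderedℚAlgebra ℝ-algebra

-- Bisection

-- The absolute value of the numerator already bounds `p`, the denominator being at least one.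
archimedean : ∀ p → ∃[ n ] p ℚ.< toℚ (+ suc n)
archimedean p@(ℚ.mkℚ i d-1 _) = n , ℚ.≤-<-trans p≤n
  (subst₂ ℚ._<_ (ℚ.+-identityˡ _) (sym (toℚ-homo-+ 1ℤ (+ n))) (ℚ.+-monoˡ-< (toℚ (+ n)) (ℚ.positive⁻¹ 1ℚ)))
  where
  n = ℤ.∣ i ∣
  i≤∣i∣ : ∀ i → i ℤ.≤ + ℤ.∣ i ∣
  i≤∣i∣ (+ _)      = ℤ.≤-refl
  i≤∣i∣ ℤ.-[1+ _ ] = ℤ.-≤+
  p≤n : p ℚ.≤ toℚ (+ n)
  p≤n = ℚ.toℚᵘ-cancel-≤ (ℚᵘ.≤-respʳ-≃ (ℚᵘ.≃-sym (toℚᵘ-toℚ (+ n))) (ℚᵘ.*≤*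
    (subst₂ ℤ._≤_ (sym (ℤ.*-identityʳ i)) (ℤ.pos-* n (suc d-1))
      (ℤ.≤-trans (i≤∣i∣ i) (ℤ.+≤+ (ℕ.m≤m*n n (suc d-1)))))))

dist< : ∀ p q {ε} → p ℚ.< q ℚ.+ ε → q ℚ.< p ℚ.+ ε → ℚ.∣ p ℚ.- q ∣ ℚ.< ε
dist< p q {ε} p< q< = ∣p∣< (p ℚ.- q)
  (+-cancelʳ-< q (subst₂ ℚ._<_ (solve 2 (λ p q → p := p :- q :+ q) refl p q) (ℚ.+-comm q ε) p<))
  (+-cancelʳ-< p (subst₂ ℚ._<_ (solve 2 (λ p q → q := :- (p :- q) :+ p) refl p q) (ℚ.+-comm p ε) q<))

-- `P` may change its truth value many times; the brackets single out one point that is approached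
-- both through rationals with `P` and through rationals without it.
module Bisection (P : ℚ → Set) (P? : ∀ q → Dec (P q))
                 (b : ℚ) (0<b : 0ℚ ℚ.< b) (P0 : P 0ℚ) (¬Pb : ¬ P b) where

  record Bracket (w : ℚ) : Set where
    field
      lo    : ℚ
      0≤lo  : 0ℚ ℚ.≤ lo
      P-lo  : P lo
      ¬P-hi : ¬ P (lo ℚ.+ w)
  open Bracket

  width : ℕ → ℚ
  width zero    = b
  width (suc n) = ½ ℚ.* width n

  0<width : ∀ n → 0ℚ ℚ.< width n
  0<width zero    = 0<b
  0<width (suc n) = ½-pos (0<width n)

  halve : ∀ {w} → 0ℚ ℚ.< w → (B : Bracket w) →
    ∃[ B′ ] (lo B ℚ.≤ lo {½ ℚ.* w} B′ × lo B′ ℚ.+ ½ ℚ.* w ℚ.≤ lo B ℚ.+ w)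
  halve {w} 0<w B with P? (lo B ℚ.+ ½ ℚ.* w)
  ... | no ¬P = record { lo = lo B ; 0≤lo = 0≤lo B ; P-lo = P-lo B ; ¬P-hi = ¬P }
              , ℚ.≤-refl , ℚ.+-monoʳ-≤ (lo B) (ℚ.<⇒≤ (½< 0<w))
  ... | yes p = record { lo = lo B ℚ.+ ½ ℚ.* w ; 0≤lo = ℚ.≤-trans (0≤lo B) lo≤
                       ; P-lo = p ; ¬P-hi = λ q → ¬P-hi B (subst P top q) }
              , lo≤ , ℚ.≤-reflexive top
    where
    lo≤ : lo B ℚ.≤ lo B ℚ.+ ½ ℚ.* w
    lo≤ = ℚ.≤-trans (ℚ.≤-reflexive (sym (ℚ.+-identityʳ (lo B)))) (ℚ.+-monoʳ-≤ (lo B) (ℚ.<⇒≤ (½-pos 0<w)))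
    top : lo B ℚ.+ ½ ℚ.* w ℚ.+ ½ ℚ.* w ≡ lo B ℚ.+ w
    top = trans (ℚ.+-assoc (lo B) _ _) (cong (lo B ℚ.+_) (½+½ w))

  bracket : ∀ n → Bracket (width n)
  bracket zero    = record { lo = 0ℚ ; 0≤lo = ℚ.≤-refl ; P-lo = P0
                           ; ¬P-hi = λ p → ¬Pb (subst P (ℚ.+-identityˡ b) p) }
  bracket (suc n) = proj₁ (halve (0<width n) (bracket n))

  loₙ : ℕ → ℚ
  loₙ n = lo (bracket n)

  nested : ∀ k n → loₙ n ℚ.≤ loₙ (k ℕ.+ n) × loₙ (k ℕ.+ n) ℚ.+ width (k ℕ.+ n) ℚ.≤ loₙ n ℚ.+ width n
                   × width (k ℕ.+ n) ℚ.≤ width n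
  nested zero    n = ℚ.≤-refl , ℚ.≤-refl , ℚ.≤-refl
  nested (suc k) n =
    let lo≤ , ≤hi , w≤ = nested k n
        _ , lo≤′ , ≤hi′ = halve (0<width (k ℕ.+ n)) (bracket (k ℕ.+ n))
    in ℚ.≤-trans lo≤ lo≤′ , ℚ.≤-trans ≤hi′ ≤hi , ℚ.≤-trans (ℚ.<⇒≤ (½< (0<width (k ℕ.+ n)))) w≤

  nested′ : ∀ {n m} → n ℕ.≤ m → loₙ n ℚ.≤ loₙ m × loₙ m ℚ.≤ loₙ n ℚ.+ width n × width m ℚ.≤ width n
  nested′ {n} {m} n≤m =
    let lo≤ , ≤hi , w≤ = subst (λ j → loₙ n ℚ.≤ loₙ j × loₙ j ℚ.+ width j ℚ.≤ loₙ n ℚ.+ width n × width j ℚ.≤ width n)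
                           (ℕ.m∸n+n≡m n≤m) (nested (m ℕ.∸ n) n)
    in lo≤ , ℚ.≤-trans (ℚ.≤-trans (ℚ.≤-reflexive (sym (ℚ.+-identityʳ (loₙ m))))
                         (ℚ.+-monoʳ-≤ (loₙ m) (ℚ.<⇒≤ (0<width m)))) ≤hi , w≤

  -- This is `n + 1 ≤ 2ⁿ`; linear decay is enough for `archimedean` to make the widths small.
  width-decay : ∀ n → toℚ (+ suc n) ℚ.* width n ℚ.≤ b
  width-decay zero    = ℚ.≤-reflexive (ℚ.*-identityˡ b)
  width-decay (suc n) = begin
    toℚ (+ suc (suc n)) ℚ.* (½ ℚ.* w)  ≡⟨ cong (ℚ._* (½ ℚ.* w)) (toℚ-homo-+ 1ℤ (+ suc n)) ⟩
    (1ℚ ℚ.+ q) ℚ.* (½ ℚ.* w)           ≤⟨ ℚ.*-monoʳ-≤-nonNeg (½ ℚ.* w) {{ℚ.nonNegative (ℚ.<⇒≤ (0<width (suc n)))}}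
                                            (ℚ.+-monoˡ-≤ q (toℚ-mono-≤ {1ℤ} {+ suc n} (ℤ.+≤+ (ℕ.s≤s ℕ.z≤n)))) ⟩
    (q ℚ.+ q) ℚ.* (½ ℚ.* w)            ≡⟨ solve 2 (λ q v → (q :+ q) :* v := q :* (v :+ v)) refl q (½ ℚ.* w) ⟩
    q ℚ.* (½ ℚ.* w ℚ.+ ½ ℚ.* w)        ≡⟨ cong (q ℚ.*_) (½+½ w) ⟩
    q ℚ.* w                            ≤⟨ width-decay n ⟩
    b                                  ∎
    where
    open ℚ.≤-Reasoning
    w = width n
    q = toℚ (+ suc n)

  width-small : ∀ ε → 0ℚ ℚ.< ε → ∃[ N ] width N ℚ.< ε
  width-small ε 0<ε =
    let δ , 0<δ , δε≡b = divide-pos b ε 0<b 0<ε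
        N , δ<N = archimedean δ
    in N , ℚ.≰⇒> λ ε≤w → ℚ.<-irrefl refl (begin-strict
         b                              ≡⟨ δε≡b ⟨
         δ ℚ.* ε                        <⟨ ℚ.*-monoˡ-<-pos ε {{ℚ.positive 0<ε}} δ<N ⟩
         toℚ (+ suc N) ℚ.* ε            ≤⟨ ℚ.*-monoˡ-≤-nonNeg (toℚ (+ suc N))
                                             {{ℚ.nonNegative (ℚ.≤-trans (ℚ.<⇒≤ 0<δ) (ℚ.<⇒≤ δ<N))}} ε≤w ⟩
         toℚ (+ suc N) ℚ.* width N      ≤⟨ width-decay N ⟩
         b                              ∎)
    where open ℚ.≤-Reasoning

  limit : ℝ
  limit = mkℝ loₙ λ ε 0<ε →
    let N , w<ε = width-small ε 0<ε
        close : ∀ m n → N ℕ.≤ m → N ℕ.≤ n → loₙ m ℚ.< loₙ n ℚ.+ ε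
        close m n N≤m N≤n = ℚ.≤-<-trans (proj₁ (proj₂ (nested′ N≤m)))
          (ℚ.+-mono-≤-< (proj₁ (nested′ N≤n)) w<ε)
    in N , λ m n N≤m N≤n → dist< (loₙ m) (loₙ n) (close m n N≤m N≤n) (close n m N≤n N≤m)

  gap : ℝ
  gap = mkℝ width λ ε 0<ε →
    let N , w<ε = width-small ε 0<ε
        close : ∀ m n → N ℕ.≤ m → width m ℚ.< width n ℚ.+ ε
        close m n N≤m = subst (ℚ._< width n ℚ.+ ε) (ℚ.+-identityˡ (width m))
          (ℚ.+-mono-< (0<width n) (ℚ.≤-<-trans (proj₂ (proj₂ (nested′ N≤m))) w<ε))
    in N , λ m n N≤m N≤n → dist< (width m) (width n) (close m n N≤m) (close n m N≤n)

  gap≈0 : gap ≈ᴿ 0ᴿ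
  gap≈0 ε 0<ε =
    let N , w<ε = width-small ε 0<ε
    in N , λ n N≤n → dist< (width n) 0ℚ
         (subst (width n ℚ.<_) (sym (ℚ.+-identityˡ ε)) (ℚ.≤-<-trans (proj₂ (proj₂ (nested′ N≤n))) w<ε))
         (ℚ.+-mono-< (0<width n) 0<ε)

  -- The right endpoints: the same real number as `limit`, but represented by terms at which `P`
  -- fails.
  upper : ℝ
  upper = limit ⊞ gap

  upper≋limit : upper ≋ limit
  upper≋limit = Ringᴿ.trans (Ringᴿ.+-congˡ (≈ᴿ⇒≋ gap≈0)) (Ringᴿ.+-identityʳ limit)

  P-limit : ∀ n → P (seq limit n)
  P-limit n = P-lo (bracket n)

  ¬P-upper : ∀ n → ¬ P (seq upper n)
  ¬P-upper n p = ¬P-hi (bracket n) (subst P (seq-⊞ limit gap n) p)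

  0≤limit : ∀ n → 0ℚ ℚ.≤ seq limit n
  0≤limit n = 0≤lo (bracket n)

-- Rational approximation of real quadratic forms

module Formsᴿ = Forms ℝ-algebra
module Formsℚ = Forms ℚ-algebra
module Orderᴿ = Order ℝ-algebra
module Orderℚ = Order ℚ-algebra

seq-sum : ∀ {k} (f : Fin k → ℝ) n → seq (Orderᴿ.sum f) n ≡ Orderℚ.sum (λ i → seq (f i) n)
seq-sum {zero}  f n = refl
seq-sum {suc k} f n = trans (seq-⊞ (f zero) (Orderᴿ.sum λ i → f (suc i)) n)
  (cong (seq (f zero) n ℚ.+_) (seq-sum (λ i → f (suc i)) n))

seq-*ᵛ : ∀ {k} (A : Matrix (Fin k)) v i n →
         seq ((A *ᵛ v) i) n ≡ Orderℚ.sum (λ j → toℚ (A i j) ℚ.* seq (v j) n)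
seq-*ᵛ A v i n = seq-foldr (λ j → fromℤ (A i j) *ᴿ v j)
  where
  seq-foldr : ∀ {k} (f : Fin k → ℝ) → seq (Vector.foldr _+ᴿ_ 0ᴿ f) n ≡ Orderℚ.sum (λ j → seq (f j) n)
  seq-foldr {zero}  f = refl
  seq-foldr {suc k} f = cong (seq (f zero) n ℚ.+_) (seq-foldr (λ j → f (suc j)))

approximant : ∀ {k} → Formsᴿ.Mat k → ℕ → Formsℚ.Mat k
approximant C n i j = seq (C i j) n

seq-⟪⟫ : ∀ {k} (x y : Formsᴿ.Vec k) n →
         seq Formsᴿ.⟪ x , y ⟫ n ≡ Formsℚ.⟪ (λ i → seq (x i) n) , (λ i → seq (y i) n) ⟫
seq-⟪⟫ x y n = trans (seq-sum (λ i → x i ⊠ y i) n) (Orderℚ.sum-cong-≗ λ i → seq-⊠ (x i) (y i) n)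

seq-form : ∀ {k} (C : Formsᴿ.Mat k) x n →
           seq (Formsᴿ.form C x) n ≡ Formsℚ.form (approximant C n) (λ i → seq (x i) n)
seq-form C x n = trans (seq-⟪⟫ x (C Formsᴿ.· x) n)
  (Orderℚ.sum-cong-≗ λ i → cong (seq (x i) n ℚ.*_) (seq-⟪⟫ (C i) x n))

-- A negative value of the real form has a rational margin on its tail, hence is already negative at
-- one approximant.
psd-limit : ∀ {k} (C : Formsᴿ.Mat k) → (∀ n → Formsℚ.PSD (approximant C n)) → Formsᴿ.PSD C
psd-limit C psd x (ε , 0<ε , N , ε≤) = psd N (λ i → seq (x i) N) (ℚ.<-≤-trans 0<ε
  (subst (ε ℚ.≤_) (trans (seq-⊟ (Formsᴿ.form C x) N) (cong ℚ.-_ (seq-form C x N))) (ε≤ N ℕ.≤-refl)))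

seq-schur : ∀ {k} (C : Formsᴿ.Mat (suc k)) n i j →
            approximant (Formsᴿ.schur C) n i j ≡ Formsℚ.schur (approximant C n) i j
seq-schur C n i j = trans (seq-⊞ (p ⊠ q) (⊟ (r ⊠ s)) n)
  (cong₂ ℚ._+_ (seq-⊠ p q n) (trans (seq-⊟ (r ⊠ s) n) (cong ℚ.-_ (seq-⊠ r s n))))
  where
  p = C zero zero
  q = C (suc i) (suc j)
  r = C zero (suc i)
  s = C zero (suc j)

-- Each pivot is bounded below on a tail, and by `seq-schur` elimination commutes with taking
-- approximants; finitely many tails intersect in a tail.
pd-eventually : ∀ {k} (C : Formsᴿ.Mat k) → Formsᴿ.PD C →
                ∃[ N ] (∀ n → N ℕ.≤ n → Formsℚ.PD (approximant C n))
pd-eventually {zero}  C _ = 0 , λ _ _ → tt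
pd-eventually {suc k} C ((ε , 0<ε , M , ε≤) , pd) =
  let N , pdₙ = pd-eventually (Formsᴿ.schur C) pd
  in M ℕ.⊔ N , λ n le → ℚ.<-≤-trans 0<ε (ε≤ n (ℕ.m⊔n≤o⇒m≤o M N le)) ,
       Formsℚ.pd-resp (seq-schur C n) (pdₙ n (ℕ.m⊔n≤o⇒n≤o M N le))

pd? : ∀ {k} (C : Formsℚ.Mat k) → Dec (Formsℚ.PD C)
pd? {zero}  C = yes tt
pd? {suc k} C = (0ℚ ℚ.<? C zero zero) ×-dec pd? (Formsℚ.schur C)

-- Positive real pivots would give late approximants positive pivots, so the alternative of
-- `psd⇒pd∨kernel` leaves only the kernel.
critical : ∀ {k} (C : Formsᴿ.Mat k) → Formsᴿ.Symmetric C → Formsᴿ.PSD C →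
           (∀ n → ¬ Formsℚ.PD (approximant C n)) → ¬ ¬ Formsᴿ.Kernel C
critical C C-sym psd ¬pd ¬ker = Formsᴿ.psd⇒pd∨kernel C C-sym psd λ where
  (inj₁ pd)  → let N , pdₙ = pd-eventually C pd in ¬pd N (pdₙ N ℕ.≤-refl)
  (inj₂ ker) → ¬ker ker

fromℚ-injective : ∀ {p q} → fromℚ p ≈ᴿ fromℚ q → p ≡ q
fromℚ-injective {p} {q} p≈q = compare (ℚ.<-cmp p q)
  where
  p+[q-p] : ∀ p q → p ℚ.+ (q ℚ.- p) ≡ q
  p+[q-p] = solve 2 (λ p q → p :+ (q :- p) := q) refl
  gap-absurd : ∀ {p q} → p ℚ.< q → ¬ fromℚ q ≈ᴿ fromℚ p
  gap-absurd {p} {q} p<q q≈p =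
    let N , close = q≈p (q ℚ.- p) (subst (ℚ._< q ℚ.- p) (ℚ.+-inverseʳ p) (ℚ.+-monoˡ-< (ℚ.- p) p<q))
    in ℚ.<-irrefl refl (subst (q ℚ.<_) (p+[q-p] p q) (dist<⇒< q p (close N ℕ.≤-refl)))
  compare : Tri (p ℚ.< q) (p ≡ q) (q ℚ.< p) → p ≡ q
  compare (tri< p<q _ _) = ⊥-elim (gap-absurd p<q (≈ᴿ-sym {fromℚ p} {fromℚ q} p≈q))
  compare (tri≈ _ p≡q _) = p≡q
  compare (tri> _ _ q<p) = ⊥-elim (gap-absurd q<p p≈q)

nonNeg⇒0≤ : ∀ {x} → Orderℚ.NonNeg x → 0ℚ ℚ.≤ x
nonNeg⇒0≤ 0≤x = ℚ.≮⇒≥ λ x<0 → 0≤x (ℚ.neg-antimono-< x<0)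

-- The critical parameters, and `A² = θ² I`

-- The index `i₀` rules out the empty matrix, whose pivots are vacuously positive for every `t`.
module Spectrum {n : ℕ} (i₀ : Fin n) (A : Matrix (Fin n)) (A-sym : ∀ i j → A i j ≡ A j i) {θ : ℝ}
                (±θ : HasExactlyTwoEigenvalues± A θ) where
  open OrderedℚAlgebra ℝ-algebra using (-‿cong; *-cong)
    renaming (refl to ≈-refl; sym to ≈-sym; trans to ≈-trans)
  private
    module Pᴿ = Pencils ℝ-algebra A A-sym
    module Pℚ = Pencils ℚ-algebra A A-sym

    *ᵛ-· : ∀ v i → (A *ᵛ v) i ≋ (Pᴿ.Aᴿ Formsᴿ.· v) i
    *ᵛ-· v i = seq⇒≋ λ n → trans (seq-*ᵛ A v i n) (sym (seq-⟪⟫ (Pᴿ.Aᴿ i) v n))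

    eigenvalues : ∀ t v → ¬ (∀ i → v i ≋ 0ᴿ) → (∀ i → (Pᴿ.Aᴿ Formsᴿ.· v) i ≋ t ⊠ v i) →
                  t ≋ θ ⊎ t ≋ ⊟ θ
    eigenvalues t v v≉0 eq = Sum.map ≈ᴿ⇒≋ (λ t≈-θ → ≈-trans (≈ᴿ⇒≋ t≈-θ) (≈-sym (⊟≋-ᴿ θ)))
      (Equivalence.to (proj₂ ±θ t)
        ( v
        , (λ v≈0 → v≉0 λ i → ≈ᴿ⇒≋ (v≈0 i))
        , λ i → ≋⇒≈ᴿ (≈-trans (*ᵛ-· v i) (≈-trans (eq i) (⊠≋*ᴿ t (v i))))))

    θ≋̸-θ : ¬ θ ≋ ⊟ θ
    θ≋̸-θ θ≋-θ = proj₁ ±θ (≋⇒≈ᴿ (≈-trans θ≋-θ (⊟≋-ᴿ θ)))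

    topℚ bottomℚ : ℚ → Formsℚ.Mat n
    topℚ q    = Pℚ.pencil (q ℚ.* q) (ℚ.- 1ℚ)
    bottomℚ q = Pℚ.pencil (ℚ.- (q ℚ.* q)) 1ℚ

    topᴿ bottomᴿ : ℝ → Formsᴿ.Mat n
    topᴿ t    = Pᴿ.pencil (t ⊠ t) (⊟ fromℚ 1ℚ)
    bottomᴿ t = Pᴿ.pencil (⊟ (t ⊠ t)) (fromℚ 1ℚ)

    seq-pencil : ∀ α β k i j →
                 approximant (Pᴿ.pencil α β) k i j ≡ Pℚ.pencil (seq α k) (seq β k) i j
    seq-pencil α β k i j = trans (seq-⊞ (α ⊠ e) (β ⊠ s) k) (cong₂ ℚ._+_ (seq-⊠ α e k) (seq-⊠ β s k))
      where
      e = fromℤ (identity i j)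
      s = fromℤ ((A ⊙ A) i j)

    seq-top : ∀ t k i j → approximant (topᴿ t) k i j ≡ topℚ (seq t k) i j
    seq-top t k i j = trans (seq-pencil (t ⊠ t) (⊟ fromℚ 1ℚ) k i j)
      (Pℚ.pencil-cong {seq (t ⊠ t) k} {seq t k ℚ.* seq t k} {seq (⊟ fromℚ 1ℚ) k} {ℚ.- 1ℚ}
        (seq-⊠ t t k) (seq-⊟ (fromℚ 1ℚ) k) i j)

    seq-bottom : ∀ t k i j → approximant (bottomᴿ t) k i j ≡ bottomℚ (seq t k) i j
    seq-bottom t k i j = trans (seq-pencil (⊟ (t ⊠ t)) (fromℚ 1ℚ) k i j)
      (Pℚ.pencil-cong {seq (⊟ (t ⊠ t)) k} {ℚ.- (seq t k ℚ.* seq t k)} {1ℚ} {1ℚ}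
        (trans (seq-⊟ (t ⊠ t) k) (cong ℚ.-_ (seq-⊠ t t k))) refl i j)

    top-sym : ∀ t → Formsᴿ.Symmetric (topᴿ t)
    top-sym t = Pᴿ.pencil-sym (t ⊠ t) (⊟ fromℚ 1ℚ)

    bottom-sym : ∀ t → Formsᴿ.Symmetric (bottomᴿ t)
    bottom-sym t = Pᴿ.pencil-sym (⊟ (t ⊠ t)) (fromℚ 1ℚ)

    top-resp : ∀ {s t} → s ⊠ s ≋ t ⊠ t → Formsᴿ.PSD (topᴿ s) → Formsᴿ.PSD (topᴿ t)
    top-resp ss≈tt = Formsᴿ.psd-resp (Pᴿ.pencil-cong ss≈tt ≈-refl)

    bottom-resp : ∀ {s t} → s ⊠ s ≋ t ⊠ t → Formsᴿ.PSD (bottomᴿ s) → Formsᴿ.PSD (bottomᴿ t)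
    bottom-resp ss≈tt = Formsᴿ.psd-resp (Pᴿ.pencil-cong (-‿cong ss≈tt) ≈-refl)

    critical-top : ∀ t → Formsᴿ.PSD (topᴿ t) → (∀ k → ¬ Formsℚ.PD (topℚ (seq t k))) → t ⊠ t ≋ θ ⊠ θ
    critical-top t psd ¬pd = Orderᴿ.≈-stable λ tt≉θθ →
      critical (topᴿ t) (top-sym t) psd (λ k pd → ¬pd k (Formsℚ.pd-resp (seq-top t k) pd))
        λ ker → tt≉θθ (Pᴿ.top-kernel eigenvalues t ker)

    critical-bottom : ∀ t → Formsᴿ.PSD (bottomᴿ t) → (∀ k → ¬ Formsℚ.PD (bottomℚ (seq t k))) →
                      t ⊠ t ≋ θ ⊠ θ
    critical-bottom t psd ¬pd = Orderᴿ.≈-stable λ tt≉θθ →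
      critical (bottomᴿ t) (bottom-sym t) psd (λ k pd → ¬pd k (Formsℚ.pd-resp (seq-bottom t k) pd))
        λ ker → tt≉θθ (Pᴿ.bottom-kernel eigenvalues t ker)

    top-limit : ∀ t → (∀ k → Formsℚ.PD (topℚ (seq t k))) → Formsᴿ.PSD (topᴿ t)
    top-limit t pd = psd-limit (topᴿ t) λ k → Formsℚ.psd-resp (λ i j → sym (seq-top t k i j))
      (Formsℚ.pd⇒psd (topℚ (seq t k)) (Pℚ.pencil-sym (seq t k ℚ.* seq t k) (ℚ.- 1ℚ)) (pd k))

    bottom-limit : ∀ t → (∀ k → Formsℚ.PD (bottomℚ (seq t k))) → Formsᴿ.PSD (bottomᴿ t)
    bottom-limit t pd = psd-limit (bottomᴿ t) λ k → Formsℚ.psd-resp (λ i j → sym (seq-bottom t k i j))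
      (Formsℚ.pd⇒psd (bottomℚ (seq t k)) (Pℚ.pencil-sym (ℚ.- (seq t k ℚ.* seq t k)) 1ℚ) (pd k))

    h : ℚ
    h = Pℚ.norm ℚ.+ 1ℚ

    0<h : 0ℚ ℚ.< h
    0<h = ℚ.+-mono-≤-< {0ℚ} {Pℚ.norm} {0ℚ} {1ℚ} (nonNeg⇒0≤ {Pℚ.norm} Pℚ.0≤norm) (ℚ.positive⁻¹ 1ℚ)

    bottom≡-top : ∀ q i → bottomℚ q i i ≡ ℚ.- topℚ q i i
    bottom≡-top q i = Pℚ.pencil-neg (q ℚ.* q) (ℚ.- 1ℚ) i i

    -- `Bisection` starts from a predicate true at `0` and false at `h`. Definiteness of `t² I - A²`
    -- fails at `0` and holds at `h`, that of `A² - t² I` the other way round, hence the negation in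
    -- only one of them.
    Top Bottom : ℚ → Set
    Top q    = ¬ Formsℚ.PD (topℚ q)
    Bottom q = Formsℚ.PD (bottomℚ q)

    -- `topℚ 0ℚ` is `- A²`, and a diagonal entry of `A²` is a value of a semidefinite form, so it
    -- cannot be negative.
    Top-0 : Top 0ℚ
    Top-0 pd =
      let i , 0<c = Formsℚ.pd⇒pos-diagonal (topℚ 0ℚ) i₀ pd
      in Formsℚ.psd-diagonal (bottomℚ 0ℚ)
        (Pℚ.pencil-psd {ℚ.- (0ℚ ℚ.* 0ℚ)} {1ℚ} (Orderℚ.≈0⇒nonNeg {0ℚ} refl) (Orderℚ.nonNeg-square 1ℚ)) i
        (subst (0ℚ ℚ.<_) (sym (trans (cong ℚ.-_ (bottom≡-top 0ℚ i)) (Orderℚ.-‿involutive (topℚ 0ℚ i i)))) 0<c)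

    -- `h² I - A²` is semidefinite, so the diagonal of its negative has no positive entry.
    ¬Bottom-h : ¬ Bottom h
    ¬Bottom-h pd =
      let i , 0<c = Formsℚ.pd⇒pos-diagonal (bottomℚ h) i₀ pd
      in Formsℚ.psd-diagonal (topℚ h) Pℚ.top-psd i (subst (0ℚ ℚ.<_) (bottom≡-top h i) 0<c)

    -- Otherwise A² would be singular, making 0 an eigenvalue of A.
    Bottom-0 : Bottom 0ℚ
    Bottom-0 = decidable-stable (pd? (bottomℚ 0ℚ)) λ ¬pd → θ≋̸-θ (θ≋-θ (critical-bottom 0ᴿ
      (Pᴿ.pencil-psd (Orderᴿ.≈0⇒nonNeg (≈-trans (-‿cong (Ringᴿ.zeroˡ 0ᴿ)) Orderᴿ.-0#≈0#))
                     (Orderᴿ.pos-asym Ringᴿ.pos-1))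
      (λ _ → ¬pd)))
      where
      θ≋-θ : 0ᴿ ⊠ 0ᴿ ≋ θ ⊠ θ → θ ≋ ⊟ θ
      θ≋-θ 00≋θθ = ≈-trans θ≋0 (≈-sym (≈-trans (-‿cong θ≋0) Orderᴿ.-0#≈0#))
        where
        θ≋0 : θ ≋ 0ᴿ
        θ≋0 = Orderᴿ.square≈0⇒≈0 (Orderᴿ.≈0⇒nonNeg (≈-trans
          (-‿cong (≈-trans (≈-sym 00≋θθ) (Ringᴿ.zeroˡ 0ᴿ))) Orderᴿ.-0#≈0#))

    module T = Bisection Top (λ q → ¬? (pd? (topℚ q))) h 0<h Top-0
      (λ ¬pd → ¬pd (decidable-stable (pd? (topℚ h)) Pℚ.top-pd))

    module B = Bisection Bottom (λ q → pd? (bottomℚ q)) h 0<h Bottom-0 ¬Bottom-h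

    -- Definiteness along the right endpoints gives semidefiniteness in the limit; its failure along
    -- the left endpoints makes the limit critical, so that its square is `θ²`. In `bottom-psd` the
    -- two endpoint sequences exchange roles.
    top-psd : Formsᴿ.PSD (topᴿ θ)
    top-psd = top-resp (critical-top T.limit limit-psd T.P-limit) limit-psd
      where
      limit-psd : Formsᴿ.PSD (topᴿ T.limit)
      limit-psd = top-resp (*-cong T.upper≋limit T.upper≋limit)
        (top-limit T.upper λ k → decidable-stable (pd? (topℚ (seq T.upper k))) (T.¬P-upper k))

    bottom-psd : Formsᴿ.PSD (bottomᴿ θ)
    bottom-psd = bottom-resp (critical-bottom B.upper upper-psd B.¬P-upper) upper-psd
      where
      upper-psd : Formsᴿ.PSD (bottomᴿ B.upper)
      upper-psd = bottom-resp (≈-sym (*-cong B.upper≋limit B.upper≋limit)) (bottom-limit B.limit B.P-limit)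

  square≋θ²I : ∀ i j → fromℤ ((A ⊙ A) i j) ≋ (θ ⊠ θ) ⊠ fromℤ (identity i j)
  square≋θ²I = Pᴿ.squeeze (θ ⊠ θ) top-psd bottom-psd

-- Integrality of `θ²`

square-nonNeg : ∀ i → 0ℤ ℤ.≤ i ℤ.* i
square-nonNeg (+ n)      = subst (0ℤ ℤ.≤_) (ℤ.pos-* n n) (ℤ.+≤+ ℕ.z≤n)
square-nonNeg ℤ.-[1+ n ] = ℤ.+≤+ ℕ.z≤n

sum-nonNeg : ∀ {k} (f : Fin k → ℤ) → (∀ i → 0ℤ ℤ.≤ f i) → 0ℤ ℤ.≤ ℤ-Sum.sum f
sum-nonNeg {zero}  f 0≤f = ℤ.≤-refl
sum-nonNeg {suc k} f 0≤f = ℤ.+-mono-≤ (0≤f zero) (sum-nonNeg (λ i → f (suc i)) (λ i → 0≤f (suc i)))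

adjacency-square : ∀ {n} (Γ : SignedGraph (Fin n)) θ → HasExactlyTwoEigenvalues± (adjacencyMatrix Γ) θ →
  ∃[ d ] ((∀ i j → (adjacencyMatrix Γ ⊙ adjacencyMatrix Γ) i j ≡ + d ℤ.* identity i j) ×
          fromℕ d ≋ θ ⊠ θ)
-- Without vertices there is no nonzero vector, yet `θ` has to be an eigenvalue.
adjacency-square {zero}  Γ θ ±θ =
  let v , v≉0 , _ = Equivalence.from (proj₂ ±θ θ) (inj₁ (pointwise {θ} {θ} λ _ → refl))
  in ⊥-elim (v≉0 λ ())
adjacency-square {suc n} Γ θ ±θ = d , A²≡d , d≋θ²
  where
  open OrderedℚAlgebra ℝ-algebra using (*-congʳ; *-identityʳ)
    renaming (sym to ≈-sym; trans to ≈-trans)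
  A = adjacencyMatrix Γ
  A-sym = IsSignedAdjacency.symmetric (adjacencyMatrix-isSignedAdjacency Γ)
  module P = Pencils ℝ-algebra A A-sym
  A²≋θ² : ∀ i j → fromℤ ((A ⊙ A) i j) ≋ (θ ⊠ θ) ⊠ fromℤ (identity i j)
  A²≋θ² = Spectrum.square≋θ²I zero A A-sym ±θ
  -- Every diagonal entry of `A²` equals `θ²`. Being also a sum of integer squares, it is a natural
  -- number and loses nothing under the absolute value.
  d : ℕ
  d = ℤ.∣ (A ⊙ A) zero zero ∣
  +d≡ : + d ≡ (A ⊙ A) zero zero
  +d≡ = ℤ.0≤i⇒+∣i∣≡i (sum-nonNeg (λ k → A zero k ℤ.* A k zero) λ k →
    subst (λ a → 0ℤ ℤ.≤ A zero k ℤ.* a) (A-sym zero k) (square-nonNeg (A zero k)))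
  d≋θ² : fromℕ d ≋ θ ⊠ θ
  d≋θ² = subst (λ z → fromℤ z ≋ θ ⊠ θ) (sym +d≡) (≈-trans (A²≋θ² zero zero) (*-identityʳ (θ ⊠ θ)))
  A²≡d : ∀ i j → (A ⊙ A) i j ≡ + d ℤ.* identity i j
  A²≡d i j = toℚ-injective (fromℚ-injective (≋⇒≈ᴿ (≈-trans (A²≋θ² i j)
    (≈-trans (*-congʳ (≈-sym d≋θ²)) (≈-sym (P.embed-* (+ d) (identity i j)))))))

-- Square roots of natural numbers

square-cancel-≤ : ∀ {p q} → 0ℚ ℚ.≤ q → p ℚ.* p ℚ.≤ q ℚ.* q → p ℚ.≤ q
square-cancel-≤ {p} {q} 0≤q pp≤qq = ℚ.≮⇒≥ λ q<p → ℚ.<-irrefl refl (begin-strict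
  q ℚ.* q  ≤⟨ ℚ.*-monoˡ-≤-nonNeg q {{ℚ.nonNegative 0≤q}} (ℚ.<⇒≤ q<p) ⟩
  q ℚ.* p  <⟨ ℚ.*-monoˡ-<-pos p {{ℚ.positive (ℚ.≤-<-trans 0≤q q<p)}} q<p ⟩
  p ℚ.* p  ≤⟨ pp≤qq ⟩
  q ℚ.* q  ∎)
  where open ℚ.≤-Reasoning

0≤seq⇒nonNeg : ∀ x → (∀ n → 0ℚ ℚ.≤ seq x n) → Orderᴿ.NonNeg x
0≤seq⇒nonNeg x 0≤x (ε , 0<ε , N , ε≤) = ℚ.<-irrefl refl (ℚ.<-≤-trans 0<ε
  (ℚ.≤-trans (ℚ.≤-trans (ε≤ N ℕ.≤-refl) (ℚ.≤-reflexive (seq-⊟ x N))) (ℚ.neg-antimono-≤ (0≤x N))))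

p≤q⇒0≤q-p : ∀ {p q} → p ℚ.≤ q → 0ℚ ℚ.≤ q ℚ.+ ℚ.- p
p≤q⇒0≤q-p {p} {q} p≤q = ℚ.≤-trans (ℚ.≤-reflexive (sym (ℚ.+-inverseʳ p))) (ℚ.+-monoˡ-≤ (ℚ.- p) p≤q)

-- The lower bisection sequence for `p² ≤ d` serves as the root. Each of its terms has square at
-- most `d ≤ D²`, so the bound by `D` holds term by term.
squareRoot : ∀ d D → d ℕ.≤ D ℕ.* D → ∃[ r ] (0ᴿ ≤ᴿ r × r ⊠ r ≋ fromℕ d × r ≤ᴿ fromℕ D)
squareRoot d D d≤D² = S.limit , 0≤r , r²≋d , r≤D
  where
  open OrderedℚAlgebra ℝ-algebra using (+-congʳ; *-cong)
    renaming (sym to ≈-sym)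
  q = toℚ (+ d)
  -- As `d + 1 ≥ 1`, its square is at least `d + 1` and so exceeds `d`; the choice `d` itself would
  -- fail for `d = 0` and `d = 1`.
  b = toℚ (+ suc d)
  0≤q : 0ℚ ℚ.≤ q
  0≤q = toℚ-mono-≤ {0ℤ} {+ d} (ℤ.+≤+ ℕ.z≤n)
  1≤b : 1ℚ ℚ.≤ b
  1≤b = toℚ-mono-≤ {1ℤ} {+ suc d} (ℤ.+≤+ (ℕ.s≤s ℕ.z≤n))
  0<b : 0ℚ ℚ.< b
  0<b = ℚ.<-≤-trans (ℚ.positive⁻¹ 1ℚ) 1≤b
  q<b : q ℚ.< b
  q<b = subst₂ ℚ._<_ (ℚ.+-identityˡ q) (sym (toℚ-homo-+ 1ℤ (+ d))) (ℚ.+-monoˡ-< q (ℚ.positive⁻¹ 1ℚ))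
  b≤b² : b ℚ.≤ b ℚ.* b
  b≤b² = subst (ℚ._≤ b ℚ.* b) (ℚ.*-identityʳ b) (ℚ.*-monoˡ-≤-nonNeg b {{ℚ.nonNegative (ℚ.<⇒≤ 0<b)}} 1≤b)
  module S = Bisection (λ p → p ℚ.* p ℚ.≤ q) (λ p → p ℚ.* p ℚ.≤? q) b 0<b
    (subst (ℚ._≤ q) (sym (ℚ.*-zeroˡ 0ℚ)) 0≤q)
    (λ b²≤q → ℚ.<-irrefl refl (ℚ.<-≤-trans q<b (ℚ.≤-trans b≤b² b²≤q)))
  r = S.limit
  below : Orderᴿ.NonNeg (fromℕ d ⊞ ⊟ (r ⊠ r))
  below = 0≤seq⇒nonNeg _ λ n → subst (0ℚ ℚ.≤_)
    (sym (trans (seq-⊞ (fromℕ d) (⊟ (r ⊠ r)) n)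
      (cong (q ℚ.+_) (trans (seq-⊟ (r ⊠ r) n) (cong ℚ.-_ (seq-⊠ r r n))))))
    (p≤q⇒0≤q-p (S.P-limit n))
  above : Orderᴿ.NonNeg (S.upper ⊠ S.upper ⊞ ⊟ fromℕ d)
  above = 0≤seq⇒nonNeg _ λ n → subst (0ℚ ℚ.≤_)
    (sym (trans (seq-⊞ (S.upper ⊠ S.upper) (⊟ fromℕ d) n)
      (cong₂ ℚ._+_ (seq-⊠ S.upper S.upper n) (seq-⊟ (fromℕ d) n))))
    (p≤q⇒0≤q-p (ℚ.<⇒≤ (ℚ.≰⇒> (S.¬P-upper n))))
  -- The left endpoints show that the square is at most `d`, the right endpoints, representing the
  -- same real, that it is at least `d`.
  r²≋d : r ⊠ r ≋ fromℕ d
  r²≋d = ≈-sym (Orderᴿ.-≈0⇒≈ (Orderᴿ.nonNeg-antisym below (Orderᴿ.nonNeg-resp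
    (Ringᴿ.trans (+-congʳ (*-cong S.upper≋limit S.upper≋limit))
      (Orderᴿ.solve 2 (λ a b → a Orderᴿ.:+ Orderᴿ.:- b Orderᴿ.:= Orderᴿ.:- (b Orderᴿ.:+ Orderᴿ.:- a))
        Ringᴿ.refl (r ⊠ r) (fromℕ d)))
    above)))
  0≤r : 0ᴿ ≤ᴿ r
  0≤r ε 0<ε = 0 , λ n _ → subst (ℚ._< seq r n ℚ.+ ε) (ℚ.+-identityˡ 0ℚ) (ℚ.+-mono-≤-< (S.0≤limit n) 0<ε)
  r≤D : r ≤ᴿ fromℕ D
  r≤D ε 0<ε = 0 , λ n _ → subst (ℚ._< toℚ (+ D) ℚ.+ ε) (ℚ.+-identityʳ (seq r n)) (ℚ.+-mono-≤-<
    (square-cancel-≤ {seq r n} {toℚ (+ D)} (toℚ-mono-≤ {0ℤ} {+ D} (ℤ.+≤+ ℕ.z≤n)) (ℚ.≤-trans (S.P-limit n)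
      (subst (q ℚ.≤_) (trans (cong toℚ (ℤ.pos-* D D)) (toℚ-homo-* (+ D) (+ D)))
        (toℚ-mono-≤ {+ d} {+ (D ℕ.* D)} (ℤ.+≤+ d≤D²)))))
    0<ε)

root-bound : ∀ d D {x} → d ℕ.≤ D ℕ.* D → fromℕ d ≋ x → ∃[ r ] (IsSquareRoot r x × r ≤ᴿ fromℕ D)
root-bound d D d≤D² d≋x =
  let r , 0≤r , r²≋d , r≤D = squareRoot d D d≤D²
  in r , (0≤r , ≋⇒≈ᴿ (Ringᴿ.trans (Ringᴿ.sym (⊠≋*ᴿ r r)) (Ringᴿ.trans r²≋d d≋x))) , r≤D

-- The two degree bounds

fromℕ-+ : ∀ a b → fromℕ (a ℕ.+ b) ≋ fromℕ a ⊞ fromℕ b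
fromℕ-+ a b = seq⇒≋ λ n → trans (trans (cong toℚ (ℤ.pos-+ a b)) (toℚ-homo-+ (+ a) (+ b)))
  (sym (seq-⊞ (fromℕ a) (fromℕ b) n))

fromℕ-* : ∀ a b → fromℕ (a ℕ.* b) ≋ fromℕ a ⊠ fromℕ b
fromℕ-* a b = seq⇒≋ λ n → trans (trans (cong toℚ (ℤ.pos-* a b)) (toℚ-homo-* (+ a) (+ b)))
  (sym (seq-⊠ (fromℕ a) (fromℕ b) n))

open import Data.Nat.Base using (_+_; _*_)

theorem1p2 : ∀ {n m : ℕ}
    (Γ₁ : SignedGraph (Fin n)) (B : Bipartition Γ₁) (Γ₂ : SignedGraph (Fin m))
    (θ₁ θ₂ : ℝ) →
    HasExactlyTwoEigenvalues± (adjacencyMatrix Γ₁) θ₁ →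
    HasExactlyTwoEigenvalues± (adjacencyMatrix Γ₂) θ₂ →
    (k : ℕ) → 2 * k ≡ m * n + 2 →
    ((f : Fin k ↣ (Fin n × Fin m)) →
    ∃[ r ] (IsSquareRoot r (θ₁ *ᴿ θ₁ +ᴿ θ₂ *ᴿ θ₂) ×
    r ≤ᴿ fromℕ (Δ (induced (signedCartesianProduct Γ₁ B Γ₂) f))))
    ×
    ((f′ : Fin k ↣ (Fin n × Fin m)) →
    ∃[ r ] (IsSquareRoot r ((θ₁ *ᴿ θ₁ +ᴿ fromℕ 1) *ᴿ (θ₂ *ᴿ θ₂)) ×
    r ≤ᴿ fromℕ (Δ (induced (signedSemiStrongProduct Γ₁ B Γ₂) f′))))
theorem1p2 {n} {m} Γ₁ B Γ₂ θ₁ θ₂ ±θ₁ ±θ₂ k 2k≡mn+2 =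
    (λ f → root-bound (d₁ + d₂) (Δ (induced (signedCartesianProduct Γ₁ B Γ₂) f))
      (Δ-bound (signedCartesianProduct Γ₁ B Γ₂) f nm<2k λ u v →
        trans (⊡-cong cartesian-entry cartesian-entry u v) (cartesian-square Γ₁ B Γ₂ {d₁} {d₂} A₁² A₂² u v))
      θ₁²+θ₂²)
  , (λ f → root-bound ((d₁ + 1) * d₂) (Δ (induced (signedSemiStrongProduct Γ₁ B Γ₂) f))
      (Δ-bound (signedSemiStrongProduct Γ₁ B Γ₂) f nm<2k λ u v →
        trans (⊡-cong semiStrong-entry semiStrong-entry u v) (semiStrong-square Γ₁ B Γ₂ {d₁} {d₂} A₁² A₂² u v))
      [θ₁²+1]θ₂²)
  where
  open OrderedℚAlgebra ℝ-algebra using (+-cong; *-cong) renaming (refl to ≈-refl; trans to ≈-trans)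
  square₁ = adjacency-square Γ₁ θ₁ ±θ₁
  square₂ = adjacency-square Γ₂ θ₂ ±θ₂
  d₁ = proj₁ square₁
  d₂ = proj₁ square₂
  A₁² = proj₁ (proj₂ square₁)
  A₂² = proj₁ (proj₂ square₂)
  d₁≋θ₁² : fromℕ d₁ ≋ θ₁ *ᴿ θ₁
  d₁≋θ₁² = ≈-trans (proj₂ (proj₂ square₁)) (⊠≋*ᴿ θ₁ θ₁)
  d₂≋θ₂² : fromℕ d₂ ≋ θ₂ *ᴿ θ₂
  d₂≋θ₂² = ≈-trans (proj₂ (proj₂ square₂)) (⊠≋*ᴿ θ₂ θ₂)
  θ₁²+θ₂² : fromℕ (d₁ + d₂) ≋ θ₁ *ᴿ θ₁ +ᴿ θ₂ *ᴿ θ₂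
  θ₁²+θ₂² = ≈-trans (fromℕ-+ d₁ d₂) (≈-trans (+-cong d₁≋θ₁² d₂≋θ₂²) (⊞≋+ᴿ _ _))
  [θ₁²+1]θ₂² : fromℕ ((d₁ + 1) * d₂) ≋ (θ₁ *ᴿ θ₁ +ᴿ fromℕ 1) *ᴿ (θ₂ *ᴿ θ₂)
  [θ₁²+1]θ₂² = ≈-trans (fromℕ-* (d₁ + 1) d₂) (≈-trans
    (*-cong (≈-trans (fromℕ-+ d₁ 1) (≈-trans (+-cong d₁≋θ₁² ≈-refl) (⊞≋+ᴿ _ _))) d₂≋θ₂²)
    (⊠≋*ᴿ _ _))
  cartesian-entry : ∀ u v → adjacencyMatrix (signedCartesianProduct Γ₁ B Γ₂) u v ≡ cartesianMatrix Γ₁ B Γ₂ u v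
  cartesian-entry = adjacencyMatrix-fromMatrix (cartesianMatrix Γ₁ B Γ₂) (cartesian-isSignedAdjacency Γ₁ B Γ₂)
  semiStrong-entry : ∀ u v → adjacencyMatrix (signedSemiStrongProduct Γ₁ B Γ₂) u v ≡ semiStrongMatrix Γ₁ B Γ₂ u v
  semiStrong-entry = adjacencyMatrix-fromMatrix (semiStrongMatrix Γ₁ B Γ₂) (semiStrong-isSignedAdjacency Γ₁ B Γ₂)
  -- `2 * k` computes to `k + (k + 0)`, and the summand `2` in the hypothesis on `k` makes the
  -- inequality strict: the set contains more than half of the vertices.
  nm<2k : n * m ℕ.< k + k
  nm<2k = subst₂ ℕ._<_ (ℕ.*-comm m n)
    (trans (sym 2k≡mn+2) (cong (λ z → k + z) (ℕ.+-identityʳ k)))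
    (ℕ.m<m+n (m * n) (ℕ.s≤s ℕ.z≤n))
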